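{- For every function $\gamma\colon \mathbb{N}\to[0,\infty)$ with $\gamma(n)=o(n)$ there exists a function $\eta\colon\mathbb{N}\to[0,\infty)$ with $\eta(n)=o(n)$ such that the following holds for every positive integer $n$ divisible by $3$. Let $\phi\colon \mathbb{F}_2^{n/3}\to\mathbb{F}_{2^{n/3}}$ be an $\mathbb{F}_2$-linear isomorphism and let $f\colon \{0,1\}^{n/3}\times\{0,1\}^{n/3}\times\{0,1\}^{n/3}\to\{0,1\}$ be defined by $f(x,y,z)=\operatorname{Tr}(\phi(x)\cdot\phi(y)\cdot\phi(z))$. Then for every $g\colon\{0,1\}^n\to\{0,1\}$ computed by a strongly read-once linear branching program of size at most $2^{\frac n3-\eta(n)}$, \[ \operatorname{dist}(f,g)\ge \frac12-2^{ -\gamma(n)}. \]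
   Context: Identify $\{0,1\}^n$ with $\mathbb{F}_2^n$. The trace map $\operatorname{Tr}\colon\mathbb{F}_{2^k}\to\mathbb{F}_2$ is $\operatorname{Tr}(x)=\sum_{i=0}^{k-1}x^{2^i}$. A linear branching program $\mathcal{P}$ in variables $x=(x_1,\dots,x_n)$ is a directed acyclic graph (parallel edges allowed) with exactly one source and two sinks, labeled $0$ and $1$; every inner (non-sink) node is labeled by a linear form over $\mathbb{F}_2$ in $x$, called its query, and has two outgoing edges labeled $0$ and $1$, representing the value of the query. Each input $x\in\{0,1\}^n$ defines a path from the source by following, at each node, the edge labeled with the value of the query on $x$. $\mathcal{P}$ computes $g$ if for every $x$ this path ends in the sink labeled $g(x)$. The size of $\mathcal{P}$ is its number of nodes. For an inner node $v$, $\operatorname{Pre}_v$ is the span of all queries that appear on any path from the source to $v$, excluding the query at $v$; $\operatorname{Post}_v$ is the span of all queries in the subprogram starting at $v$ (including the query at $v$). $\mathcal{P}$ is strongly read-once if for every inner node $v$, $\operatorname{Pre}_v\cap\operatorname{Post}_v=\{0\}$. $\operatorname{dist}(f,g)=|\{x\in\{0,1\}^n: f(x)\ne g(x)\}|/2^n$. -}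

module Defs where

open import Algebra.Apartness.Bundles using (HeytingField)
open import Algebra.Bundles using (CommutativeRing)
import Algebra.Properties.Monoid.Sum as MonoidSum
import Algebra.Properties.Semiring.Exp as SemiringExp
open import Data.Bool.Base using (Bool; true; false; _∧_; _xor_)
import Data.Bool.Properties as Bool
open import Data.Empty using (⊥)
open import Data.Fin.Base using (Fin; toℕ)
open import Data.Integer.Base as ℤ using (ℤ; +_; -[1+_])
import Data.Integer.Properties as ℤ
open import Data.List.Base using (List; []; _∷_; _++_; map; filter; length)
open import Data.Nat.Base as ℕ using (ℕ; zero; suc)
import Data.Nat.Properties as ℕ
open import Data.Product.Base using (∃; ∃₂; ∃-syntax; _×_; _,_; proj₁; proj₂)
open import Data.Rational.Base
open import Data.Rational.Properties hiding (heytingField)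
import Data.Rational.Unnormalised.Base as ℚᵘ
import Data.Rational.Unnormalised.Properties as ℚᵘ
open import Data.Rational.Solver using (module +-*-Solver)
open import Data.Sum.Base as Sum using (_⊎_; inj₁; inj₂)
open import Data.Vec.Base as Vec using (Vec; []; _∷_; replicate; zipWith; foldr′)
open import Function.Bundles using (Inverse)
open import Function.Definitions using (Bijective)
open import Level using (Level) renaming (suc to lsuc; _⊔_ to _⊔ˡ_)
open import Relation.Binary.Construct.Closure.ReflexiveTransitive using (Star)
open import Relation.Binary.Construct.Closure.Transitive using (TransClosure)
open import Relation.Binary.PropositionalEquality
  using (_≡_; refl; sym; trans; cong; cong₂; subst; subst₂; setoid)
open import Relation.Nullary using (¬_; yes; no; ¬?)

-- Dedekind cuts of ℚ; `lower q` means q < x, `upper q` means x < q.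
record ℝ : Set₁ where
  field
    lower upper     : ℚ → Set
    lower-inhabited : ∃ lower
    upper-inhabited : ∃ upper
    lower-closed    : ∀ {p q} → p < q → lower q → lower p
    upper-closed    : ∀ {p q} → p < q → upper p → upper q
    lower-open      : ∀ {p} → lower p → ∃[ q ] p < q × lower q
    upper-open      : ∀ {q} → upper q → ∃[ p ] p < q × upper p
    disjoint        : ∀ {q} → lower q → upper q → ⊥
    located         : ∀ {p q} → p < q → lower p ⊎ upper q

open ℝ public using (lower; upper)

infix 4 _≤ʳ_
_≤ʳ_ : ℝ → ℝ → Set
x ≤ʳ y = ∀ {q} → lower x q → lower y q

private
  p<p+1 : ∀ p → p < p + 1ℚ
  p<p+1 p = subst (_< p + 1ℚ) (+-identityʳ p) (+-monoʳ-< p {0ℚ} {1ℚ} (positive⁻¹ 1ℚ))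

  p-1<p : ∀ p → p - 1ℚ < p
  p-1<p p = subst (p - 1ℚ <_) (+-identityʳ p) (+-monoʳ-< p {(- 1ℚ)} {0ℚ} (negative⁻¹ (- 1ℚ)))

  -‿anti : ∀ c {p q} → p < q → c - q < c - p
  -‿anti c p<q = +-monoʳ-< c (neg-antimono-< p<q)

  c-[c-p] : ∀ c p → c - (c - p) ≡ p
  c-[c-p] = solve 2 (λ c p → c :- (c :- p) := p) refl where open +-*-Solver

fromℚ : ℚ → ℝ
fromℚ q = record
  { lower           = _< q
  ; upper           = q <_
  ; lower-inhabited = q - 1ℚ , p-1<p q
  ; upper-inhabited = q + 1ℚ , p<p+1 q
  ; lower-closed    = <-trans
  ; upper-closed    = λ p<r q<p → <-trans q<p p<r
  ; lower-open      = λ p<q → let (r , p<r , r<q) = <-dense p<q in r , p<r , r<q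
  ; upper-open      = λ q<p → let (r , q<r , r<p) = <-dense q<p in r , r<p , q<r
  ; disjoint        = <-asym
  ; located         = loc
  }
  where
  loc : ∀ {p r} → p < r → p < q ⊎ q < r
  loc {p} p<r with p <? q
  ... | yes p<q = inj₁ p<q
  ... | no  p≮q = inj₂ (≤-<-trans (≮⇒≥ p≮q) p<r)

0ʳ : ℝ
0ʳ = fromℚ 0ℚ

infixl 6 _-ʳ_
_-ʳ_ : ℚ → ℝ → ℝ
c -ʳ x = record
  { lower           = λ q → upper x (c - q)
  ; upper           = λ q → lower x (c - q)
  ; lower-inhabited = let (u , xu) = X.upper-inhabited in
                      c - u , subst (upper x) (sym (c-[c-p] c u)) xu
  ; upper-inhabited = let (l , lx) = X.lower-inhabited in
                      c - l , subst (lower x) (sym (c-[c-p] c l)) lx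
  ; lower-closed    = λ p<q → X.upper-closed (-‿anti c p<q)
  ; upper-closed    = λ p<q → X.lower-closed (-‿anti c p<q)
  ; lower-open      = λ {p} u → let (r , r<c-p , xr) = X.upper-open u in
                      c - r
                      , subst (_< c - r) (c-[c-p] c p) (-‿anti c r<c-p)
                      , subst (upper x) (sym (c-[c-p] c r)) xr
  ; upper-open      = λ {q} l → let (r , c-q<r , rx) = X.lower-open l in
                      c - r
                      , subst (c - r <_) (c-[c-p] c q) (-‿anti c c-q<r)
                      , subst (lower x) (sym (c-[c-p] c r)) rx
  ; disjoint        = λ u l → X.disjoint l u
  ; located         = λ p<q → Sum.swap (X.located (-‿anti c p<q))
  }
  where
  module X = ℝ x

negʳ : ℝ → ℝ
negʳ x = 0ℚ -ʳ x

open SemiringExp (CommutativeRing.semiring +-*-commutativeRing) public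
  using () renaming (_^_ to _^ℚ_)

2ℚ : ℚ
2ℚ = + 2 / 1

exp2 : ℤ → ℚ
exp2 (+ n)    = 2ℚ ^ℚ n
exp2 -[1+ n ] = ½ ^ℚ suc n

-- For r ≥ 0 these compare r with 2^(p/m), where e is the fraction p/m.
_≤2^_ _≥2^_ : ℚ → ℚᵘ.ℚᵘ → Set
r ≤2^ e = r ^ℚ ℚᵘ.↧ₙ e ≤ exp2 (ℚᵘ.↥ e)
r ≥2^ e = exp2 (ℚᵘ.↥ e) ≤ r ^ℚ ℚᵘ.↧ₙ e

module Exp2 where
  open SemiringExp (CommutativeRing.semiring +-*-commutativeRing)
    using (^-assocʳ)

  0≤⇒nn : ∀ {p} → 0ℚ ≤ p → NonNegative p
  0≤⇒nn = nonNegative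
  0<⇒pos : ∀ {p} → 0ℚ < p → Positive p
  0<⇒pos = positive

  *-mono : ∀ {a b c d} → 0ℚ ≤ b → 0ℚ ≤ c → a ≤ b → c ≤ d → a * c ≤ b * d
  *-mono {a} {b} {c} {d} 0≤b 0≤c a≤b c≤d = ≤-trans
    (*-monoʳ-≤-nonNeg c {{0≤⇒nn 0≤c}} a≤b)
    (*-monoˡ-≤-nonNeg b {{0≤⇒nn 0≤b}} c≤d)

  *-nn : ∀ {a b} → 0ℚ ≤ a → 0ℚ ≤ b → 0ℚ ≤ a * b
  *-nn {a} {b} 0≤a 0≤b = subst (_≤ a * b) (*-zeroʳ a) (*-monoˡ-≤-nonNeg a {{0≤⇒nn 0≤a}} 0≤b)

  *-pos : ∀ {a b} → 0ℚ < a → 0ℚ < b → 0ℚ < a * b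
  *-pos {a} {b} 0<a 0<b = subst (_< a * b) (*-zeroʳ a) (*-monoʳ-<-pos a {{0<⇒pos 0<a}} 0<b)

  +-nn : ∀ {a b} → 0ℚ ≤ a → 0ℚ ≤ b → 0ℚ ≤ a + b
  +-nn {a} {b} 0≤a 0≤b = subst (_≤ a + b) (+-identityʳ 0ℚ) (+-mono-≤ 0≤a 0≤b)

  0<1 : 0ℚ < 1ℚ
  0<1 = positive⁻¹ 1ℚ
  0<2 : 0ℚ < 2ℚ
  0<2 = positive⁻¹ 2ℚ
  0<½ : 0ℚ < ½
  0<½ = positive⁻¹ ½
  1≤2 : 1ℚ ≤ 2ℚ
  1≤2 = ≤ᵇ⇒≤ _
  ½≤1 : ½ ≤ 1ℚ
  ½≤1 = ≤ᵇ⇒≤ _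

  ^-pos : ∀ {a} → 0ℚ < a → ∀ n → 0ℚ < a ^ℚ n
  ^-pos 0<a zero    = 0<1
  ^-pos 0<a (suc n) = *-pos 0<a (^-pos 0<a n)

  ^-nn : ∀ {a} → 0ℚ ≤ a → ∀ n → 0ℚ ≤ a ^ℚ n
  ^-nn 0≤a zero    = <⇒≤ 0<1
  ^-nn 0≤a (suc n) = *-nn 0≤a (^-nn 0≤a n)

  ^-mono-≤ : ∀ {a b} → 0ℚ ≤ a → a ≤ b → ∀ n → a ^ℚ n ≤ b ^ℚ n
  ^-mono-≤ 0≤a a≤b zero    = ≤-refl
  ^-mono-≤ 0≤a a≤b (suc n) = *-mono (≤-trans 0≤a a≤b) (^-nn 0≤a n) a≤b (^-mono-≤ 0≤a a≤b n)

  ^-mono-< : ∀ {a b} → 0ℚ ≤ a → a < b → ∀ n .{{_ : ℕ.NonZero n}} → a ^ℚ n < b ^ℚ n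
  ^-mono-< {a} {b} 0≤a a<b (suc n) = ≤-<-trans
    (*-monoˡ-≤-nonNeg a {{0≤⇒nn 0≤a}} (^-mono-≤ 0≤a (<⇒≤ a<b) n))
    (*-monoˡ-<-pos (b ^ℚ n) {{0<⇒pos (^-pos (≤-<-trans 0≤a a<b) n)}} a<b)

  1≤^ : ∀ {a} → 1ℚ ≤ a → ∀ n → 1ℚ ≤ a ^ℚ n
  1≤^ 1≤a zero    = ≤-refl
  1≤^ 1≤a (suc n) = *-mono (≤-trans (<⇒≤ 0<1) 1≤a) (<⇒≤ 0<1) 1≤a (1≤^ 1≤a n)

  ^≤1 : ∀ {a} → 0ℚ ≤ a → a ≤ 1ℚ → ∀ n → a ^ℚ n ≤ 1ℚ
  ^≤1 0≤a a≤1 zero    = ≤-refl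
  ^≤1 0≤a a≤1 (suc n) = *-mono (<⇒≤ 0<1) (^-nn 0≤a n) a≤1 (^≤1 0≤a a≤1 n)

  a≤a^ : ∀ {a} → 1ℚ ≤ a → ∀ n → a ≤ a ^ℚ suc n
  a≤a^ {a} 1≤a n = subst (_≤ a * a ^ℚ n) (*-identityʳ a)
    (*-monoˡ-≤-nonNeg a {{0≤⇒nn (≤-trans (<⇒≤ 0<1) 1≤a)}} (1≤^ 1≤a n))

  0^ : ∀ n → 0ℚ ^ℚ suc n ≡ 0ℚ
  0^ n = *-zeroˡ (0ℚ ^ℚ n)

  2^-mono : ∀ {m n} → m ℕ.≤ n → 2ℚ ^ℚ m ≤ 2ℚ ^ℚ n
  2^-mono {n = n} ℕ.z≤n = 1≤^ 1≤2 n
  2^-mono (ℕ.s≤s m≤n)   = *-monoˡ-≤-nonNeg 2ℚ (2^-mono m≤n)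

  ½^-anti : ∀ {m n} → m ℕ.≤ n → ½ ^ℚ n ≤ ½ ^ℚ m
  ½^-anti {n = n} ℕ.z≤n = ^≤1 (<⇒≤ 0<½) ½≤1 n
  ½^-anti (ℕ.s≤s m≤n)   = *-monoˡ-≤-nonNeg ½ (½^-anti m≤n)

  exp2-mono : ∀ {i j} → i ℤ.≤ j → exp2 i ≤ exp2 j
  exp2-mono (ℤ.-≤- n≤m)           = ½^-anti (ℕ.s≤s n≤m)
  exp2-mono (ℤ.-≤+ {m} {n})       = ≤-trans (^≤1 (<⇒≤ 0<½) ½≤1 (suc m)) (1≤^ 1≤2 n)
  exp2-mono (ℤ.+≤+ m≤n)           = 2^-mono m≤n

  exp2-pos : ∀ i → 0ℚ < exp2 i
  exp2-pos (+ n)    = ^-pos 0<2 n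
  exp2-pos -[1+ n ] = ^-pos 0<½ (suc n)

  exp2-neg : ∀ n → exp2 (ℤ.- (+ n)) ≡ ½ ^ℚ n
  exp2-neg zero    = refl
  exp2-neg (suc n) = refl

  exp2-^ : ∀ i m → exp2 i ^ℚ m ≡ exp2 (i ℤ.* + m)
  exp2-^ (+ n) m = trans (^-assocʳ 2ℚ n m) (cong exp2 (ℤ.pos-* n m))
  exp2-^ -[1+ n ] m = trans (^-assocʳ ½ (suc n) m) (trans (sym (exp2-neg (suc n ℕ.* m)))
    (cong exp2 (trans (cong ℤ.-_ (ℤ.pos-* (suc n) m)) (ℤ.neg-distribˡ-* (+ suc n) (+ m)))))

  2*½* : ∀ a → 2ℚ * (½ * a) ≡ a
  2*½* a = trans (sym (*-assoc 2ℚ ½ a)) (*-identityˡ a)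

  exp2-suc : ∀ i → exp2 (ℤ.suc i) ≡ 2ℚ * exp2 i
  exp2-suc (+ n)        = refl
  exp2-suc -[1+ zero ]  = refl
  exp2-suc -[1+ suc n ] = sym (2*½* (½ ^ℚ suc n))

  ½^*2^ : ∀ n → ½ ^ℚ n * 2ℚ ^ℚ n ≡ 1ℚ
  ½^*2^ zero    = refl
  ½^*2^ (suc n) = trans
    (solve 4 (λ h a t b → (h :* a) :* (t :* b) := (t :* (h :* (a :* b)))) refl ½ (½ ^ℚ n) 2ℚ (2ℚ ^ℚ n))
    (trans (2*½* (½ ^ℚ n * 2ℚ ^ℚ n)) (½^*2^ n))
    where open +-*-Solver

  exp2-⊖ : ∀ j n → exp2 (j ℤ.⊖ n) * 2ℚ ^ℚ n ≡ 2ℚ ^ℚ j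
  exp2-⊖ j       zero    = *-identityʳ (2ℚ ^ℚ j)
  exp2-⊖ zero    (suc n) = ½^*2^ (suc n)
  exp2-⊖ (suc j) (suc n) = trans
    (cong (λ i → exp2 i * 2ℚ ^ℚ suc n) (ℤ.[1+m]⊖[1+n]≡m⊖n j n))
    (trans (solve 3 (λ e t a → e :* (t :* a) := t :* (e :* a)) refl (exp2 (j ℤ.⊖ n)) 2ℚ (2ℚ ^ℚ n))
           (cong (2ℚ *_) (exp2-⊖ j n)))
    where open +-*-Solver

  fromℕ : ℕ → ℚ
  fromℕ n = + n / 1

  fromℕ-suc : ∀ n → fromℕ (suc n) ≡ 1ℚ + fromℕ n
  fromℕ-suc n = toℚᵘ-injective (ℚᵘ.≃-trans (toℚᵘ-fromℚᵘ (ℚᵘ.mkℚᵘ (+ suc n) 0))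
    (ℚᵘ.≃-sym (ℚᵘ.≃-trans (toℚᵘ-homo-+ 1ℚ (fromℕ n))
      (ℚᵘ.≃-trans (ℚᵘ.+-congʳ ℚᵘ.1ℚᵘ (toℚᵘ-fromℚᵘ (ℚᵘ.mkℚᵘ (+ n) 0)))
        (ℚᵘ.*≡* (cong (ℤ._* + 1) (cong (λ i → + 1 ℤ.+ i) (ℤ.*-identityʳ (+ n)))))))))

  fromℕ-nn : ∀ n → 0ℚ ≤ fromℕ n
  fromℕ-nn zero    = ≤-refl
  fromℕ-nn (suc n) = subst (0ℚ ≤_) (sym (fromℕ-suc n)) (+-nn (<⇒≤ 0<1) (fromℕ-nn n))

  fromℕ≤2^ : ∀ n → fromℕ n ≤ 2ℚ ^ℚ n
  fromℕ≤2^ zero    = <⇒≤ 0<1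
  fromℕ≤2^ (suc n) = subst₂ _≤_ (sym (fromℕ-suc n)) (double (2ℚ ^ℚ n))
    (+-mono-≤ (1≤^ 1≤2 n) (fromℕ≤2^ n))
    where
    double : ∀ a → a + a ≡ 2ℚ * a
    double a = sym (trans (*-distribʳ-+ a 1ℚ 1ℚ) (cong₂ _+_ (*-identityˡ a) (*-identityˡ a)))

  ≤fromℕ : ∀ q → ∃[ n ] q ≤ fromℕ (suc n)
  ≤fromℕ q = ℤ.∣ ↥ q ∣ , toℚᵘ-cancel-≤ (ℚᵘ.≤-respʳ-≃
    (ℚᵘ.≃-sym (toℚᵘ-fromℚᵘ (ℚᵘ.mkℚᵘ (+ suc ℤ.∣ ↥ q ∣) 0)))
    (bound (toℚᵘ q) (ℤ.∣ ↥ q ∣) (cong ℤ.∣_∣ (↥ᵘ-toℚᵘ q))))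
    where
    bound : ∀ u n → ℤ.∣ ℚᵘ.↥ u ∣ ≡ n → u ℚᵘ.≤ ℚᵘ.mkℚᵘ (+ suc n) 0
    bound (ℚᵘ.mkℚᵘ (+ n) d)    .n       refl = ℚᵘ.*≤* (subst₂ ℤ._≤_
      (sym (ℤ.*-identityʳ (+ n))) (ℤ.pos-* (suc n) (suc d))
      (ℤ.+≤+ (ℕ.≤-trans (ℕ.n≤1+n n) (ℕ.m≤m*n (suc n) (suc d)))))
    bound (ℚᵘ.mkℚᵘ -[1+ n ] d) .(suc n) refl = ℚᵘ.*≤* ℤ.-≤+

  archimedean : ∀ c {d} → 0ℚ < d → ∃[ n ] c ≤ fromℕ (suc n) * d
  archimedean c {d} 0<d = n , subst (_≤ fromℕ (suc n) * d) c/d*d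
    (*-monoʳ-≤-nonNeg d {{0≤⇒nn (<⇒≤ 0<d)}} c/d≤)
    where
    instance
      d≢0 : NonZero d
      d≢0 = pos⇒nonZero d {{0<⇒pos 0<d}}
    bnd = ≤fromℕ (c * 1/ d)
    n = proj₁ bnd
    c/d≤ = proj₂ bnd
    c/d*d : c * 1/ d * d ≡ c
    c/d*d = trans (*-assoc c (1/ d) d) (trans (cong (c *_) (*-inverseˡ d)) (*-identityʳ c))

  log₂-ℕ : ∀ n {u} → 1ℚ ≤ u → u ≤ 2ℚ ^ℚ n → ∃[ j ] u ≤ 2ℚ ^ℚ j × 2ℚ ^ℚ j ≤ 2ℚ * u
  log₂-ℕ zero {u} 1≤u u≤1 = 0 , u≤1 , ≤-trans 1≤u
    (subst (_≤ 2ℚ * u) (*-identityˡ u) (*-monoʳ-≤-nonNeg u {{0≤⇒nn (≤-trans (<⇒≤ 0<1) 1≤u)}} 1≤2))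
  log₂-ℕ (suc n) {u} 1≤u u≤2^ with u ≤? 2ℚ ^ℚ n
  ... | yes u≤ = log₂-ℕ n 1≤u u≤
  ... | no  u≰ = suc n , u≤2^ , *-monoˡ-≤-nonNeg 2ℚ (<⇒≤ (≰⇒> u≰))

  log₂ : ∀ {t} → 0ℚ < t → ∃[ i ] t ≤ exp2 i × exp2 i ≤ 2ℚ * t
  log₂ {t} 0<t = j ℤ.⊖ m , cancel lo , cancel′ hi
    where
    M : ∃[ m ] 1ℚ ≤ t * 2ℚ ^ℚ m
    M = let (n , 1≤) = archimedean 1ℚ 0<t in suc n ,
        ≤-trans 1≤ (subst (_≤ t * 2ℚ ^ℚ suc n) (*-comm t (fromℕ (suc n)))
          (*-monoˡ-≤-nonNeg t {{0≤⇒nn (<⇒≤ 0<t)}} (fromℕ≤2^ (suc n))))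
    m = proj₁ M
    u = t * 2ℚ ^ℚ m
    J : ∃[ j ] u ≤ 2ℚ ^ℚ j × 2ℚ ^ℚ j ≤ 2ℚ * u
    J = let (n , u≤) = ≤fromℕ u in
        log₂-ℕ (suc n) (proj₂ M) (≤-trans u≤ (fromℕ≤2^ (suc n)))
    j = proj₁ J
    lo : t * 2ℚ ^ℚ m ≤ exp2 (j ℤ.⊖ m) * 2ℚ ^ℚ m
    lo = subst (u ≤_) (sym (exp2-⊖ j m)) (proj₁ (proj₂ J))
    hi : exp2 (j ℤ.⊖ m) * 2ℚ ^ℚ m ≤ 2ℚ * t * 2ℚ ^ℚ m
    hi = subst₂ _≤_ (sym (exp2-⊖ j m)) (sym (*-assoc 2ℚ t (2ℚ ^ℚ m))) (proj₂ (proj₂ J))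
    cancel : t * 2ℚ ^ℚ m ≤ exp2 (j ℤ.⊖ m) * 2ℚ ^ℚ m → t ≤ exp2 (j ℤ.⊖ m)
    cancel = *-cancelʳ-≤-pos (2ℚ ^ℚ m) {{0<⇒pos (^-pos 0<2 m)}}
    cancel′ : exp2 (j ℤ.⊖ m) * 2ℚ ^ℚ m ≤ 2ℚ * t * 2ℚ ^ℚ m → exp2 (j ℤ.⊖ m) ≤ 2ℚ * t
    cancel′ = *-cancelʳ-≤-pos (2ℚ ^ℚ m) {{0<⇒pos (^-pos 0<2 m)}}

  bernoulli : ∀ {r d} → 0ℚ ≤ r → 0ℚ ≤ d → ∀ n →
              r ^ℚ n * (r + fromℕ n * d) ≤ (r + d) ^ℚ n * r
  bernoulli {r} {d} 0≤r 0≤d zero = ≤-reflexive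
    (cong (1ℚ *_) (trans (cong (λ z → r + z) (*-zeroˡ d)) (+-identityʳ r)))
  bernoulli {r} {d} 0≤r 0≤d (suc n) = ≤-trans
    (subst₂ _≤_ (trans (+-identityʳ _) (sym (cong (λ k → r * A * (r + k * d)) (fromℕ-suc n)))) split
      (+-monoʳ-≤ (r * A * (r + (1ℚ + N) * d))
        (*-nn (*-nn (*-nn 0≤d 0≤d) (fromℕ-nn n)) (^-nn 0≤r n))))
    (subst ((r + d) * (A * (r + N * d)) ≤_) (sym (*-assoc (r + d) ((r + d) ^ℚ n) r))
      (*-monoˡ-≤-nonNeg (r + d) {{0≤⇒nn (+-nn 0≤r 0≤d)}} (bernoulli 0≤r 0≤d n)))
    where
    A = r ^ℚ n
    N = fromℕ n
    open +-*-Solver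
    split : r * A * (r + (1ℚ + N) * d) + d * d * N * A ≡ (r + d) * (A * (r + N * d))
    split = solve 4 (λ r d A N →
      r :* A :* (r :+ (con 1ℚ :+ N) :* d) :+ d :* d :* N :* A := (r :+ d) :* (A :* (r :+ N :* d)))
      refl r d A N

  power-gap : ∀ {r s} → 0ℚ < r → r < s → ∃[ n ] 2ℚ * (2ℚ * r ^ℚ suc n) ≤ s ^ℚ suc n
  power-gap {r} {s} 0<r r<s = n , *-cancelʳ-≤-pos r {{0<⇒pos 0<r}}
    (≤-trans (≤-trans (≤-reflexive rearrange)
       (*-monoˡ-≤-nonNeg (r ^ℚ suc n) {{0≤⇒nn (^-nn (<⇒≤ 0<r) (suc n))}}
         (+-monoʳ-≤ r 3r≤)))
     (subst (λ z → r ^ℚ suc n * (r + fromℕ (suc n) * d) ≤ z ^ℚ suc n * r) r+d≡s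
       (bernoulli (<⇒≤ 0<r) (<⇒≤ 0<d) (suc n))))
    where
    open +-*-Solver
    d = s - r
    0<d : 0ℚ < d
    0<d = subst (_< d) (+-inverseʳ r) (+-monoˡ-< (- r) r<s)
    r+d≡s : r + d ≡ s
    r+d≡s = solve 2 (λ r s → r :+ (s :- r) := s) refl r s
    arch = archimedean (r + (r + r)) 0<d
    n = proj₁ arch
    3r≤ = proj₂ arch
    rearrange : 2ℚ * (2ℚ * r ^ℚ suc n) * r ≡ r ^ℚ suc n * (r + (r + (r + r)))
    rearrange = solve 2 (λ r A →
      con 2ℚ :* (con 2ℚ :* A) :* r := A :* (r :+ (r :+ (r :+ r)))) refl r (r ^ℚ suc n)

  ℚᵘ-< : ∀ e f → fromℚᵘ e < fromℚᵘ f → ℚᵘ.↥ e ℤ.* ℚᵘ.↧ f ℤ.< ℚᵘ.↥ f ℤ.* ℚᵘ.↧ e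
  ℚᵘ-< e f lt = ℚᵘ.drop-*<* (ℚᵘ.<-respˡ-≃ (toℚᵘ-fromℚᵘ e)
    (ℚᵘ.<-respʳ-≃ (toℚᵘ-fromℚᵘ f) (toℚᵘ-mono-< lt)))

  /-suc-< : ∀ i n → fromℚᵘ (ℚᵘ.mkℚᵘ i n) < fromℚᵘ (ℚᵘ.mkℚᵘ (ℤ.suc i) n)
  /-suc-< i n = toℚᵘ-cancel-<
    (ℚᵘ.<-respˡ-≃ (ℚᵘ.≃-sym (toℚᵘ-fromℚᵘ (ℚᵘ.mkℚᵘ i n)))
    (ℚᵘ.<-respʳ-≃ (ℚᵘ.≃-sym (toℚᵘ-fromℚᵘ (ℚᵘ.mkℚᵘ (ℤ.suc i) n)))
    (ℚᵘ.*<* (ℤ.*-monoʳ-<-pos (+ suc n) {i} {ℤ.suc i} (ℤ.suc[i]≤j⇒i<j ℤ.≤-refl)))))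

  2^-disjoint : ∀ {r s} e f → fromℚᵘ e < fromℚᵘ f → 0ℚ ≤ s → s < r →
                0ℚ ≤ r → r ≤2^ e → s ≥2^ f → ⊥
  2^-disjoint {r} {s} e@(ℚᵘ.mkℚᵘ p m) f@(ℚᵘ.mkℚᵘ p′ m′) e<f 0≤s s<r 0≤r r≤ s≥ =
    <-irrefl refl (≤-<-trans chain (^-mono-< 0≤s s<r (suc m ℕ.* suc m′)))
    where
    rN≤ : r ^ℚ (suc m ℕ.* suc m′) ≤ exp2 (p ℤ.* + suc m′)
    rN≤ = subst₂ _≤_ (^-assocʳ r (suc m) (suc m′)) (exp2-^ p (suc m′))
      (^-mono-≤ (^-nn 0≤r (suc m)) r≤ (suc m′))
    ≤sN : exp2 (p′ ℤ.* + suc m) ≤ s ^ℚ (suc m ℕ.* suc m′)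
    ≤sN = subst₂ _≤_ (exp2-^ p′ (suc m))
      (trans (^-assocʳ s (suc m′) (suc m)) (cong (s ^ℚ_) (ℕ.*-comm (suc m′) (suc m))))
      (^-mono-≤ (<⇒≤ (exp2-pos p′)) s≥ (suc m))
    chain : r ^ℚ (suc m ℕ.* suc m′) ≤ s ^ℚ (suc m ℕ.* suc m′)
    chain = ≤-trans rN≤ (≤-trans (exp2-mono (ℤ.<⇒≤ (ℚᵘ-< e f e<f))) ≤sN)

open Exp2

-- q < 2^x iff q < r ≤ 2^e for some r ≥ 0 and some rational e < x; dually for x < q.
infixr 8 2^_
2^_ : ℝ → ℝ
2^ x = record
  { lower           = low
  ; upper           = upp
  ; lower-inhabited = - 1ℚ , low-neg (negative⁻¹ (- 1ℚ))
  ; upper-inhabited = upp-inhabited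
  ; lower-closed    = λ { p<q (e , r , lx , q<r , rest) → e , r , lx , <-trans p<q q<r , rest }
  ; upper-closed    = λ { p<q (e , r , xu , r<p , rest) → e , r , xu , <-trans r<p p<q , rest }
  ; lower-open      = λ { (e , r , lx , p<r , rest) → let (q , p<q , q<r) = <-dense p<r in
                        q , p<q , e , r , lx , q<r , rest }
  ; upper-open      = λ { (e , r , xu , r<q , rest) → let (p , r<p , p<q) = <-dense r<q in
                        p , p<q , e , r , xu , r<p , rest }
  ; disjoint        = disj
  ; located         = loc
  }
  where
  module X = ℝ x

  low upp : ℚ → Set
  low q = ∃₂ λ e r → lower x (fromℚᵘ e) × q < r × 0ℚ ≤ r × r ≤2^ e
  upp q = ∃₂ λ e r → upper x (fromℚᵘ e) × r < q × 0ℚ ≤ r × r ≥2^ e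

  low-neg : ∀ {q} → q < 0ℚ → low q
  low-neg q<0 with X.lower-inhabited
  ... | l , lx = toℚᵘ l , 0ℚ , subst (lower x) (sym (fromℚᵘ-toℚᵘ l)) lx , q<0 , ≤-refl
               , subst (_≤ exp2 (ℚᵘ.↥ (toℚᵘ l))) (sym (0^ (ℚᵘ.ℚᵘ.denominator-1 (toℚᵘ l)))) (<⇒≤ (exp2-pos (ℚᵘ.↥ (toℚᵘ l))))

  upp-inhabited : ∃ upp
  upp-inhabited with X.upper-inhabited
  ... | u , xu = r + 1ℚ , toℚᵘ u , r , subst (upper x) (sym (fromℚᵘ-toℚᵘ u)) xu , p<p+1 r
               , ≤-trans (<⇒≤ 0<1) 1≤r , ≤-trans t≤r (a≤a^ 1≤r (ℚᵘ.ℚᵘ.denominator-1 (toℚᵘ u)))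
    where
    t = exp2 (ℚᵘ.↥ (toℚᵘ u))
    r = 1ℚ + t
    1≤r : 1ℚ ≤ r
    1≤r = subst (_≤ r) (+-identityʳ 1ℚ) (+-monoʳ-≤ 1ℚ (<⇒≤ (exp2-pos (ℚᵘ.↥ (toℚᵘ u)))))
    t≤r : t ≤ r
    t≤r = subst (_≤ r) (+-identityˡ t) (+-monoˡ-≤ t (<⇒≤ 0<1))

  disj : ∀ {q} → low q → upp q → ⊥
  disj (e , r , le , q<r , 0≤r , r≤) (f , s , uf , s<q , 0≤s , s≥) =
    2^-disjoint e f e<f 0≤s (<-trans s<q q<r) 0≤r r≤ s≥
    where
    e<f : fromℚᵘ e < fromℚᵘ f
    e<f with fromℚᵘ e <? fromℚᵘ f
    ... | yes lt = lt
    ... | no  ¬lt with X.upper-open uf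
    ...   | g , g<f , ug with X.disjoint (X.lower-closed (<-≤-trans g<f (≮⇒≥ ¬lt)) le) ug
    ...     | ()

  cut-at : ∀ {p q r s} → p < r → 0ℚ < r → 0ℚ ≤ s → s < q →
           ∃[ n ] 2ℚ * (2ℚ * r ^ℚ suc n) ≤ s ^ℚ suc n → low p ⊎ upp q
  cut-at {p} {q} {r} {s} p<r 0<r 0≤s s<q (n , gap) = choose (log₂ (^-pos 0<r (suc n)))
    where
    choose : ∃[ i ] r ^ℚ suc n ≤ exp2 i × exp2 i ≤ 2ℚ * r ^ℚ suc n → low p ⊎ upp q
    choose (i , r≤ , ≤2r) = Sum.map
      (λ l → ℚᵘ.mkℚᵘ i n , r , l , p<r , <⇒≤ 0<r , r≤)
      (λ u → ℚᵘ.mkℚᵘ (ℤ.suc i) n , s , u , s<q , 0≤s , s≥)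
      (X.located (/-suc-< i n))
      where
      s≥ : exp2 (ℤ.suc i) ≤ s ^ℚ suc n
      s≥ = subst (_≤ s ^ℚ suc n) (sym (exp2-suc i)) (≤-trans (*-monoˡ-≤-nonNeg 2ℚ ≤2r) gap)

  loc : ∀ {p q} → p < q → low p ⊎ upp q
  loc {p} {q} p<q = split (<-dense p<q)
    where
    split : ∃[ r ] p < r × r < q → low p ⊎ upp q
    split (r , p<r , r<q) with 0ℚ <? r
    ... | no  r≤0 = inj₁ (low-neg (<-≤-trans p<r (≮⇒≥ r≤0)))
    ... | yes 0<r = between (<-dense r<q)
      where
      between : ∃[ s ] r < s × s < q → low p ⊎ upp q
      between (s , r<s , s<q) =
        cut-at p<r 0<r (<⇒≤ (<-trans 0<r r<s)) s<q (power-gap 0<r r<s)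

-- There is no absolute value: the notion is meant for nonnegative γ only.
IsLittleO-n : (ℕ → ℝ) → Set
IsLittleO-n γ = ∀ (ε : ℚ) → 0ℚ < ε →
  ∃[ N ] (∀ n → N ℕ.≤ n → γ n ≤ʳ fromℚ (ε * (+ n / 1)))

-- 𝔽₂ is Bool with _xor_ and _∧_; a linear form is its coefficient vector.
LinearForm : ℕ → Set
LinearForm n = Vec Bool n

_⊕_ : ∀ {n} → Vec Bool n → Vec Bool n → Vec Bool n
_⊕_ = zipWith _xor_

𝟎 : ∀ {n} → Vec Bool n
𝟎 = replicate _ false

⟨_,_⟩ : ∀ {n} → LinearForm n → Vec Bool n → Bool
⟨ a , x ⟩ = foldr′ _xor_ false (zipWith _∧_ a x)

-- Closure under scalar multiplication is automatic over 𝔽₂.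
data Span {n} (S : LinearForm n → Set) : LinearForm n → Set where
  gen  : ∀ {a} → S a → Span S a
  zero : Span S 𝟎
  add  : ∀ {a b} → Span S a → Span S b → Span S (a ⊕ b)

data Node (n size : ℕ) : Set where
  sink  : Bool → Node n size
  inner : (query : LinearForm n) (next : Bool → Fin size) → Node n size

module Digraph {n size} (node : Fin size → Node n size) where

  data _⟶_ (u : Fin size) : Fin size → Set where
    edge : ∀ {query next} → node u ≡ inner query next → (b : Bool) → u ⟶ next b

  IsSource : Fin size → Set
  IsSource v = ∀ u → ¬ (u ⟶ v)

record LBP (n : ℕ) : Set where
  field
    size : ℕ
    node : Fin size → Node n size

  open Digraph node public

  field
    acyclic       : ∀ v → ¬ TransClosure _⟶_ v v
    source        : Fin size
    isSource      : IsSource source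
    source-unique : ∀ v → IsSource v → v ≡ source
    sinkOf        : Bool → Fin size
    isSink        : ∀ b → node (sinkOf b) ≡ sink b
    sink-unique   : ∀ b v → node v ≡ sink b → v ≡ sinkOf b

  data Step (x : Vec Bool n) (u : Fin size) : Fin size → Set where
    step : ∀ {a next} → node u ≡ inner a next → Step x u (next ⟨ a , x ⟩)

  Computes : (Vec Bool n → Bool) → Set
  Computes g = ∀ x → Star (Step x) source (sinkOf (g x))

  -- By acyclicity, u ⟶⁺ v is the same as u ⟶* v with u ≠ v.
  PreQuery : Fin size → LinearForm n → Set
  PreQuery v a = ∃₂ λ u next →
    node u ≡ inner a next × Star _⟶_ source u × TransClosure _⟶_ u v

  PostQuery : Fin size → LinearForm n → Set
  PostQuery v a = ∃₂ λ u next → node u ≡ inner a next × Star _⟶_ v u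

  Pre Post : Fin size → LinearForm n → Set
  Pre v  = Span (PreQuery v)
  Post v = Span (PostQuery v)

  StronglyReadOnce : Set
  StronglyReadOnce = ∀ v {a next} → node v ≡ inner a next →
    ∀ w → Pre v w → Post v w → w ≡ 𝟎

open LBP public using (size; Computes; StronglyReadOnce)

cube : ∀ n → List (Vec Bool n)
cube zero    = [] ∷ []
cube (suc n) = map (false ∷_) (cube n) ++ map (true ∷_) (cube n)

dist : ∀ {n} → (Vec Bool n → Bool) → (Vec Bool n → Bool) → ℚ
dist {n} f g =
  (+ length (filter (λ x → ¬? (f x Bool.≟ g x)) (cube n))) / (2 ℕ.^ n)
  where instance _ = ℕ.m^n≢0 2 n

-- A field with 2^k elements.  Its equality is decidable by the enumeration, so
-- the apartness is the negation of equality and the Heyting field is a field.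
record BinaryField (c ℓ₁ ℓ₂ : Level) (k : ℕ) : Set (lsuc (c ⊔ˡ ℓ₁ ⊔ˡ ℓ₂)) where
  field
    heytingField : HeytingField c ℓ₁ ℓ₂

  open HeytingField heytingField public
    using (Carrier; _≈_; _#_; 0#; 1#)
    renaming (_+_ to infixl 6 _+ᶠ_; _*_ to infixl 7 _*ᶠ_; -_ to infix 8 -ᶠ_)

  commutativeRing : CommutativeRing c ℓ₁
  commutativeRing = record
    { isCommutativeRing = HeytingField.isCommutativeRing heytingField }

  field
    enumeration : Inverse (setoid (Fin (2 ℕ.^ k))) (CommutativeRing.setoid commutativeRing)

module _ {c ℓ₁ ℓ₂ k} (F : BinaryField c ℓ₁ ℓ₂ k) where
  open BinaryField F
  open SemiringExp (CommutativeRing.semiring commutativeRing) using (_^_)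
  open MonoidSum (CommutativeRing.+-monoid commutativeRing) using (sum-syntax)

  ι : Bool → Carrier
  ι false = 0#
  ι true  = 1#

  -- Valued in F rather than 𝔽₂; the values lie in the image of ι.
  Tr : Carrier → Carrier
  Tr x = ∑[ i < k ] (x ^ (2 ℕ.^ toℕ i))

  record IsLinearIsomorphism (φ : Vec Bool k → Carrier) : Set (c ⊔ˡ ℓ₁) where
    field
      additive    : ∀ x y → φ (x ⊕ y) ≈ φ x +ᶠ φ y
      homogeneous : ∀ b x → φ (Vec.map (b ∧_) x) ≈ ι b *ᶠ φ x
      bijective   : Bijective _≡_ _≈_ φ

{-# OPTIONS --safe #-}

-- Let t exceed γ(n) by a bounded amount, η(n) = 4t + 2 and m = k - 2t - 1, and let v range over the
-- nodes with |Pre_v| > 2^m.  Cut the path of every input at the first edge e whose target is such a v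
-- or a sink.  Let A be spanned by all queries up to and including that of e, B by those after e; then
-- A ∩ B = 0, |A| ≤ 2^(m+1) and |B| ≤ 2^(n-m).  The set R of inputs cut at e is invariant under the
-- annihilator A^⊥, and on R the value of g depends only on the coset of B^⊥.  With F = (-1)^f,
-- expanding the indicator of B^⊥ in characters, the correlation S of f and g on R satisfies
--   S² ≤ |B| Σ F(x) F(y)   over x, y ∈ R with x + y ∈ B^⊥.
-- The diagonal contributes |R|.  For h = x + y ≠ 0 the derivative of f in direction h is a quadratic
-- form whose radical has at most 2^k elements, so that its character sum over any coset of A^⊥ is at
-- most 2^(2k).  There are |R|²/|B| pairs, again by characters and A ∩ B = 0.  Together these give
-- 2^t S ≤ |R| + 2^(2t) |B|, which is summed over the at most twice |P| edges.

module Submission where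

open import Defs
open import Data.Bool.Base using (Bool)
open import Data.Integer.Base using (ℤ)
open import Data.Nat.Base as ℕ using (ℕ)
open import Data.Vec.Base using (Vec; []; _∷_; concat)
open import Level using (Level)
open import Relation.Binary.PropositionalEquality using (_≡_)
open import Relation.Nullary using (Dec)

-- The cut is made at edges because `Pre v` collects the queries of all paths into `v` and may
-- overshoot the threshold by far. The tail of a cut edge is below the threshold, so A gains at most
-- one query over it; the head is a sink, and then B = 0, or it is above the threshold, which limits
-- B, and strong read-onceness at the head gives A ∩ B = 0. The constants balance two constraints.
-- 2^(2k) |A| 2^(2t) ≤ 2^n asks for m ≤ k - 2t - 1, and 2 |P| 2^(2t) 2^(n-m) ≤ 2^n asks for |P| ≤
-- 2^(m-2t-1), which for the largest m is 2^(k-4t-2). Hence η(n) = 4t + 2. The bound on S is linear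
-- in |R| because the sets R partition the cube, so that the terms |R| add up to 2^n regardless of
-- the number of edges. No bases or dimensions occur: subspaces are Boolean predicates measured by
-- cardinality, and duality and |A| |B| ≤ 2^n come from character sums. All estimates are cleared of
-- denominators and live in the integers until the end.

-- Finite sums of integers, indicators and signs.

module IntegerSums where
  open import Data.Bool.Base using (true; false; _∧_; _xor_)
  open import Data.Integer.Base
  open import Data.Integer.Properties
  open import Data.Integer.Tactic.RingSolver using (solve-∀)
  open import Data.List.Base using (List; []; _∷_; _++_; map; length)
  open import Relation.Binary.PropositionalEquality using (refl; sym; trans; cong; cong₂; subst)
  open import Relation.Nullary using (yes; no; contradiction)

  private variable
    a b : Level
    A : Set a
    B : Set b

  ∑ : List A → (A → ℤ) → ℤ
  ∑ []       f = 0ℤ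
  ∑ (x ∷ xs) f = f x + ∑ xs f

  syntax ∑ xs (λ x → e) = ∑[ x ∈ xs ] e
  infix 5 ∑

  ∑-cong : ∀ (xs : List A) {f g : A → ℤ} → (∀ x → f x ≡ g x) → ∑ xs f ≡ ∑ xs g
  ∑-cong []       f≡g = refl
  ∑-cong (x ∷ xs) f≡g = cong₂ _+_ (f≡g x) (∑-cong xs f≡g)

  ∑-mono : ∀ (xs : List A) {f g : A → ℤ} → (∀ x → f x ≤ g x) → ∑ xs f ≤ ∑ xs g
  ∑-mono []       f≤g = ≤-refl
  ∑-mono (x ∷ xs) f≤g = +-mono-≤ (f≤g x) (∑-mono xs f≤g)

  ∑-zero : ∀ (xs : List A) → (∑[ x ∈ xs ] 0ℤ) ≡ 0ℤ
  ∑-zero []       = refl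
  ∑-zero (x ∷ xs) = trans (+-identityˡ _) (∑-zero xs)

  ∑-const : ∀ (xs : List A) c → (∑[ x ∈ xs ] c) ≡ + length xs * c
  ∑-const []       c = refl
  ∑-const (x ∷ xs) c = trans (cong (_+_ c) (∑-const xs c)) (lemma c (+ length xs))
    where
    lemma : ∀ c l → c + l * c ≡ (+ 1 + l) * c
    lemma = solve-∀

  ∑-nonneg : ∀ (xs : List A) {f : A → ℤ} → (∀ x → 0ℤ ≤ f x) → 0ℤ ≤ ∑ xs f
  ∑-nonneg xs 0≤f = subst (_≤ ∑ xs _) (∑-zero xs) (∑-mono xs 0≤f)

  ∑-+ : ∀ (xs : List A) (f g : A → ℤ) → (∑[ x ∈ xs ] f x + g x) ≡ ∑ xs f + ∑ xs g
  ∑-+ []       f g = refl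
  ∑-+ (x ∷ xs) f g = trans (cong (_+_ (f x + g x)) (∑-+ xs f g)) (lemma (f x) (g x) (∑ xs f) (∑ xs g))
    where
    lemma : ∀ a b c d → a + b + (c + d) ≡ a + c + (b + d)
    lemma = solve-∀

  ∑-*ˡ : ∀ (xs : List A) c (f : A → ℤ) → (∑[ x ∈ xs ] c * f x) ≡ c * ∑ xs f
  ∑-*ˡ []       c f = sym (*-zeroʳ c)
  ∑-*ˡ (x ∷ xs) c f = trans (cong (_+_ (c * f x)) (∑-*ˡ xs c f)) (sym (*-distribˡ-+ c (f x) (∑ xs f)))

  ∑-*ʳ : ∀ (xs : List A) c (f : A → ℤ) → (∑[ x ∈ xs ] f x * c) ≡ ∑ xs f * c
  ∑-*ʳ xs c f = trans (∑-cong xs λ x → *-comm (f x) c) (trans (∑-*ˡ xs c f) (*-comm c (∑ xs f)))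

  ∑-swap : ∀ (xs : List A) (ys : List B) (f : A → B → ℤ) →
           (∑[ x ∈ xs ] ∑[ y ∈ ys ] f x y) ≡ (∑[ y ∈ ys ] ∑[ x ∈ xs ] f x y)
  ∑-swap []       ys f = sym (∑-zero ys)
  ∑-swap (x ∷ xs) ys f = trans (cong (_+_ (∑ ys (f x))) (∑-swap xs ys f))
    (sym (∑-+ ys (f x) λ y → ∑[ x ∈ xs ] f x y))

  ∑-* : ∀ (xs : List A) (ys : List B) (f : A → ℤ) (g : B → ℤ) →
        ∑ xs f * ∑ ys g ≡ (∑[ x ∈ xs ] ∑[ y ∈ ys ] f x * g y)
  ∑-* xs ys f g = trans (sym (∑-*ʳ xs (∑ ys g) f)) (∑-cong xs λ x → sym (∑-*ˡ ys (f x) g))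

  ∑-++ : ∀ (xs ys : List A) (f : A → ℤ) → ∑ (xs ++ ys) f ≡ ∑ xs f + ∑ ys f
  ∑-++ []       ys f = sym (+-identityˡ _)
  ∑-++ (x ∷ xs) ys f = trans (cong (_+_ (f x)) (∑-++ xs ys f)) (sym (+-assoc (f x) _ _))

  ∑-map : ∀ (h : A → B) (xs : List A) (f : B → ℤ) → ∑ (map h xs) f ≡ (∑[ x ∈ xs ] f (h x))
  ∑-map h []       f = refl
  ∑-map h (x ∷ xs) f = cong (_+_ (f (h x))) (∑-map h xs f)

  [_] : Bool → ℤ
  [ true  ] = 1ℤ
  [ false ] = 0ℤ

  sgn : Bool → ℤ
  sgn false = 1ℤ
  sgn true  = -1ℤ

  sgn-xor : ∀ p q → sgn (p xor q) ≡ sgn p * sgn q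
  sgn-xor false q     = sym (*-identityˡ (sgn q))
  sgn-xor true  false = refl
  sgn-xor true  true  = refl

  []-nonneg : ∀ p → 0ℤ ≤ [ p ]
  []-nonneg true  = +≤+ ℕ.z≤n
  []-nonneg false = ≤-refl

  []-∧ : ∀ p q → [ p ∧ q ] ≡ [ p ] * [ q ]
  []-∧ true  q = sym (*-identityˡ [ q ])
  []-∧ false q = refl

  []*-mono : ∀ p {i j} → i ≤ j → [ p ] * i ≤ [ p ] * j
  []*-mono true  i≤j = *-monoˡ-≤-nonNeg 1ℤ i≤j
  []*-mono false i≤j = ≤-refl

  []*-cong : ∀ p {i j} → (p ≡ true → i ≡ j) → [ p ] * i ≡ [ p ] * j
  []*-cong true  i≡j = cong (1ℤ *_) (i≡j refl)
  []*-cong false i≡j = refl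

  *-nonneg : ∀ {i j} → 0ℤ ≤ i → 0ℤ ≤ j → 0ℤ ≤ i * j
  *-nonneg {i} {j} 0≤i 0≤j = subst (_≤ i * j) (*-zeroʳ i) (*-monoˡ-≤-nonNeg i {{nonNegative 0≤i}} 0≤j)

  square-nonneg : ∀ i → 0ℤ ≤ i * i
  square-nonneg (+ n)    = *-nonneg {+ n} {+ n} (+≤+ ℕ.z≤n) (+≤+ ℕ.z≤n)
  square-nonneg -[1+ n ] = +≤+ ℕ.z≤n

  *-monoˡ : ∀ {i j} k → 0ℤ ≤ k → i ≤ j → k * i ≤ k * j
  *-monoˡ k 0≤k = *-monoˡ-≤-nonNeg k {{nonNegative 0≤k}}

  *-monoʳ : ∀ {i j} k → 0ℤ ≤ k → i ≤ j → i * k ≤ j * k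
  *-monoʳ k 0≤k = *-monoʳ-≤-nonNeg k {{nonNegative 0≤k}}

  square-cancel-≤ : ∀ {i j} → 0ℤ ≤ j → i * i ≤ j * j → i ≤ j
  square-cancel-≤ {i} {j} 0≤j i²≤j² with i ≤? j
  ... | yes i≤j = i≤j
  ... | no  i≰j = contradiction (<-≤-trans j²<i² i²≤j²) (<-irrefl refl)
    where
    j<i : j < i
    j<i = ≰⇒> i≰j
    j²<i² : j * j < i * i
    j²<i² = ≤-<-trans (*-monoˡ j 0≤j (<⇒≤ j<i)) (*-monoʳ-<-pos i {{positive (≤-<-trans 0≤j j<i)}} j<i)

  +-nonneg : ∀ {i j} → 0ℤ ≤ i → 0ℤ ≤ j → 0ℤ ≤ i + j
  +-nonneg = +-mono-≤

-- Subgroups of the cube and their character sums.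

module Cube where
  open IntegerSums
  open import Data.Bool.Base using (true; false; _∧_; _xor_; not)
  import Data.Bool.Properties as Bool
  open import Data.Empty using (⊥)
  open import Data.Integer.Base hiding (∣_∣; suc)
  open import Data.Integer.Properties
  open import Data.Integer.Tactic.RingSolver using (solve-∀)
  open import Data.List.Base using ([]; _∷_; map)
  open import Data.List.Membership.Propositional using (_∈_; lose)
  open import Data.List.Membership.Propositional.Properties using (∈-map⁺; ∈-map⁻; ∈-++⁺ˡ; ∈-++⁺ʳ)
  open import Data.List.Relation.Unary.All as All using (All; []; _∷_)
  open import Data.List.Relation.Unary.AllPairs using ([]; _∷_)
  open import Data.List.Relation.Unary.Any using (here; there; any?; satisfied)
  open import Data.List.Relation.Unary.Unique.Propositional using (Unique)
  open import Data.List.Relation.Unary.Unique.Propositional.Properties using (map⁺; ++⁺)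
  open import Data.Nat.Base as ℕ using (zero; suc)
  import Data.Nat.Properties as ℕ
  open import Data.Product.Base using (∃; _×_; _,_; proj₁; proj₂)
  open import Data.Vec.Base as Vec using ([]; _∷_)
  open import Data.Vec.Properties using (∷-injectiveʳ; ≡-dec; zipWith-assoc; zipWith-comm; zipWith-identityˡ; zipWith-identityʳ)
  open import Relation.Binary.Definitions using (DecidableEquality)
  open import Relation.Binary.PropositionalEquality using (_≢_; refl; sym; trans; cong; cong₂; subst)
  open import Relation.Nullary using (¬_; yes; no; does; contradiction)
  open import Relation.Nullary.Decidable using (map′)

  private variable
    n : ℕ
    a : Level
    A : Set a

  module _ (_≟_ : DecidableEquality A) where

    ∑-absent : ∀ {xs} {y : A} → All (y ≢_) xs → ∀ (f : A → ℤ) → (∑[ x ∈ xs ] [ does (x ≟ y) ] * f x) ≡ 0ℤ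
    ∑-absent []                        f = refl
    ∑-absent {x ∷ xs} {y} (y≢x ∷ y∉xs) f with x ≟ y
    ... | yes x≡y = contradiction (sym x≡y) y≢x
    ... | no  _   = trans (+-identityˡ _) (∑-absent y∉xs f)

    ∑-point : ∀ {xs} {y : A} → Unique xs → y ∈ xs → ∀ (f : A → ℤ) → (∑[ x ∈ xs ] [ does (x ≟ y) ] * f x) ≡ f y
    ∑-point {x ∷ xs} {y} (x∉xs ∷ uxs) y∈ f with x ≟ y | y∈
    ... | yes refl | _          = trans (cong₂ _+_ (*-identityˡ (f y)) (∑-absent x∉xs f)) (+-identityʳ (f y))
    ... | no  x≢y  | here y≡x   = contradiction (sym y≡x) x≢y
    ... | no  _    | there y∈xs = trans (+-identityˡ _) (∑-point uxs y∈xs f)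

  term≤∑ : ∀ {xs} {y : A} → y ∈ xs → {f : A → ℤ} → (∀ x → 0ℤ ≤ f x) → f y ≤ ∑ xs f
  term≤∑ {xs = x ∷ xs} (here refl) {f} 0≤f =
    subst (_≤ f x + ∑ xs f) (+-identityʳ (f x)) (+-monoʳ-≤ (f x) (∑-nonneg xs 0≤f))
  term≤∑ {xs = x ∷ xs} (there y∈) {f} 0≤f =
    subst (_≤ f x + ∑ xs f) (+-identityˡ _) (+-mono-≤ (0≤f x) (term≤∑ y∈ 0≤f))

  ∈-cube : (x : Vec Bool n) → x ∈ cube n
  ∈-cube []          = here refl
  ∈-cube (false ∷ x) = ∈-++⁺ˡ (∈-map⁺ (false ∷_) (∈-cube x))
  ∈-cube (true  ∷ x) = ∈-++⁺ʳ (map (false ∷_) (cube _)) (∈-map⁺ (true ∷_) (∈-cube x))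

  cube-unique : ∀ n → Unique (cube n)
  cube-unique zero    = [] ∷ []
  cube-unique (suc n) = ++⁺ (map⁺ ∷-injectiveʳ (cube-unique n)) (map⁺ ∷-injectiveʳ (cube-unique n))
    λ { (v∈₀ , v∈₁) → apart (∈-map⁻ (false ∷_) v∈₀) (∈-map⁻ (true ∷_) v∈₁) }
    where
    apart : ∀ {v : Vec Bool (suc n)} → ∃ (λ y → y ∈ cube n × v ≡ false ∷ y) →
            ∃ (λ y → y ∈ cube n × v ≡ true ∷ y) → ⊥
    apart (_ , _ , refl) (_ , _ , ())

  infix 4 _≟ᵛ_ _==_
  _≟ᵛ_ : DecidableEquality (Vec Bool n)
  _≟ᵛ_ = ≡-dec Bool._≟_

  _==_ : Vec Bool n → Vec Bool n → Bool
  x == y = does (x ≟ᵛ y)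

  ∑-cube-point : ∀ (y : Vec Bool n) (f : Vec Bool n → ℤ) → (∑[ x ∈ cube n ] [ x == y ] * f x) ≡ f y
  ∑-cube-point y = ∑-point _≟ᵛ_ (cube-unique _) (∈-cube y)

  ∃-cube? : {P : Vec Bool n → Set} → (∀ x → Dec (P x)) → Dec (∃ P)
  ∃-cube? P? = map′ satisfied (λ (x , px) → lose (∈-cube x) px) (any? P? (cube _))

  ⊕-assoc : (x y z : Vec Bool n) → (x ⊕ y) ⊕ z ≡ x ⊕ (y ⊕ z)
  ⊕-assoc = zipWith-assoc Bool.xor-assoc

  ⊕-comm : (x y : Vec Bool n) → x ⊕ y ≡ y ⊕ x
  ⊕-comm = zipWith-comm Bool.xor-comm

  ⊕-identityˡ : (x : Vec Bool n) → 𝟎 ⊕ x ≡ x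
  ⊕-identityˡ = zipWith-identityˡ Bool.xor-identityˡ

  ⊕-identityʳ : (x : Vec Bool n) → x ⊕ 𝟎 ≡ x
  ⊕-identityʳ = zipWith-identityʳ Bool.xor-identityʳ

  ⊕-self : (x : Vec Bool n) → x ⊕ x ≡ 𝟎
  ⊕-self []      = refl
  ⊕-self (b ∷ x) = cong₂ _∷_ (Bool.xor-same b) (⊕-self x)

  ⊕-cancelʳ : (x y : Vec Bool n) → (x ⊕ y) ⊕ y ≡ x
  ⊕-cancelʳ x y = trans (⊕-assoc x y y) (trans (cong (x ⊕_) (⊕-self y)) (⊕-identityʳ x))

  ⊕-cancelˡ : (x y : Vec Bool n) → x ⊕ (x ⊕ y) ≡ y
  ⊕-cancelˡ x y = trans (sym (⊕-assoc x x y)) (trans (cong (_⊕ y) (⊕-self x)) (⊕-identityˡ y))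

  ⊕-right-comm : (x y z : Vec Bool n) → (x ⊕ y) ⊕ z ≡ (x ⊕ z) ⊕ y
  ⊕-right-comm x y z = trans (⊕-assoc x y z) (trans (cong (x ⊕_) (⊕-comm y z)) (sym (⊕-assoc x z y)))

  ⊕≡𝟎⇒≡ : (x y : Vec Bool n) → x ⊕ y ≡ 𝟎 → x ≡ y
  ⊕≡𝟎⇒≡ x y eq = trans (sym (⊕-cancelʳ x y)) (trans (cong (_⊕ y) eq) (⊕-identityˡ y))

  xor-interchange : ∀ p q r s → (p xor q) xor (r xor s) ≡ (p xor r) xor (q xor s)
  xor-interchange p q r s = trans (Bool.xor-assoc p q (r xor s)) (trans (cong (p xor_) (trans
    (sym (Bool.xor-assoc q r s)) (trans (cong (_xor s) (Bool.xor-comm q r)) (Bool.xor-assoc r q s))))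
    (sym (Bool.xor-assoc p r (q xor s))))

  ⟨⟩-⊕ʳ : (a x y : Vec Bool n) → ⟨ a , x ⊕ y ⟩ ≡ ⟨ a , x ⟩ xor ⟨ a , y ⟩
  ⟨⟩-⊕ʳ []      []      []      = refl
  ⟨⟩-⊕ʳ (p ∷ a) (q ∷ x) (r ∷ y) = trans
    (cong₂ _xor_ (Bool.∧-distribˡ-xor p q r) (⟨⟩-⊕ʳ a x y))
    (xor-interchange (p ∧ q) (p ∧ r) ⟨ a , x ⟩ ⟨ a , y ⟩)

  ⟨⟩-comm : (a x : Vec Bool n) → ⟨ a , x ⟩ ≡ ⟨ x , a ⟩
  ⟨⟩-comm []      []      = refl
  ⟨⟩-comm (p ∷ a) (q ∷ x) = cong₂ _xor_ (Bool.∧-comm p q) (⟨⟩-comm a x)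

  ⟨⟩-⊕ˡ : (a b x : Vec Bool n) → ⟨ a ⊕ b , x ⟩ ≡ ⟨ a , x ⟩ xor ⟨ b , x ⟩
  ⟨⟩-⊕ˡ a b x = trans (⟨⟩-comm (a ⊕ b) x)
    (trans (⟨⟩-⊕ʳ x a b) (cong₂ _xor_ (⟨⟩-comm x a) (⟨⟩-comm x b)))

  ⟨𝟎,⟩ : (x : Vec Bool n) → ⟨ 𝟎 , x ⟩ ≡ false
  ⟨𝟎,⟩ []      = refl
  ⟨𝟎,⟩ (q ∷ x) = ⟨𝟎,⟩ x

  ⟨⟩-nondegenerate : (a : Vec Bool n) → a ≢ 𝟎 → ∃ λ x → ⟨ a , x ⟩ ≡ true
  ⟨⟩-nondegenerate []          a≢𝟎 = contradiction refl a≢𝟎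
  ⟨⟩-nondegenerate (true  ∷ a) a≢𝟎 =
    true ∷ 𝟎 , cong not (trans (⟨⟩-comm a 𝟎) (⟨𝟎,⟩ a))
  ⟨⟩-nondegenerate (false ∷ a) a≢𝟎 =
    let x , eq = ⟨⟩-nondegenerate a λ a≡𝟎 → a≢𝟎 (cong (false ∷_) a≡𝟎) in false ∷ x , eq

  ∑-cube-suc : ∀ (f : Vec Bool (suc n) → ℤ) →
    ∑ (cube (suc n)) f ≡ (∑[ x ∈ cube n ] f (false ∷ x)) + (∑[ x ∈ cube n ] f (true ∷ x))
  ∑-cube-suc {n} f = trans (∑-++ (map (false ∷_) (cube n)) _ f)
    (cong₂ _+_ (∑-map (false ∷_) (cube n) f) (∑-map (true ∷_) (cube n) f))

  ∑-translate : ∀ (y : Vec Bool n) (f : Vec Bool n → ℤ) → (∑[ x ∈ cube n ] f (x ⊕ y)) ≡ ∑ (cube n) f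
  ∑-translate         []          f = refl
  ∑-translate {suc n} (false ∷ y) f = trans (∑-cube-suc {n} _) (trans
    (cong₂ _+_ (∑-translate y λ x → f (false ∷ x)) (∑-translate y λ x → f (true ∷ x)))
    (sym (∑-cube-suc f)))
  ∑-translate {suc n} (true ∷ y)  f = trans (∑-cube-suc {n} _) (trans
    (cong₂ _+_ (∑-translate y λ x → f (true ∷ x)) (∑-translate y λ x → f (false ∷ x)))
    (trans (+-comm (∑ (cube n) _) _) (sym (∑-cube-suc f))))

  ∑-translateˡ : ∀ (y : Vec Bool n) (f : Vec Bool n → ℤ) → (∑[ x ∈ cube n ] f (y ⊕ x)) ≡ ∑ (cube n) f
  ∑-translateˡ y f = trans (∑-cong (cube _) λ x → cong f (⊕-comm y x)) (∑-translate y f)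

  2^ⁿ : ℕ → ℤ
  2^ⁿ n = + (2 ℕ.^ n)

  2^ⁿ>0 : ∀ n → 0ℤ < 2^ⁿ n
  2^ⁿ>0 n = +<+ (ℕ.m^n>0 2 n)

  2^ⁿ-+ : ∀ m n → 2^ⁿ m * 2^ⁿ n ≡ 2^ⁿ (m ℕ.+ n)
  2^ⁿ-+ m n = trans (sym (pos-* (2 ℕ.^ m) (2 ℕ.^ n))) (cong +_ (sym (ℕ.^-distribˡ-+-* 2 m n)))

  ∑-cube-1 : ∀ n → (∑[ x ∈ cube n ] 1ℤ) ≡ 2^ⁿ n
  ∑-cube-1 zero    = refl
  ∑-cube-1 (suc n) = trans (∑-cube-suc {n} λ _ → 1ℤ) (trans (cong₂ _+_ (∑-cube-1 n) (∑-cube-1 n))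
    (cong +_ (cong (2 ℕ.^ n ℕ.+_) (sym (ℕ.+-identityʳ (2 ℕ.^ n))))))

  self-negative⇒0 : ∀ i → i ≡ -1ℤ * i → i ≡ 0ℤ
  -- For every other `i` the two sides have different constructors, so the equation is absurd.
  self-negative⇒0 (+ zero) _ = refl

  -- Subsets of the cube are Boolean predicates.
  # : (Vec Bool n → Bool) → ℤ
  # A = ∑[ x ∈ cube _ ] [ A x ]

  #-nonneg : (A : Vec Bool n → Bool) → 0ℤ ≤ # A
  #-nonneg A = ∑-nonneg (cube _) λ x → []-nonneg (A x)

  #-pos : (A : Vec Bool n → Bool) (x : Vec Bool n) → A x ≡ true → 0ℤ < # A
  #-pos A x x∈ = <-≤-trans (+<+ (ℕ.s≤s ℕ.z≤n))
    (subst (λ p → [ p ] ≤ # A) x∈ (term≤∑ (∈-cube x) λ y → []-nonneg (A y)))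

  accepted : ∀ {a} {P : Set a} (P? : Dec P) → does P? ≡ true → P
  accepted (yes p) _ = p

  refuted : ∀ {a} {P : Set a} (P? : Dec P) → not (does P?) ≡ true → ¬ P
  refuted (no ¬p) _ = ¬p

  confirmed : ∀ {a} {P : Set a} (P? : Dec P) → not (does P?) ≡ false → P
  confirmed (yes p) _ = p

  #-trivial : ∀ (A : Vec Bool n → Bool) → (∀ w → A w ≡ true → w ≡ 𝟎) → # A ≤ 1ℤ
  #-trivial {n} A trivial = subst (# A ≤_) (∑-cube-point {n} 𝟎 λ _ → 1ℤ) (∑-mono (cube n) term)
    where
    term : ∀ w → [ A w ] ≤ [ w == 𝟎 ] * 1ℤ
    term w with A w in w∈ | w ≟ᵛ 𝟎
    ... | true  | yes _   = ≤-refl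
    ... | true  | no w≢𝟎  = contradiction (trivial w w∈) w≢𝟎
    ... | false | yes _   = +≤+ ℕ.z≤n
    ... | false | no _    = ≤-refl

  -- Over 𝔽₂ these are the linear subspaces.
  record IsSubgroup (A : Vec Bool n → Bool) : Set where
    field
      𝟎∈ : A 𝟎 ≡ true
      ⊕∈ : ∀ {x y} → A x ≡ true → A y ≡ true → A (x ⊕ y) ≡ true

    translate : ∀ x {y} → A y ≡ true → A (x ⊕ y) ≡ A x
    translate x {y} y∈ with A x in eqx | A (x ⊕ y) in eqxy
    ... | true  | true  = refl
    ... | false | false = refl
    ... | true  | false = trans (sym eqxy) (⊕∈ eqx y∈)
    ... | false | true  = trans (sym (⊕∈ eqxy y∈)) (trans (cong A (⊕-cancelʳ x y)) eqx)

    #>0 : 0ℤ < # A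
    #>0 = #-pos A 𝟎 𝟎∈

  everything : IsSubgroup {n} λ _ → true
  everything = record { 𝟎∈ = refl ; ⊕∈ = λ _ _ → refl }

  ∧-true : ∀ p {q} → p ∧ q ≡ true → p ≡ true × q ≡ true
  ∧-true true q≡ = refl , q≡

  Additive : (Vec Bool n → Bool) → Set
  Additive L = ∀ x y → L (x ⊕ y) ≡ L x xor L y

  module _ {A : Vec Bool n → Bool} (subgroup : IsSubgroup A)
           {L : Vec Bool n → Bool} (additive : Additive L) where
    open IsSubgroup subgroup

    character-sum-trivial : (∀ x → A x ≡ true → L x ≡ false) →
      (∑[ x ∈ cube n ] [ A x ] * sgn (L x)) ≡ # A
    character-sum-trivial L≡0 = ∑-cong (cube n) λ x →
      trans ([]*-cong (A x) λ x∈ → cong sgn (L≡0 x x∈)) (*-identityʳ [ A x ])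

    -- Translation by `y` permutes the terms and flips every sign, so the sum is its own negative.
    character-sum-nontrivial : ∀ y → A y ≡ true → L y ≡ true →
      (∑[ x ∈ cube n ] [ A x ] * sgn (L x)) ≡ 0ℤ
    character-sum-nontrivial y y∈ Ly = self-negative⇒0 _ (trans
      (sym (∑-translate y λ x → [ A x ] * sgn (L x)))
      (trans (∑-cong (cube n) negate) (∑-*ˡ (cube n) -1ℤ λ x → [ A x ] * sgn (L x))))
      where
      swap : ∀ a b → a * (b * -1ℤ) ≡ -1ℤ * (a * b)
      swap = solve-∀
      negate : ∀ x → [ A (x ⊕ y) ] * sgn (L (x ⊕ y)) ≡ -1ℤ * ([ A x ] * sgn (L x))
      negate x = trans (cong₂ (λ p q → [ p ] * q) (translate x y∈)
        (trans (cong sgn (trans (additive x y) (cong (L x xor_) Ly))) (sgn-xor (L x) true)))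
        (swap [ A x ] (sgn (L x)))

    nontrivial? : Dec (∃ λ x → A x ∧ L x ≡ true)
    nontrivial? = ∃-cube? λ x → (A x ∧ L x) Bool.≟ true

    trivial : ¬ (∃ λ x → A x ∧ L x ≡ true) → ∀ x → A x ≡ true → L x ≡ false
    trivial none x x∈ = Bool.¬-not λ Lx → none (x , cong₂ _∧_ x∈ Lx)

    -- The sum is either 0 or the order of the group. The sign is what later allows a range of
    -- summation to be enlarged.
    character-sum-nonneg : 0ℤ ≤ (∑[ x ∈ cube n ] [ A x ] * sgn (L x))
    character-sum-nonneg with nontrivial?
    ... | yes (y , eq) = ≤-reflexive (sym (character-sum-nontrivial y
            (proj₁ (∧-true (A y) eq)) (proj₂ (∧-true (A y) eq))))
    ... | no none = subst (0ℤ ≤_) (sym (character-sum-trivial (trivial none))) (#-nonneg A)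

-- Annihilators, the double annihilator and Plancherel's identity.

module Duality where
  open IntegerSums
  open Cube
  open import Data.Bool.Base using (true; false; _∧_; _xor_; not)
  import Data.Bool.Properties as Bool
  open import Data.Integer.Base using (1ℤ; _*_)
  open import Data.Integer.Properties
  open import Data.Integer.Tactic.RingSolver using (solve-∀)
  open import Data.Product.Base using (∃; _×_; _,_)
  open import Relation.Binary.PropositionalEquality using (refl; sym; trans; cong; cong₂; module ≡-Reasoning)
  open import Relation.Nullary using (yes; no; does; contradiction)
  open import Relation.Nullary.Decidable using (dec-true; dec-false)

  private variable
    n : ℕ

  detects? : ∀ (A : Vec Bool n → Bool) x → Dec (∃ λ a → A a ∧ ⟨ a , x ⟩ ≡ true)
  detects? A x = ∃-cube? λ a → (A a ∧ ⟨ a , x ⟩) Bool.≟ true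

  perp : (Vec Bool n → Bool) → Vec Bool n → Bool
  perp A x = not (does (detects? A x))

  perp-intro : ∀ (A : Vec Bool n → Bool) {x} → (∀ a → A a ≡ true → ⟨ a , x ⟩ ≡ false) → perp A x ≡ true
  perp-intro A {x} A⊥x = cong not (dec-false (detects? A x) λ (a , eq) →
    let a∈ , ax = ∧-true (A a) eq in contradiction (trans (sym (A⊥x a a∈)) ax) λ ())

  perp-elim : ∀ (A : Vec Bool n → Bool) {x} → perp A x ≡ true → ∀ a → A a ≡ true → ⟨ a , x ⟩ ≡ false
  perp-elim A {x} x∈ a a∈ = Bool.¬-not λ ax → refuted (detects? A x) x∈ (a , cong₂ _∧_ a∈ ax)

  perp-witness : ∀ (A : Vec Bool n → Bool) {x} → perp A x ≡ false → ∃ λ a → A a ≡ true × ⟨ a , x ⟩ ≡ true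
  perp-witness A {x} x∉ = let a , eq = confirmed (detects? A x) x∉ in a , ∧-true (A a) eq

  perp-subgroup : ∀ (A : Vec Bool n → Bool) → IsSubgroup (perp A)
  perp-subgroup A = record
    { 𝟎∈ = perp-intro A λ a _ → trans (⟨⟩-comm a 𝟎) (⟨𝟎,⟩ a)
    ; ⊕∈ = λ {x} {y} x∈ y∈ → perp-intro A λ a a∈ →
        trans (⟨⟩-⊕ʳ a x y) (cong₂ _xor_ (perp-elim A x∈ a a∈) (perp-elim A y∈ a a∈))
    }

  ∑-pairing : (c : Vec Bool n) → (∑[ x ∈ cube n ] sgn ⟨ c , x ⟩) ≡ [ c == 𝟎 ] * 2^ⁿ n
  ∑-pairing {n} c = trans (∑-cong (cube n) λ x → sym (*-identityˡ (sgn ⟨ c , x ⟩))) full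
    where
    full : (∑[ x ∈ cube n ] 1ℤ * sgn ⟨ c , x ⟩) ≡ [ c == 𝟎 ] * 2^ⁿ n
    full with c ≟ᵛ 𝟎
    ... | yes refl = trans (character-sum-trivial (everything {n}) (⟨⟩-⊕ʳ 𝟎) λ x _ → ⟨𝟎,⟩ x)
                       (trans (∑-cube-1 n) (sym (*-identityˡ _)))
    ... | no  c≢𝟎  = let y , cy = ⟨⟩-nondegenerate c c≢𝟎 in
                     character-sum-nontrivial (everything {n}) (⟨⟩-⊕ʳ c) y refl cy

  -- Orthogonality of characters: the expansion of the indicator of `perp A` in the characters
  -- indexed by `A`.
  ∑-dual : ∀ {A : Vec Bool n → Bool} → IsSubgroup A → ∀ x →
           (∑[ a ∈ cube n ] [ A a ] * sgn ⟨ a , x ⟩) ≡ [ perp A x ] * # A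
  ∑-dual {A = A} subgroup x with perp A x in eq
  ... | true  = trans (character-sum-trivial subgroup (λ a b → ⟨⟩-⊕ˡ a b x) (perp-elim A eq)) (sym (*-identityˡ (# A)))
  ... | false = let a , a∈ , ax = perp-witness A eq in
                character-sum-nontrivial subgroup (λ a b → ⟨⟩-⊕ˡ a b x) a a∈ ax

  ⊕==𝟎 : ∀ (x y : Vec Bool n) → (x ⊕ y == 𝟎) ≡ (x == y)
  ⊕==𝟎 x y with x ≟ᵛ y
  ... | yes refl = dec-true (x ⊕ x ≟ᵛ 𝟎) (⊕-self x)
  ... | no  x≢y  = dec-false (x ⊕ y ≟ᵛ 𝟎) λ eq → x≢y (⊕≡𝟎⇒≡ x y eq)

  -- Inserting `∑-dual` for the indicator and summing over `w` first leaves only the term a = b. For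
  -- `b` outside `A` the sum vanishes, so `b` is not orthogonal to all of `perp A`: this replaces
  -- the double annihilator theorem.
  ∑-perp : ∀ {A : Vec Bool n → Bool} → IsSubgroup A → ∀ b →
           # A * (∑[ w ∈ cube n ] [ perp A w ] * sgn ⟨ b , w ⟩) ≡ [ A b ] * 2^ⁿ n
  ∑-perp {n} {A} subgroup b = begin
    # A * (∑[ w ∈ cube n ] [ perp A w ] * sgn ⟨ b , w ⟩)
      ≡⟨ ∑-*ˡ (cube n) (# A) _ ⟨
    (∑[ w ∈ cube n ] # A * ([ perp A w ] * sgn ⟨ b , w ⟩))
      ≡⟨ ∑-cong (cube n) (λ w → trans (left (# A) [ perp A w ] (sgn ⟨ b , w ⟩))
           (cong (_* sgn ⟨ b , w ⟩) (sym (∑-dual subgroup w)))) ⟩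
    (∑[ w ∈ cube n ] (∑[ a ∈ cube n ] [ A a ] * sgn ⟨ a , w ⟩) * sgn ⟨ b , w ⟩)
      ≡⟨ ∑-cong (cube n) (λ w → sym (∑-*ʳ (cube n) (sgn ⟨ b , w ⟩) λ a → [ A a ] * sgn ⟨ a , w ⟩)) ⟩
    (∑[ w ∈ cube n ] ∑[ a ∈ cube n ] [ A a ] * sgn ⟨ a , w ⟩ * sgn ⟨ b , w ⟩)
      ≡⟨ ∑-swap (cube n) (cube n) (λ w a → [ A a ] * sgn ⟨ a , w ⟩ * sgn ⟨ b , w ⟩) ⟩
    (∑[ a ∈ cube n ] ∑[ w ∈ cube n ] [ A a ] * sgn ⟨ a , w ⟩ * sgn ⟨ b , w ⟩)
      ≡⟨ ∑-cong (cube n) (λ a → trans (∑-cong (cube n) (combine a)) (trans (∑-*ˡ (cube n) [ A a ] _)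
           (cong ([ A a ] *_) (∑-pairing (a ⊕ b))))) ⟩
    (∑[ a ∈ cube n ] [ A a ] * ([ a ⊕ b == 𝟎 ] * 2^ⁿ n))
      ≡⟨ ∑-cong (cube n) (λ a → trans (cong (λ p → [ A a ] * ([ p ] * 2^ⁿ n)) (⊕==𝟎 a b))
           (middle [ A a ] [ a == b ] (2^ⁿ n))) ⟩
    (∑[ a ∈ cube n ] [ a == b ] * ([ A a ] * 2^ⁿ n))
      ≡⟨ ∑-cube-point b (λ a → [ A a ] * 2^ⁿ n) ⟩
    [ A b ] * 2^ⁿ n ∎
    where
    open ≡-Reasoning
    left : ∀ p q r → p * (q * r) ≡ q * p * r
    left = solve-∀
    middle : ∀ p q r → p * (q * r) ≡ q * (p * r)
    middle = solve-∀
    combine : ∀ a w → [ A a ] * sgn ⟨ a , w ⟩ * sgn ⟨ b , w ⟩ ≡ [ A a ] * sgn ⟨ a ⊕ b , w ⟩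
    combine a w = trans (*-assoc [ A a ] _ _) (cong ([ A a ] *_)
      (trans (sym (sgn-xor ⟨ a , w ⟩ ⟨ b , w ⟩)) (cong sgn (sym (⟨⟩-⊕ˡ a b w)))))

  #-perp : ∀ {A : Vec Bool n → Bool} → IsSubgroup A → # A * # (perp A) ≡ 2^ⁿ n
  #-perp {n} {A} subgroup = trans
    (cong (# A *_) (sym (character-sum-trivial (perp-subgroup A) (⟨⟩-⊕ʳ 𝟎) λ x _ → ⟨𝟎,⟩ x)))
    (trans (∑-perp subgroup 𝟎) (trans (cong (λ p → [ p ] * 2^ⁿ n) (IsSubgroup.𝟎∈ subgroup)) (*-identityˡ _)))

  -- Each translation by an element of `W` permutes the cube and preserves `E`; the sum is repeated
  -- once for every such translation.
  averaging : ∀ {W : Vec Bool n → Bool} (D E : Vec Bool n → ℤ) →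
    (∀ x {w} → W w ≡ true → E (x ⊕ w) ≡ E x) →
    # W * (∑[ x ∈ cube n ] E x * D x) ≡ (∑[ x ∈ cube n ] E x * (∑[ w ∈ cube n ] [ W w ] * D (x ⊕ w)))
  averaging {n} {W} D E E-inv = begin
    # W * (∑[ x ∈ cube n ] E x * D x)
      ≡⟨ ∑-*ʳ (cube n) (∑[ x ∈ cube n ] E x * D x) (λ w → [ W w ]) ⟨
    (∑[ w ∈ cube n ] [ W w ] * (∑[ x ∈ cube n ] E x * D x))
      ≡⟨ ∑-cong (cube n) (λ w → []*-cong (W w) λ w∈ → sym (trans
           (∑-cong (cube n) λ x → cong (_* D (x ⊕ w)) (sym (E-inv x w∈)))
           (∑-translate w λ x → E x * D x))) ⟩
    (∑[ w ∈ cube n ] [ W w ] * (∑[ x ∈ cube n ] E x * D (x ⊕ w)))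
      ≡⟨ ∑-cong (cube n) (λ w → sym (∑-*ˡ (cube n) [ W w ] λ x → E x * D (x ⊕ w))) ⟩
    (∑[ w ∈ cube n ] ∑[ x ∈ cube n ] [ W w ] * (E x * D (x ⊕ w)))
      ≡⟨ ∑-swap (cube n) (cube n) (λ w x → [ W w ] * (E x * D (x ⊕ w))) ⟩
    (∑[ x ∈ cube n ] ∑[ w ∈ cube n ] [ W w ] * (E x * D (x ⊕ w)))
      ≡⟨ ∑-cong (cube n) (λ x → trans (∑-cong (cube n) λ w → middle [ W w ] (E x) (D (x ⊕ w)))
           (∑-*ˡ (cube n) (E x) λ w → [ W w ] * D (x ⊕ w))) ⟩
    (∑[ x ∈ cube n ] E x * (∑[ w ∈ cube n ] [ W w ] * D (x ⊕ w))) ∎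
    where
    open ≡-Reasoning
    middle : ∀ p q r → p * (q * r) ≡ q * (p * r)
    middle = solve-∀

  -- By `∑-dual` the kernel `perp B (x ⊕ y)` is a sum over `b` of products of a character in `x` and
  -- the same character in `y`, so the double sum splits into squares.
  plancherel : ∀ {B : Vec Bool n → Bool} → IsSubgroup B → (ψ : Vec Bool n → ℤ) →
    # B * (∑[ x ∈ cube n ] ∑[ y ∈ cube n ] ψ x * ψ y * [ perp B (x ⊕ y) ]) ≡
    (∑[ b ∈ cube n ] [ B b ] * ((∑[ x ∈ cube n ] ψ x * sgn ⟨ b , x ⟩) * (∑[ x ∈ cube n ] ψ x * sgn ⟨ b , x ⟩)))
  plancherel {n} {B} subgroup ψ = begin
    # B * (∑[ x ∈ cube n ] ∑[ y ∈ cube n ] ψ x * ψ y * [ perp B (x ⊕ y) ])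
      ≡⟨ ∑-*ˡ (cube n) (# B) _ ⟨
    (∑[ x ∈ cube n ] # B * (∑[ y ∈ cube n ] ψ x * ψ y * [ perp B (x ⊕ y) ]))
      ≡⟨ ∑-cong (cube n) (λ x → trans (sym (∑-*ˡ (cube n) (# B) _)) (∑-cong (cube n) (expand x))) ⟩
    (∑[ x ∈ cube n ] ∑[ y ∈ cube n ] ∑[ b ∈ cube n ] [ B b ] * (ψ x * χ b x * (ψ y * χ b y)))
      ≡⟨ ∑-cong (cube n) (λ x → ∑-swap (cube n) (cube n) λ y b → [ B b ] * (ψ x * χ b x * (ψ y * χ b y))) ⟩
    (∑[ x ∈ cube n ] ∑[ b ∈ cube n ] ∑[ y ∈ cube n ] [ B b ] * (ψ x * χ b x * (ψ y * χ b y)))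
      ≡⟨ ∑-swap (cube n) (cube n) (λ x b → ∑[ y ∈ cube n ] [ B b ] * (ψ x * χ b x * (ψ y * χ b y))) ⟩
    (∑[ b ∈ cube n ] ∑[ x ∈ cube n ] ∑[ y ∈ cube n ] [ B b ] * (ψ x * χ b x * (ψ y * χ b y)))
      ≡⟨ ∑-cong (cube n) (λ b → trans
           (∑-cong (cube n) λ x → ∑-*ˡ (cube n) [ B b ] λ y → ψ x * χ b x * (ψ y * χ b y))
           (trans (∑-*ˡ (cube n) [ B b ] λ x → ∑[ y ∈ cube n ] ψ x * χ b x * (ψ y * χ b y))
           (cong ([ B b ] *_) (sym (∑-* (cube n) (cube n) (λ x → ψ x * χ b x) (λ y → ψ y * χ b y)))))) ⟩
    (∑[ b ∈ cube n ] [ B b ] * ((∑[ x ∈ cube n ] ψ x * χ b x) * (∑[ x ∈ cube n ] ψ x * χ b x))) ∎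
    where
    open ≡-Reasoning
    χ : Vec Bool n → Vec Bool n → ℤ
    χ b x = sgn ⟨ b , x ⟩
    right : ∀ p q r → p * (q * r) ≡ q * (r * p)
    right = solve-∀
    regroup : ∀ p q r s t → p * q * (r * (s * t)) ≡ r * (p * s * (q * t))
    regroup = solve-∀
    expand : ∀ x y → # B * (ψ x * ψ y * [ perp B (x ⊕ y) ]) ≡
                     (∑[ b ∈ cube n ] [ B b ] * (ψ x * χ b x * (ψ y * χ b y)))
    expand x y = trans (right (# B) (ψ x * ψ y) [ perp B (x ⊕ y) ]) (trans
      (cong (ψ x * ψ y *_) (sym (∑-dual subgroup (x ⊕ y))))
      (trans (sym (∑-*ˡ (cube n) (ψ x * ψ y) λ b → [ B b ] * sgn ⟨ b , x ⊕ y ⟩))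
      (∑-cong (cube n) λ b → trans
        (cong (λ s → ψ x * ψ y * ([ B b ] * s)) (trans (cong sgn (⟨⟩-⊕ʳ b x y)) (sgn-xor ⟨ b , x ⟩ ⟨ b , y ⟩)))
        (regroup (ψ x) (ψ y) [ B b ] (χ b x) (χ b y)))))

-- Correlation on a single region.

module CosetDiscrepancy where
  open IntegerSums
  open Cube
  open Duality
  open import Data.Bool.Base using (true; false; _xor_)
  import Data.Bool.Properties as Bool
  open import Data.Integer.Base using (0ℤ; 1ℤ; _+_; _*_; _≤_; _<_; +_; positive)
  open import Data.Integer.Properties
  open import Data.Integer.Tactic.RingSolver using (solve-∀)
  open import Relation.Binary.PropositionalEquality using (_≢_; refl; sym; trans; cong; cong₂; subst; subst₂; module ≡-Reasoning)
  open import Relation.Nullary using (yes; no; contradiction)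

  -- The sum # A · # B · |perp A ∩ perp B| equals 2^n: after expanding the indicator of `perp B`,
  -- `∑-perp` keeps only the b in A ∩ B, that is b = 𝟎. The bound keeps just the term w = 𝟎 of the
  -- intersection.
  subgroup-product : ∀ {n} {A B : Vec Bool n → Bool} → IsSubgroup A → IsSubgroup B →
    (∀ b → A b ≡ true → B b ≡ true → b ≡ 𝟎) → # A * # B ≤ 2^ⁿ n
  subgroup-product {n} {A} {B} A-sub B-sub disjoint = subst₂ _≤_ left right
    (*-monoˡ (# A) (#-nonneg A) (term≤∑ (∈-cube 𝟎) {λ w → [ perp A w ] * ([ perp B w ] * # B)} λ w →
      *-nonneg ([]-nonneg (perp A w)) (*-nonneg ([]-nonneg (perp B w)) (#-nonneg B))))
    where
    open ≡-Reasoning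
    left : # A * ([ perp A 𝟎 ] * ([ perp B 𝟎 ] * # B)) ≡ # A * # B
    left = cong (# A *_) (trans
      (cong₂ (λ p q → [ p ] * ([ q ] * # B)) (IsSubgroup.𝟎∈ (perp-subgroup A)) (IsSubgroup.𝟎∈ (perp-subgroup B)))
      (trans (*-identityˡ _) (*-identityˡ _)))
    middle : ∀ p q r → p * (q * r) ≡ q * (p * r)
    middle = solve-∀
    only-𝟎 : ∀ b → [ B b ] * ([ A b ] * 2^ⁿ n) ≡ [ b == 𝟎 ] * 2^ⁿ n
    only-𝟎 b with b ≟ᵛ 𝟎
    ... | yes refl rewrite IsSubgroup.𝟎∈ A-sub | IsSubgroup.𝟎∈ B-sub = trans (*-identityˡ _) refl
    ... | no  b≢𝟎 with A b in a∈ | B b in b∈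
    ...   | true  | true  = contradiction (disjoint b a∈ b∈) b≢𝟎
    ...   | true  | false = refl
    ...   | false | true  = refl
    ...   | false | false = refl
    right : # A * (∑[ w ∈ cube n ] [ perp A w ] * ([ perp B w ] * # B)) ≡ 2^ⁿ n
    right = begin
      # A * (∑[ w ∈ cube n ] [ perp A w ] * ([ perp B w ] * # B))
        ≡⟨ cong (# A *_) (∑-cong (cube n) λ w → trans (cong ([ perp A w ] *_) (sym (∑-dual B-sub w)))
             (sym (∑-*ˡ (cube n) [ perp A w ] λ b → [ B b ] * sgn ⟨ b , w ⟩))) ⟩
      # A * (∑[ w ∈ cube n ] ∑[ b ∈ cube n ] [ perp A w ] * ([ B b ] * sgn ⟨ b , w ⟩))
        ≡⟨ cong (# A *_) (trans (∑-swap (cube n) (cube n) λ w b → [ perp A w ] * ([ B b ] * sgn ⟨ b , w ⟩))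
             (∑-cong (cube n) λ b → trans (∑-cong (cube n) λ w → middle [ perp A w ] [ B b ] (sgn ⟨ b , w ⟩))
               (∑-*ˡ (cube n) [ B b ] λ w → [ perp A w ] * sgn ⟨ b , w ⟩))) ⟩
      # A * (∑[ b ∈ cube n ] [ B b ] * (∑[ w ∈ cube n ] [ perp A w ] * sgn ⟨ b , w ⟩))
        ≡⟨ trans (sym (∑-*ˡ (cube n) (# A) λ b → [ B b ] * (∑[ w ∈ cube n ] [ perp A w ] * sgn ⟨ b , w ⟩)))
             (∑-cong (cube n) λ b → trans (middle (# A) [ B b ] _) (cong ([ B b ] *_) (∑-perp A-sub b))) ⟩
      (∑[ b ∈ cube n ] [ B b ] * ([ A b ] * 2^ⁿ n))
        ≡⟨ trans (∑-cong (cube n) only-𝟎) (∑-cube-point {n} 𝟎 λ _ → 2^ⁿ n) ⟩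
      2^ⁿ n ∎

  module _ {n : ℕ} {A B : Vec Bool n → Bool} (A-sub : IsSubgroup A) (B-sub : IsSubgroup B)
           (disjoint : ∀ b → A b ≡ true → B b ≡ true → b ≡ 𝟎)
           (R : Vec Bool n → Bool) (R-inv : ∀ x {w} → perp A w ≡ true → R (x ⊕ w) ≡ R x) where

    E : Vec Bool n → Vec Bool n → ℤ
    E h x = [ R x ] * [ R (x ⊕ h) ]

    E-nonneg : ∀ h x → 0ℤ ≤ E h x
    E-nonneg h x = *-nonneg ([]-nonneg (R x)) ([]-nonneg (R (x ⊕ h)))

    E-inv : ∀ h x {w} → perp A w ≡ true → E h (x ⊕ w) ≡ E h x
    E-inv h x {w} w∈ = cong₂ (λ p q → [ p ] * [ q ]) (R-inv x w∈)
      (trans (cong R (⊕-right-comm x w h)) (R-inv (x ⊕ h) w∈))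

    pairs-by-difference : ∀ (F : Vec Bool n → Vec Bool n → ℤ) →
      (∑[ x ∈ cube n ] ∑[ y ∈ cube n ] [ perp B (x ⊕ y) ] * ([ R x ] * [ R y ] * F x y)) ≡
      (∑[ h ∈ cube n ] [ perp B h ] * (∑[ x ∈ cube n ] E h x * F x (x ⊕ h)))
    pairs-by-difference F = begin
      (∑[ x ∈ cube n ] ∑[ y ∈ cube n ] K x y)
        ≡⟨ ∑-cong (cube n) (λ x → sym (∑-translateˡ x (K x))) ⟩
      (∑[ x ∈ cube n ] ∑[ h ∈ cube n ] K x (x ⊕ h))
        ≡⟨ ∑-swap (cube n) (cube n) (λ x h → K x (x ⊕ h)) ⟩
      (∑[ h ∈ cube n ] ∑[ x ∈ cube n ] K x (x ⊕ h))
        ≡⟨ ∑-cong (cube n) (λ h → trans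
             (∑-cong (cube n) λ x → cong (λ z → [ perp B z ] * (E h x * F x (x ⊕ h))) (⊕-cancelˡ x h))
             (∑-*ˡ (cube n) [ perp B h ] λ x → E h x * F x (x ⊕ h))) ⟩
      (∑[ h ∈ cube n ] [ perp B h ] * (∑[ x ∈ cube n ] E h x * F x (x ⊕ h))) ∎
      where
      open ≡-Reasoning
      K : Vec Bool n → Vec Bool n → ℤ
      K x y = [ perp B (x ⊕ y) ] * ([ R x ] * [ R y ] * F x y)

    R-hat : Vec Bool n → ℤ
    R-hat b = ∑[ x ∈ cube n ] [ R x ] * sgn ⟨ b , x ⟩

    R-hat-zero : R-hat 𝟎 ≡ # R
    R-hat-zero = ∑-cong (cube n) λ x → trans (cong (λ p → [ R x ] * sgn p) (⟨𝟎,⟩ x)) (*-identityʳ _)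

    private
      pos-cancel : ∀ {i j} → 0ℤ < i → i * j ≡ 0ℤ → j ≡ 0ℤ
      pos-cancel {i} {j} 0<i eq = *-cancelˡ-≡ i j 0ℤ {{>-nonZero 0<i}} (trans eq (sym (*-zeroʳ i)))
        where open import Data.Integer.Base using (>-nonZero)

      middle : ∀ p q r → p * (q * r) ≡ q * (p * r)
      middle = solve-∀

    -- A character outside `A` is nontrivial on `perp A` and sums to 0 there, whereas `R` is a union
    -- of cosets of `perp A`.
    R-hat-vanishes : ∀ b → A b ≡ false → R-hat b ≡ 0ℤ
    R-hat-vanishes b b∉ = pos-cancel (IsSubgroup.#>0 (perp-subgroup A)) (begin
      # (perp A) * R-hat b
        ≡⟨ averaging (λ x → sgn ⟨ b , x ⟩) (λ x → [ R x ]) (λ x w∈ → cong [_] (R-inv x w∈)) ⟩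
      (∑[ x ∈ cube n ] [ R x ] * (∑[ w ∈ cube n ] [ perp A w ] * sgn ⟨ b , x ⊕ w ⟩))
        ≡⟨ ∑-cong (cube n) (λ x → trans (cong ([ R x ] *_) (inner-sum x)) (*-zeroʳ [ R x ])) ⟩
      (∑[ x ∈ cube n ] 0ℤ)
        ≡⟨ ∑-zero (cube n) ⟩
      0ℤ ∎)
      where
      open ≡-Reasoning
      character-sum : (∑[ w ∈ cube n ] [ perp A w ] * sgn ⟨ b , w ⟩) ≡ 0ℤ
      character-sum = pos-cancel (IsSubgroup.#>0 A-sub)
        (trans (∑-perp A-sub b) (cong (λ p → [ p ] * 2^ⁿ n) b∉))
      inner-sum : ∀ x → (∑[ w ∈ cube n ] [ perp A w ] * sgn ⟨ b , x ⊕ w ⟩) ≡ 0ℤ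
      inner-sum x = trans (∑-cong (cube n) λ w → trans
          (cong ([ perp A w ] *_) (trans (cong sgn (⟨⟩-⊕ʳ b x w)) (sgn-xor ⟨ b , x ⟩ ⟨ b , w ⟩)))
          (middle [ perp A w ] (sgn ⟨ b , x ⟩) (sgn ⟨ b , w ⟩)))
        (trans (∑-*ˡ (cube n) (sgn ⟨ b , x ⟩) λ w → [ perp A w ] * sgn ⟨ b , w ⟩)
        (trans (cong (sgn ⟨ b , x ⟩ *_) character-sum) (*-zeroʳ (sgn ⟨ b , x ⟩))))

    -- Plancherel involves only frequencies in `B`, and those of `R` lie in `A`, so 𝟎 alone
    -- survives. Equivalently, `R` is spread evenly over the cosets of `perp B`.
    equidistribution : # B * (∑[ h ∈ cube n ] [ perp B h ] * ∑ (cube n) (E h)) ≡ # R * # R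
    equidistribution = begin
      # B * (∑[ h ∈ cube n ] [ perp B h ] * ∑ (cube n) (E h))
        ≡⟨ cong (# B *_) (∑-cong (cube n) λ h → cong ([ perp B h ] *_)
             (∑-cong (cube n) λ x → sym (*-identityʳ (E h x)))) ⟩
      # B * (∑[ h ∈ cube n ] [ perp B h ] * (∑[ x ∈ cube n ] E h x * 1ℤ))
        ≡⟨ cong (# B *_) (pairs-by-difference λ _ _ → 1ℤ) ⟨
      # B * (∑[ x ∈ cube n ] ∑[ y ∈ cube n ] [ perp B (x ⊕ y) ] * ([ R x ] * [ R y ] * 1ℤ))
        ≡⟨ cong (# B *_) (∑-cong (cube n) λ x → ∑-cong (cube n) λ y →
             trans (cong ([ perp B (x ⊕ y) ] *_) (*-identityʳ ([ R x ] * [ R y ])))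
             (*-comm [ perp B (x ⊕ y) ] ([ R x ] * [ R y ]))) ⟩
      # B * (∑[ x ∈ cube n ] ∑[ y ∈ cube n ] [ R x ] * [ R y ] * [ perp B (x ⊕ y) ])
        ≡⟨ plancherel B-sub (λ x → [ R x ]) ⟩
      (∑[ b ∈ cube n ] [ B b ] * (R-hat b * R-hat b))
        ≡⟨ ∑-cong (cube n) only-𝟎 ⟩
      (∑[ b ∈ cube n ] [ b == 𝟎 ] * (R-hat b * R-hat b))
        ≡⟨ trans (∑-cube-point 𝟎 λ b → R-hat b * R-hat b) (cong₂ _*_ R-hat-zero R-hat-zero) ⟩
      # R * # R ∎
      where
      open ≡-Reasoning
      only-𝟎 : ∀ b → [ B b ] * (R-hat b * R-hat b) ≡ [ b == 𝟎 ] * (R-hat b * R-hat b)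
      only-𝟎 b with b ≟ᵛ 𝟎
      ... | yes refl = cong (λ p → [ p ] * (R-hat 𝟎 * R-hat 𝟎)) (IsSubgroup.𝟎∈ B-sub)
      ... | no  b≢𝟎 with B b in b∈ | A b in a∈
      ...   | false | _     = refl
      ...   | true  | true  = contradiction (disjoint b a∈ b∈) b≢𝟎
      ...   | true  | false = cong (λ z → 1ℤ * (z * z)) (R-hat-vanishes b a∈)

    module _ (f g : Vec Bool n → Bool)
             (g-inv : ∀ x y → R x ≡ true → R y ≡ true → perp B (x ⊕ y) ≡ true → g x ≡ g y)
             (C : ℤ) (0≤C : 0ℤ ≤ C)
             (f-bound : ∀ h → h ≢ 𝟎 → ∀ x →
               (∑[ w ∈ cube n ] [ perp A w ] * sgn (f (x ⊕ w) xor f ((x ⊕ w) ⊕ h))) ≤ C) where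

      correlation : ℤ
      correlation = ∑[ x ∈ cube n ] [ R x ] * sgn (f x xor g x)

      D : Vec Bool n → ℤ
      D h = ∑[ x ∈ cube n ] E h x * sgn (f x xor f (x ⊕ h))

      private
        ψ : Vec Bool n → ℤ
        ψ x = [ R x ] * sgn (f x xor g x)

        sgn-cancel : ∀ p q r → sgn (p xor r) * sgn (q xor r) ≡ sgn (p xor q)
        sgn-cancel false false false = refl
        sgn-cancel false false true  = refl
        sgn-cancel false true  false = refl
        sgn-cancel false true  true  = refl
        sgn-cancel true  false false = refl
        sgn-cancel true  false true  = refl
        sgn-cancel true  true  false = refl
        sgn-cancel true  true  true  = refl

        shuffle : ∀ p s q t → p * s * (q * t) ≡ p * q * (s * t)
        shuffle = solve-∀

        -- On two points of `R` in one coset of `perp B` the values of `g` agree, so `g` cancels and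
        -- only the derivative of `f` remains.
        pointwise : ∀ x y → ψ x * ψ y * [ perp B (x ⊕ y) ] ≡
                            [ perp B (x ⊕ y) ] * ([ R x ] * [ R y ] * sgn (f x xor f y))
        pointwise x y = trans (*-comm (ψ x * ψ y) [ perp B (x ⊕ y) ]) ([]*-cong (perp B (x ⊕ y)) λ h∈ →
          trans (shuffle [ R x ] (sgn (f x xor g x)) [ R y ] (sgn (f y xor g y)))
          (trans (*-assoc [ R x ] [ R y ] _) (trans ([]*-cong (R x) λ x∈ → []*-cong (R y) λ y∈ →
            trans (cong (λ p → sgn (f x xor g x) * sgn (f y xor p)) (sym (g-inv x y x∈ y∈ h∈)))
              (sgn-cancel (f x) (f y) (g x)))
          (sym (*-assoc [ R x ] [ R y ] _)))))

      -- The left-hand side is the term b = 𝟎 of a Plancherel sum of squares.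
      correlation² : correlation * correlation ≤ # B * (∑[ h ∈ cube n ] [ perp B h ] * D h)
      correlation² = subst₂ _≤_ at-𝟎 (trans (sym (plancherel B-sub ψ)) (cong (# B *_) (trans
          (∑-cong (cube n) λ x → ∑-cong (cube n) (pointwise x))
          (pairs-by-difference λ x y → sgn (f x xor f y)))))
        (term≤∑ (∈-cube 𝟎) {λ b → [ B b ] * (ψ-hat b * ψ-hat b)} λ b →
          *-nonneg ([]-nonneg (B b)) (square-nonneg (ψ-hat b)))
        where
        ψ-hat : Vec Bool n → ℤ
        ψ-hat b = ∑[ x ∈ cube n ] ψ x * sgn ⟨ b , x ⟩
        ψ-hat-𝟎 : ψ-hat 𝟎 ≡ correlation
        ψ-hat-𝟎 = ∑-cong (cube n) λ x → trans (cong (λ p → ψ x * sgn p) (⟨𝟎,⟩ x)) (*-identityʳ (ψ x))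
        at-𝟎 : [ B 𝟎 ] * (ψ-hat 𝟎 * ψ-hat 𝟎) ≡ correlation * correlation
        at-𝟎 = trans (cong₂ (λ p i → [ p ] * (i * i)) (IsSubgroup.𝟎∈ B-sub) ψ-hat-𝟎) (*-identityˡ _)

      -- For h ≠ 𝟎, `E h` is invariant under `perp A`, and averaging reduces `D h` to coset sums
      -- bounded by `C`. At h = 𝟎 the term with `C` is mere slack; keeping it lets the sum over all
      -- `h` be evaluated by `equidistribution`.
      D-bound : ∀ h → # (perp A) * D h ≤ [ h == 𝟎 ] * (# (perp A) * # R) + C * ∑ (cube n) (E h)
      D-bound h with h ≟ᵛ 𝟎
      ... | yes refl = subst₂ _≤_ (trans (+-identityʳ _) (cong (# (perp A) *_) (sym D𝟎)))
          (cong (_+ C * ∑ (cube n) (E 𝟎)) (sym (*-identityˡ (# (perp A) * # R))))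
          (+-monoʳ-≤ (# (perp A) * # R) (*-nonneg 0≤C (∑-nonneg (cube n) (E-nonneg 𝟎))))
        where
        idem : ∀ p → [ p ] * [ p ] * 1ℤ ≡ [ p ]
        idem true  = refl
        idem false = refl
        D𝟎 : D 𝟎 ≡ # R
        D𝟎 = ∑-cong (cube n) λ x → trans
          (cong₂ (λ p q → [ R x ] * [ p ] * sgn q) (cong R (⊕-identityʳ x))
            (trans (cong (λ z → f x xor f z) (⊕-identityʳ x)) (Bool.xor-same (f x))))
          (idem (R x))
      ... | no h≢𝟎 = subst₂ _≤_ (sym (averaging (λ x → sgn (f x xor f (x ⊕ h))) (E h) (E-inv h)))
          (trans (∑-*ʳ (cube n) C (E h)) (trans (*-comm (∑ (cube n) (E h)) C) (sym (+-identityˡ _))))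
          (∑-mono (cube n) λ x → *-monoˡ (E h x) (E-nonneg h x) (f-bound h h≢𝟎 x))

      -- Multiplying by # A · # (perp A) = 2^n removes the divisions by # (perp A) and # B. The
      -- first summand comes from h = 𝟎, the second from counting all pairs.
      discrepancy : 2^ⁿ n * (correlation * correlation) ≤ 2^ⁿ n * (# B * # R) + C * # A * (# R * # R)
      discrepancy = subst (λ m → m * (correlation * correlation) ≤ 2^ⁿ n * (# B * # R) + C * # A * (# R * # R))
        (#-perp A-sub) (begin
        # A * W * (correlation * correlation)
          ≤⟨ *-monoˡ (# A * W) (*-nonneg (#-nonneg A) (#-nonneg (perp A))) correlation² ⟩
        # A * W * (# B * (∑[ h ∈ cube n ] [ perp B h ] * D h))
          ≡⟨ regroup (# A) W (# B) _ ⟩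
        # A * # B * (W * (∑[ h ∈ cube n ] [ perp B h ] * D h))
          ≡⟨ cong (# A * # B *_) (trans (sym (∑-*ˡ (cube n) W λ h → [ perp B h ] * D h))
               (∑-cong (cube n) λ h → middle W [ perp B h ] (D h))) ⟩
        # A * # B * (∑[ h ∈ cube n ] [ perp B h ] * (W * D h))
          ≤⟨ *-monoˡ (# A * # B) (*-nonneg (#-nonneg A) (#-nonneg B))
               (∑-mono (cube n) λ h → []*-mono (perp B h) (D-bound h)) ⟩
        # A * # B * (∑[ h ∈ cube n ] [ perp B h ] * ([ h == 𝟎 ] * (W * # R) + C * ∑ (cube n) (E h)))
          ≡⟨ cong (# A * # B *_) (trans
               (∑-cong (cube n) λ h → distribute [ perp B h ] [ h == 𝟎 ] (W * # R) C (∑ (cube n) (E h)))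
               (trans (∑-+ (cube n) (λ h → [ h == 𝟎 ] * ([ perp B h ] * (W * # R))) (λ h → C * ([ perp B h ] * ∑ (cube n) (E h))))
               (cong₂ _+_ (trans (∑-cube-point 𝟎 λ h → [ perp B h ] * (W * # R))
                            (trans (cong (λ p → [ p ] * (W * # R)) (IsSubgroup.𝟎∈ (perp-subgroup B))) (*-identityˡ (W * # R))))
                          (∑-*ˡ (cube n) C λ h → [ perp B h ] * ∑ (cube n) (E h))))) ⟩
        # A * # B * (W * # R + C * (∑[ h ∈ cube n ] [ perp B h ] * ∑ (cube n) (E h)))
          ≡⟨ collect (# A) (# B) W (# R) C _ ⟩
        # A * W * (# B * # R) + C * # A * (# B * (∑[ h ∈ cube n ] [ perp B h ] * ∑ (cube n) (E h)))
          ≡⟨ cong₂ (λ m e → m * (# B * # R) + C * # A * e) (#-perp A-sub) equidistribution ⟩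
        2^ⁿ n * (# B * # R) + C * # A * (# R * # R) ∎)
        where
        open ≤-Reasoning
        W : ℤ
        W = # (perp A)
        regroup : ∀ a w b d → a * w * (b * d) ≡ a * b * (w * d)
        regroup = solve-∀
        distribute : ∀ p q r c s → p * (q * r + c * s) ≡ q * (p * r) + c * (p * s)
        distribute = solve-∀
        collect : ∀ a b w r c s → a * b * (w * r + c * s) ≡ a * w * (b * r) + c * a * (b * s)
        collect = solve-∀

      -- With `small`, `discrepancy` becomes τ²S² ≤ τ²|B||R| + |R|². Writing e = τ²|B|, the
      -- nonnegative e² + e|R| is added to reach the square of |R| + e, and both squares are then
      -- removed.
      correlation-bound : ∀ τ → 0ℤ ≤ τ → C * # A * (τ * τ) ≤ 2^ⁿ n → τ * correlation ≤ # R + τ * τ * # B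
      correlation-bound τ 0≤τ small = square-cancel-≤ (+-nonneg (#-nonneg R) 0≤τ²b)
        (*-cancelˡ-≤-pos (τ * correlation * (τ * correlation)) _ (2^ⁿ n) {{positive (2^ⁿ>0 n)}} (begin
          2^ⁿ n * (τ * correlation * (τ * correlation))
            ≡⟨ regroup (2^ⁿ n) τ correlation ⟩
          τ * τ * (2^ⁿ n * (correlation * correlation))
            ≤⟨ *-monoˡ (τ * τ) (square-nonneg τ) discrepancy ⟩
          τ * τ * (2^ⁿ n * (# B * # R) + C * # A * (# R * # R))
            ≡⟨ expand τ (2^ⁿ n) (# B) (# R) (C * # A) ⟩
          2^ⁿ n * (τ * τ * # B * # R) + C * # A * (τ * τ) * (# R * # R)
            ≤⟨ +-monoʳ-≤ (2^ⁿ n * (τ * τ * # B * # R)) (*-monoʳ (# R * # R) (square-nonneg (# R)) small) ⟩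
          2^ⁿ n * (τ * τ * # B * # R) + 2^ⁿ n * (# R * # R)
            ≡⟨ +-identityʳ _ ⟨
          2^ⁿ n * (τ * τ * # B * # R) + 2^ⁿ n * (# R * # R) + 0ℤ
            ≤⟨ +-monoʳ-≤ (2^ⁿ n * (τ * τ * # B * # R) + 2^ⁿ n * (# R * # R)) (*-nonneg (<⇒≤ (2^ⁿ>0 n)) (+-nonneg (*-nonneg 0≤τ²b 0≤τ²b) (*-nonneg 0≤τ²b (#-nonneg R)))) ⟩
          2^ⁿ n * (τ * τ * # B * # R) + 2^ⁿ n * (# R * # R) +
            2^ⁿ n * (τ * τ * # B * (τ * τ * # B) + τ * τ * # B * # R)
            ≡⟨ complete (2^ⁿ n) (τ * τ * # B) (# R) ⟩
          2^ⁿ n * ((# R + τ * τ * # B) * (# R + τ * τ * # B)) ∎))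
        where
        open ≤-Reasoning
        0≤τ²b : 0ℤ ≤ τ * τ * # B
        0≤τ²b = *-nonneg (square-nonneg τ) (#-nonneg B)
        regroup : ∀ a t s → a * (t * s * (t * s)) ≡ t * t * (a * (s * s))
        regroup = solve-∀
        expand : ∀ t a b r d → t * t * (a * (b * r) + d * (r * r)) ≡ a * (t * t * b * r) + d * (t * t) * (r * r)
        expand = solve-∀
        complete : ∀ a e r → a * (e * r) + a * (r * r) + a * (e * e + e * r) ≡ a * ((r + e) * (r + e))
        complete = solve-∀

-- Character sums of a quadratic form over cosets.

module CubicForms where
  open IntegerSums
  open Cube
  open Duality
  open CosetDiscrepancy
  open import Data.Bool.Base using (true; false; _∧_; _xor_)
  import Data.Bool.Properties as Bool
  open import Data.Integer.Base using (0ℤ; 1ℤ; _*_; _≤_; +≤+; -≤+)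
  open import Data.Integer.Properties
  open import Data.Integer.Tactic.RingSolver using (solve-∀)
  open import Data.Product.Base using (∃; _,_)
  open import Relation.Binary.PropositionalEquality using (refl; sym; trans; cong; cong₂; subst; subst₂)
  open import Relation.Nullary using (yes; no; contradiction)

  -- Double counting: the fibres of `π` over the k-cube cover `K`, and each contains at most one of
  -- its elements.
  #-injective : ∀ {n k} (K : Vec Bool n → Bool) (π : Vec Bool n → Vec Bool k) →
    (∀ v w → K v ≡ true → K w ≡ true → π v ≡ π w → v ≡ w) → # K ≤ 2^ⁿ k
  #-injective {n} {k} K π inj = subst₂ _≤_ fibres (∑-cube-1 k) (∑-mono (cube k) fibre≤1)
    where
    fibres : (∑[ p ∈ cube k ] ∑[ w ∈ cube n ] [ p == π w ] * [ K w ]) ≡ # K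
    fibres = trans (∑-swap (cube k) (cube n) λ p w → [ p == π w ] * [ K w ])
      (∑-cong (cube n) λ w → ∑-cube-point (π w) λ _ → [ K w ])
    fibre≤1 : ∀ p → (∑[ w ∈ cube n ] [ p == π w ] * [ K w ]) ≤ 1ℤ
    fibre≤1 p with ∃-cube? (λ w → (p == π w) ∧ K w Bool.≟ true)
    ... | yes (w₀ , eq) = subst (_ ≤_) (∑-cube-point w₀ λ _ → 1ℤ) (∑-mono (cube n) term)
      where
      term : ∀ w → [ p == π w ] * [ K w ] ≤ [ w == w₀ ] * 1ℤ
      term w with p ≟ᵛ π w | K w in w∈ | w ≟ᵛ w₀
      ... | no _     | _     | yes _   = +≤+ ℕ.z≤n
      ... | no _     | _     | no _    = ≤-refl
      ... | yes _    | false | yes _   = +≤+ ℕ.z≤n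
      ... | yes _    | false | no _    = ≤-refl
      ... | yes _    | true  | yes _   = ≤-refl
      ... | yes refl | true  | no w≢w₀ with ∧-true (π w == π w₀) eq
      ...   | eqπ , w₀∈ with π w ≟ᵛ π w₀
      ...     | yes πw≡πw₀ = contradiction (inj w w₀ w∈ w₀∈ πw≡πw₀) w≢w₀
    ... | no none = subst (_≤ 1ℤ) (sym (trans (∑-cong (cube n) vanish) (∑-zero (cube n)))) (+≤+ ℕ.z≤n)
      where
      vanish : ∀ w → [ p == π w ] * [ K w ] ≡ 0ℤ
      vanish w = trans (sym ([]-∧ (p == π w) (K w))) (cong [_] (Bool.¬-not λ eq → none (w , eq)))

  -- For D a directional derivative of a cubic form, the second difference T does not depend on x.
  module _ {n : ℕ} (D : Vec Bool n → Bool) (T : Vec Bool n → Vec Bool n → Bool)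
           (second : ∀ x w u → D (x ⊕ w) xor D (x ⊕ (w ⊕ u)) ≡ (D x xor D (x ⊕ u)) xor T w u)
           (additiveˡ : ∀ u → Additive λ w → T w u) (additiveʳ : ∀ w → Additive (T w))
           (K : Vec Bool n → Bool) (K-radical : ∀ w → K w ≡ false → ∃ λ u → T w u ≡ true)
           {W : Vec Bool n → Bool} (W-sub : IsSubgroup W) where

    private
      sgn≤1 : ∀ p → sgn p ≤ 1ℤ
      sgn≤1 false = ≤-refl
      sgn≤1 true  = -≤+

      signed≤ : ∀ p q {i} → 0ℤ ≤ i → [ p ] * (sgn q * i) ≤ i
      signed≤ false q     0≤i = 0≤i
      signed≤ true  q {i} 0≤i = subst (_≤ i) (sym (*-identityˡ (sgn q * i)))
        (subst (sgn q * i ≤_) (*-identityˡ i) (*-monoʳ i 0≤i (sgn≤1 q)))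

      -- Outside `K` the additive map `T w` is nontrivial on the whole cube and its signs cancel;
      -- inside, the trivial bound is used.
      row : ∀ w → (∑[ u ∈ cube n ] sgn (T w u)) ≤ [ K w ] * 2^ⁿ n
      row w with K w in eq
      ... | true  = subst ((∑[ u ∈ cube n ] sgn (T w u)) ≤_) (trans (∑-cube-1 n) (sym (*-identityˡ (2^ⁿ n)))) (∑-mono (cube n) λ u → sgn≤1 (T w u))
      ... | false = let u , Twu = K-radical w eq in ≤-reflexive
        (trans (∑-cong (cube n) λ u → sym (*-identityˡ (sgn (T w u))))
               (character-sum-nontrivial (everything {n}) (additiveʳ w) u refl Twu))

    subgroup-sum : Vec Bool n → ℤ
    subgroup-sum x = ∑[ w ∈ cube n ] [ W w ] * sgn (D (x ⊕ w))

    -- Weyl differencing: in the squared sum the substitution v = w ⊕ u turns the dependence on `w`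
    -- into the additive `T w u`. Although `W` is an arbitrary subgroup, only the radical on the
    -- whole cube enters.
    subgroup-sum² : ∀ x → subgroup-sum x * subgroup-sum x ≤ 2^ⁿ n * # K
    subgroup-sum² x = begin
      subgroup-sum x * subgroup-sum x
        ≡⟨ ∑-* (cube n) (cube n) s s ⟩
      (∑[ w ∈ cube n ] ∑[ v ∈ cube n ] s w * s v)
        ≡⟨ ∑-cong (cube n) (λ w → sym (∑-translateˡ w λ v → s w * s v)) ⟩
      (∑[ w ∈ cube n ] ∑[ u ∈ cube n ] s w * s (w ⊕ u))
        ≡⟨ ∑-swap (cube n) (cube n) (λ w u → s w * s (w ⊕ u)) ⟩
      (∑[ u ∈ cube n ] ∑[ w ∈ cube n ] s w * s (w ⊕ u))
        ≡⟨ ∑-cong (cube n) (λ u → trans (∑-cong (cube n) (pointwise u)) (trans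
             (∑-*ˡ (cube n) [ W u ] _) (cong ([ W u ] *_) (∑-*ˡ (cube n) (sgn (D x xor D (x ⊕ u))) λ w → [ W w ] * sgn (T w u))))) ⟩
      (∑[ u ∈ cube n ] [ W u ] * (sgn (D x xor D (x ⊕ u)) * Y u))
        ≤⟨ ∑-mono (cube n) (λ u → signed≤ (W u) (D x xor D (x ⊕ u)) (character-sum-nonneg W-sub (additiveˡ u))) ⟩
      (∑[ u ∈ cube n ] Y u)
        ≡⟨ trans (∑-swap (cube n) (cube n) λ u w → [ W w ] * sgn (T w u))
             (∑-cong (cube n) λ w → ∑-*ˡ (cube n) [ W w ] λ u → sgn (T w u)) ⟩
      (∑[ w ∈ cube n ] [ W w ] * (∑[ u ∈ cube n ] sgn (T w u)))
        ≤⟨ ∑-mono (cube n) (λ w → ≤-trans ([]*-mono (W w) (row w)) (drop (W w) (*-nonneg ([]-nonneg (K w)) (+≤+ ℕ.z≤n)))) ⟩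
      (∑[ w ∈ cube n ] [ K w ] * 2^ⁿ n)
        ≡⟨ trans (∑-*ʳ (cube n) (2^ⁿ n) λ w → [ K w ]) (*-comm (# K) (2^ⁿ n)) ⟩
      2^ⁿ n * # K ∎
      where
      open ≤-Reasoning
      s Y : Vec Bool n → ℤ
      s w = [ W w ] * sgn (D (x ⊕ w))
      Y u = ∑[ w ∈ cube n ] [ W w ] * sgn (T w u)
      drop : ∀ p {i} → 0ℤ ≤ i → [ p ] * i ≤ i
      drop true  {i} _   = ≤-reflexive (*-identityˡ i)
      drop false     0≤i = 0≤i
      shuffle : ∀ a b c d → a * b * (c * d) ≡ a * (c * (b * d))
      shuffle = solve-∀
      unshuffle : ∀ a b c d → a * (b * (c * d)) ≡ b * (c * (a * d))
      unshuffle = solve-∀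
      pointwise : ∀ u w → s w * s (w ⊕ u) ≡ [ W u ] * (sgn (D x xor D (x ⊕ u)) * ([ W w ] * sgn (T w u)))
      pointwise u w = trans (shuffle [ W w ] (sgn (D (x ⊕ w))) [ W (w ⊕ u) ] (sgn (D (x ⊕ (w ⊕ u)))))
        (trans ([]*-cong (W w) λ w∈ → cong₂ (λ p i → [ p ] * i)
            (trans (cong W (⊕-comm w u)) (IsSubgroup.translate W-sub u w∈))
            (trans (sym (sgn-xor (D (x ⊕ w)) _)) (trans (cong sgn (second x w u)) (sgn-xor (D x xor D (x ⊕ u)) (T w u)))))
          (unshuffle [ W w ] [ W u ] (sgn (D x xor D (x ⊕ u))) (sgn (T w u))))

-- Characteristic two, roots of polynomials and nondegeneracy of the trace.

module BinaryFieldTrace {c ℓ₁ ℓ₂ : Level} {k : ℕ} (F : BinaryField c ℓ₁ ℓ₂ k)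
  (φ : Vec Bool k → BinaryField.Carrier F) (iso : IsLinearIsomorphism F φ) where
  open Cube using (⊕-self)
  open import Algebra.Bundles using (CommutativeRing; RawRing)
  open import Algebra.Apartness.Bundles using (HeytingField)
  import Algebra.Apartness.Properties.HeytingCommutativeRing as Heyting
  import Algebra.Properties.CommutativeMonoid.Sum as Sum
  import Algebra.Properties.Semiring.Exp as Exp
  import Algebra.Properties.Group as Group
  import Algebra.Solver.Ring as RingSolver
  open import Algebra.Solver.Ring.AlmostCommutativeRing
    using (AlmostCommutativeRing; fromCommutativeRing; _-Raw-AlmostCommutative⟶_; Induced-equivalence)
  open import Data.Bool.Base using (true; false; _∧_; _xor_)
  open import Data.Empty using (⊥)
  open import Data.Fin.Base using (Fin; toℕ; inject₁; inject≤; fromℕ)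
  open import Data.Fin.Properties using (toℕ-inject₁; toℕ-fromℕ; inject≤-injective; 0≢1+n; suc-injective)
  open import Data.Maybe.Base using (just; nothing)
  open import Data.Nat.Base as ℕ using (zero; suc; s≤s; z≤n)
  import Data.Nat.Properties as ℕ
  open import Data.Product.Base using (∃; _,_; proj₁; proj₂)
  open import Data.Vec.Base using ([]; _∷_)
  open import Function.Base using (_∘_)
  open import Function.Bundles using (Inverse)
  open import Relation.Binary.Definitions using (WeaklyDecidable)
  import Relation.Binary.PropositionalEquality as ≡
  open ≡ using (_≡_)
  open import Relation.Nullary using (¬_; contradiction)

  open BinaryField F using (heytingField; commutativeRing; enumeration)
  open CommutativeRing commutativeRing
  open HeytingField heytingField using (_#_; tight; #⇒invertible; heytingCommutativeRing)
  open Heyting heytingCommutativeRing using (1#0; x-0≈x)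
  open Exp semiring using (_^_; ^-congˡ; ^-homo-*)
  open Sum +-commutativeMonoid using (sum-cong-≋; ∑-distrib-+; sum-init-last; sum-syntax)
  open IsLinearIsomorphism iso
  open import Relation.Binary.Reasoning.Setoid setoid

  φ-surjective : ∀ y → ∃ λ x → φ x ≈ y
  φ-surjective y = let x , φx≈y = proj₂ bijective y in x , φx≈y ≡.refl

  φ-injective : ∀ {x y} → φ x ≈ φ y → x ≡ y
  φ-injective = proj₁ bijective

  φ-𝟎 : φ 𝟎 ≈ 0#
  φ-𝟎 = Group.identityˡ-unique +-group (φ 𝟎) (φ 𝟎)
    (trans (sym (additive 𝟎 𝟎)) (reflexive (≡.cong φ (⊕-self 𝟎))))
  -- The characteristic is read off from `φ`: its domain has exponent two, and 1 lies in its image.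
  1+1≈0 : 1# + 1# ≈ 0#
  1+1≈0 = let e , φe≈1 = φ-surjective 1# in begin
    1# + 1#     ≈⟨ +-cong φe≈1 φe≈1 ⟨
    φ e + φ e   ≈⟨ additive e e ⟨
    φ (e ⊕ e)   ≡⟨ ≡.cong φ (⊕-self e) ⟩
    φ 𝟎         ≈⟨ φ-𝟎 ⟩
    0#          ∎
  1≉0 : ¬ 1# ≈ 0#
  1≉0 1≈0 = proj₂ (tight 1# 0#) 1≈0 1#0

  ι-xor : ∀ p q → ι F (p xor q) ≈ ι F p + ι F q
  ι-xor false q     = sym (+-identityˡ (ι F q))
  ι-xor true  false = sym (+-identityʳ 1#)
  ι-xor true  true  = sym 1+1≈0

  ι-∧ : ∀ p q → ι F (p ∧ q) ≈ ι F p * ι F q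
  ι-∧ false q = sym (zeroˡ (ι F q))
  ι-∧ true  q = sym (*-identityˡ (ι F q))

  ι-injective : ∀ p q → ι F p ≈ ι F q → p ≡ q
  ι-injective false false _  = ≡.refl
  ι-injective true  true  _  = ≡.refl
  ι-injective false true  eq = contradiction (sym eq) 1≉0
  ι-injective true  false eq = contradiction eq 1≉0

  x≈-x : ∀ x → x ≈ - x
  x≈-x x = Group.inverseˡ-unique +-group x x (begin
    x + x             ≈⟨ +-cong (*-identityˡ x) (*-identityˡ x) ⟨
    1# * x + 1# * x   ≈⟨ distribʳ x 1# 1# ⟨
    (1# + 1#) * x     ≈⟨ *-congʳ 1+1≈0 ⟩
    0# * x            ≈⟨ zeroˡ x ⟩
    0#                ∎)

  -- The ring solver with coefficients in 𝔽₂, which knows that the characteristic is 2.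
  private
    𝔽₂ : RawRing _ _
    𝔽₂ = record { Carrier = Bool ; _≈_ = _≡_ ; _+_ = _xor_ ; _*_ = _∧_ ; -_ = λ p → p ; 0# = false ; 1# = true }

    almostRing : AlmostCommutativeRing c ℓ₁
    almostRing = fromCommutativeRing commutativeRing

    ι-morphism : 𝔽₂ -Raw-AlmostCommutative⟶ almostRing
    ι-morphism = record
      { ⟦_⟧ = ι F ; +-homo = ι-xor ; *-homo = ι-∧ ; -‿homo = λ p → x≈-x (ι F p) ; 0-homo = refl ; 1-homo = refl }

    coefficient≟ : WeaklyDecidable (Induced-equivalence ι-morphism)
    coefficient≟ false false = just refl
    coefficient≟ true  true  = just refl
    coefficient≟ _     _     = nothing

  module Char2 = RingSolver 𝔽₂ almostRing ι-morphism coefficient≟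

  frobenius : ∀ i x y → (x + y) ^ (2 ℕ.^ i) ≈ x ^ (2 ℕ.^ i) + y ^ (2 ℕ.^ i)
  frobenius zero    x y = solve 2 (λ x y → (x :+ y) :* con true := x :* con true :+ y :* con true) refl x y
    where open Char2
  frobenius (suc i) x y = begin
    (x + y) ^ (m ℕ.+ (m ℕ.+ 0))
      ≈⟨ square (x + y) ⟩
    (x + y) ^ m * (x + y) ^ m
      ≈⟨ *-cong (frobenius i x y) (frobenius i x y) ⟩
    (x ^ m + y ^ m) * (x ^ m + y ^ m)
      ≈⟨ solve 2 (λ a b → (a :+ b) :* (a :+ b) := a :* a :+ b :* b) refl (x ^ m) (y ^ m) ⟩
    x ^ m * x ^ m + y ^ m * y ^ m
      ≈⟨ +-cong (square x) (square y) ⟨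
    x ^ (m ℕ.+ (m ℕ.+ 0)) + y ^ (m ℕ.+ (m ℕ.+ 0)) ∎
    where
    open Char2
    m = 2 ℕ.^ i
    square : ∀ z → z ^ (m ℕ.+ (m ℕ.+ 0)) ≈ z ^ m * z ^ m
    square z = trans (reflexive (≡.cong (λ e → z ^ (m ℕ.+ e)) (ℕ.+-identityʳ m))) (^-homo-* z m m)

  Tr-cong : ∀ {x y} → x ≈ y → Tr F x ≈ Tr F y
  Tr-cong x≈y = sum-cong-≋ {k} λ i → ^-congˡ (2 ℕ.^ toℕ i) x≈y

  Tr-+ : ∀ x y → Tr F (x + y) ≈ Tr F x + Tr F y
  Tr-+ x y = trans (sum-cong-≋ {k} λ i → frobenius (toℕ i) x y)
    (∑-distrib-+ {k} (λ i → x ^ (2 ℕ.^ toℕ i)) (λ i → y ^ (2 ℕ.^ toℕ i)))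

  -- Evaluates a monic polynomial given by its lower coefficients, constant term first.
  monic : ∀ {d} → Vec Carrier d → Carrier → Carrier
  monic []       x = 1#
  monic (a ∷ as) x = a + x * monic as x

  -- Synthetic division by x - r, which in characteristic two is x + r; the remainder is the value
  -- at `r`.
  quotient : ∀ {d} → Vec Carrier (suc d) → Carrier → Vec Carrier d
  quotient (a ∷ [])      r = []
  quotient (a ∷ b ∷ as) r = monic (b ∷ as) r ∷ quotient (b ∷ as) r

  quotient-correct : ∀ {d} (as : Vec Carrier (suc d)) r x →
    monic as x ≈ (x + r) * monic (quotient as r) x + monic as r
  quotient-correct (a ∷ [])     r x = solve 3 (λ a r x →
      a :+ x :* con true := (x :+ r) :* con true :+ (a :+ r :* con true)) refl a r x
    where open Char2
  quotient-correct (a ∷ b ∷ as) r x = begin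
    a + x * p x
      ≈⟨ +-congˡ (*-congˡ (quotient-correct (b ∷ as) r x)) ⟩
    a + x * ((x + r) * q + p r)
      ≈⟨ solve 5 (λ a r x q s → a :+ x :* ((x :+ r) :* q :+ s) :=
           (x :+ r) :* (s :+ x :* q) :+ (a :+ r :* s)) refl a r x q (p r) ⟩
    (x + r) * (p r + x * q) + (a + r * p r) ∎
    where
    open Char2
    p = monic (b ∷ as)
    q = monic (quotient (b ∷ as) r) x

  -- Inverses are available only for elements apart from 0, so y ≈ 0 is obtained by tightness: an
  -- inverse of `y` would force a ≈ 0.
  zero-product : ∀ {a y} → ¬ a ≈ 0# → a * y ≈ 0# → y ≈ 0#
  zero-product {a} {y} a≉0 ay≈0 = proj₁ (tight y 0#) λ y#0 →
    let y⁻¹ , _ , yy⁻¹≈1 = #⇒invertible y#0 in a≉0 (begin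
      a                    ≈⟨ *-identityʳ a ⟨
      a * 1#               ≈⟨ *-congˡ yy⁻¹≈1 ⟨
      a * ((y - 0#) * y⁻¹) ≈⟨ *-congˡ (*-congʳ (x-0≈x y)) ⟩
      a * (y * y⁻¹)        ≈⟨ *-assoc a y y⁻¹ ⟨
      a * y * y⁻¹          ≈⟨ *-congʳ ay≈0 ⟩
      0# * y⁻¹             ≈⟨ zeroˡ y⁻¹ ⟩
      0#                   ∎)

  -- Dividing out one root leaves the remaining d roots to a monic quotient of degree d - 1. At
  -- degree 0 the polynomial is the constant 1.
  too-many-roots : ∀ {d} (as : Vec Carrier d) (r : Fin (suc d) → Carrier) →
    (∀ {i j} → r i ≈ r j → i ≡ j) → (∀ i → monic as (r i) ≈ 0#) → ⊥
  too-many-roots []           r r-inj root = 1≉0 (root Fin.zero)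
  too-many-roots as@(_ ∷ _) r r-inj root = too-many-roots (quotient as r₀) (r ∘ Fin.suc)
    (suc-injective ∘ r-inj) λ i → zero-product (distinct i) (begin
      (r (Fin.suc i) + r₀) * monic (quotient as r₀) (r (Fin.suc i))
        ≈⟨ +-identityʳ _ ⟨
      (r (Fin.suc i) + r₀) * monic (quotient as r₀) (r (Fin.suc i)) + 0#
        ≈⟨ +-congˡ (root Fin.zero) ⟨
      (r (Fin.suc i) + r₀) * monic (quotient as r₀) (r (Fin.suc i)) + monic as r₀
        ≈⟨ quotient-correct as r₀ (r (Fin.suc i)) ⟨
      monic as (r (Fin.suc i))
        ≈⟨ root (Fin.suc i) ⟩
      0# ∎)
    where
    r₀ = r Fin.zero
    distinct : ∀ i → ¬ r (Fin.suc i) + r₀ ≈ 0#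
    distinct i eq = contradiction (r-inj (begin
      r₀                         ≈⟨ solve 2 (λ a b → a := (b :+ a) :+ b) refl r₀ (r (Fin.suc i)) ⟩
      (r (Fin.suc i) + r₀) + r (Fin.suc i) ≈⟨ +-congʳ eq ⟩
      0# + r (Fin.suc i)         ≈⟨ +-identityˡ _ ⟩
      r (Fin.suc i)              ∎)) 0≢1+n
      where open Char2

  -- The inequality d < m makes x^m the leading term and turns the old leading 1 into an ordinary
  -- coefficient.
  monic-+^ : ∀ {d} (as : Vec Carrier d) {m} → d ℕ.< m →
             ∃ λ (bs : Vec Carrier m) → ∀ x → monic bs x ≈ monic as x + x ^ m
  monic-+^ []       {suc m} _         = 1# ∷ power m , λ x → +-congˡ (*-congˡ (power-correct m x))
    where
    power : ∀ m → Vec Carrier m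
    power zero    = []
    power (suc m) = 0# ∷ power m
    power-correct : ∀ m x → monic (power m) x ≈ x ^ m
    power-correct zero    x = refl
    power-correct (suc m) x = trans (+-identityˡ _) (*-congˡ (power-correct m x))
  monic-+^ (a ∷ as) {suc m} (s≤s d<m) = let bs , eq = monic-+^ as d<m in a ∷ bs , λ x →
    trans (+-congˡ (*-congˡ (eq x))) (solve 4 (λ a x p q → a :+ x :* (p :+ q) := a :+ x :* p :+ x :* q)
      refl a x (monic as x) (x ^ m))
    where open Char2

  trace-polynomial : ∀ j → ∃ λ (as : Vec Carrier (2 ℕ.^ j)) →
    ∀ x → monic as x ≈ (∑[ i < suc j ] (x ^ (2 ℕ.^ toℕ i)))
  trace-polynomial zero    = 0# ∷ [] , λ x → solve 1 (λ x → con false :+ x :* con true := x :* con true :+ con false) refl x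
    where open Char2
  trace-polynomial (suc j) =
    let as , as-correct = trace-polynomial j
        bs , bs-correct = monic-+^ as (ℕ.^-monoʳ-< 2 (s≤s (s≤s z≤n)) (ℕ.n<1+n j))
    in bs , λ x → begin
      monic bs x
        ≈⟨ bs-correct x ⟩
      monic as x + x ^ (2 ℕ.^ suc j)
        ≈⟨ +-cong (as-correct x) (reflexive (≡.cong (λ e → x ^ (2 ℕ.^ e)) (≡.sym (toℕ-fromℕ (suc j))))) ⟩
      (∑[ i < suc j ] (x ^ (2 ℕ.^ toℕ i))) + x ^ (2 ℕ.^ toℕ (fromℕ (suc j)))
        ≈⟨ +-congʳ (sum-cong-≋ {suc j} λ i → reflexive (≡.cong (λ e → x ^ (2 ℕ.^ e)) (≡.sym (toℕ-inject₁ i)))) ⟩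
      (∑[ i < suc j ] (x ^ (2 ℕ.^ toℕ (inject₁ i)))) + x ^ (2 ℕ.^ toℕ (fromℕ (suc j)))
        ≈⟨ sum-init-last {suc j} (λ i → x ^ (2 ℕ.^ toℕ i)) ⟨
      (∑[ i < suc (suc j) ] (x ^ (2 ℕ.^ toℕ i))) ∎

  -- The trace is a monic polynomial of degree 2^(k-1), which is less than the number 2^k of field
  -- elements. The strict inequality supplies the one root too many.
  Tr-nontrivial : .{{_ : ℕ.NonZero k}} → ¬ (∀ x → Tr F x ≈ 0#)
  Tr-nontrivial Tr≈0 = too-many-roots as (λ i → to (inject≤ i 2^k′<2^k))
    (λ eq → inject≤-injective _ _ _ _ (to-injective eq))
    (λ i → trans (as-correct _) (trans (reflexive (≡.cong (power-sum (to (inject≤ i 2^k′<2^k))) (ℕ.suc-pred k)))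
      (Tr≈0 _)))
    where
    open Inverse enumeration using (to; from-cong; strictlyInverseʳ)
    power-sum : Carrier → ℕ → Carrier
    power-sum x j = ∑[ i < j ] (x ^ (2 ℕ.^ toℕ i))
    as = proj₁ (trace-polynomial (ℕ.pred k))
    as-correct = proj₂ (trace-polynomial (ℕ.pred k))
    2^k′<2^k : 2 ℕ.^ ℕ.pred k ℕ.< 2 ℕ.^ k
    2^k′<2^k = ℕ.^-monoʳ-< 2 (s≤s (s≤s z≤n)) (ℕ.≤-reflexive (ℕ.suc-pred k))
    to-injective : ∀ {i j} → to i ≈ to j → i ≡ j
    to-injective {i} {j} eq = ≡.trans (≡.sym (strictlyInverseʳ i)) (≡.trans (from-cong eq) (strictlyInverseʳ j))

  -- If `a` were invertible, its multiples would exhaust the field and the trace would vanish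
  -- everywhere.
  Tr-nondegenerate : .{{_ : ℕ.NonZero k}} → ∀ {a} → (∀ x → Tr F (a * x) ≈ 0#) → a ≈ 0#
  Tr-nondegenerate {a} Tr≈0 = proj₁ (tight a 0#) λ a#0 →
    let a⁻¹ , _ , aa⁻¹≈1 = #⇒invertible a#0 in Tr-nontrivial λ x → trans (Tr-cong (begin
      x                    ≈⟨ *-identityˡ x ⟨
      1# * x               ≈⟨ *-congʳ aa⁻¹≈1 ⟨
      (a - 0#) * a⁻¹ * x   ≈⟨ *-congʳ (*-congʳ (x-0≈x a)) ⟩
      a * a⁻¹ * x          ≈⟨ *-assoc a a⁻¹ x ⟩
      a * (a⁻¹ * x)        ∎)) (Tr≈0 (a⁻¹ * x))

-- Derivatives of the trace of a triple product and their radicals.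

module TraceOfTripleProduct {c ℓ₁ ℓ₂ : Level} {k : ℕ} .{{k≢0 : ℕ.NonZero k}} (F : BinaryField c ℓ₁ ℓ₂ k)
  (φ : Vec Bool k → BinaryField.Carrier F) (iso : IsLinearIsomorphism F φ)
  (f : Vec Bool (3 ℕ.* k) → Bool)
  (f-trace : ∀ x y z → BinaryField._≈_ F (ι F (f (concat (x ∷ y ∷ z ∷ []))))
     (Tr F (BinaryField._*ᶠ_ F (BinaryField._*ᶠ_ F (φ x) (φ y)) (φ z)))) where
  open import Algebra.Bundles using (CommutativeRing)
  open import Data.Bool.Base using (true; false; _xor_; not)
  import Data.Bool.Properties as Bool
  import Data.Integer.Base as ℤ
  import Data.Integer.Properties as ℤ
  import Data.Nat.Properties as ℕ
  open import Data.Product.Base using (∃; _,_)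
  open import Data.Vec.Base using (_++_; take; drop)
  open import Data.Vec.Properties using (take++drop≡id; take-zipWith; drop-zipWith; ++-injectiveˡ; ++-injectiveʳ)
  import Relation.Binary.PropositionalEquality as ≡
  open ≡ using (_≡_; _≢_)
  open import Relation.Nullary using (¬_; yes; no; does; contradiction)
  open IntegerSums
  open Cube
  open Duality
  open CubicForms
  open BinaryFieldTrace F φ iso
  open BinaryField F using (commutativeRing)
  open CommutativeRing commutativeRing
  open IsLinearIsomorphism iso using (additive)
  open import Relation.Binary.Reasoning.Setoid setoid

  part₁ part₂ part₃ : Vec Bool (3 ℕ.* k) → Vec Bool k
  part₁ v = take k v
  part₂ v = take k (drop k v)
  part₃ v = take k (drop k (drop k v))

  take-++ : ∀ {m n} (x : Vec Bool m) (y : Vec Bool n) → take m (x ++ y) ≡ x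
  take-++ {m} x y = ++-injectiveˡ (take m (x ++ y)) x (take++drop≡id m (x ++ y))

  drop-++ : ∀ {m n} (x : Vec Bool m) (y : Vec Bool n) → drop m (x ++ y) ≡ y
  drop-++ {m} x y = ++-injectiveʳ (take m (x ++ y)) x (take++drop≡id m (x ++ y))

  parts : ∀ v → concat (part₁ v ∷ part₂ v ∷ part₃ v ∷ []) ≡ v
  parts v = ≡.trans (≡.cong (λ w → part₁ v ++ part₂ v ++ w) (≡.trans
      (≡.cong (part₃ v ++_) (empty (drop k (drop k (drop k v))))) (take++drop≡id k _)))
    (≡.trans (≡.cong (part₁ v ++_) (take++drop≡id k _)) (take++drop≡id k v))
    where
    empty : (w : Vec Bool 0) → [] ≡ w
    empty [] = ≡.refl

  X Y Z : Vec Bool (3 ℕ.* k) → Carrier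
  X v = φ (part₁ v)
  Y v = φ (part₂ v)
  Z v = φ (part₃ v)

  module _ (x y z : Vec Bool k) where
    private
      v = concat (x ∷ y ∷ z ∷ [])

    part₁-concat : part₁ v ≡ x
    part₁-concat = take-++ x _

    part₂-concat : part₂ v ≡ y
    part₂-concat = ≡.trans (≡.cong (take k) (drop-++ x _)) (take-++ y _)

    part₃-concat : part₃ v ≡ z
    part₃-concat = ≡.trans (≡.cong (λ w → take k (drop k w)) (drop-++ x _))
      (≡.trans (≡.cong (take k) (drop-++ y _)) (take-++ z _))

  part₁-⊕ : ∀ v w → part₁ (v ⊕ w) ≡ part₁ v ⊕ part₁ w
  part₁-⊕ v w = take-zipWith _xor_ v w

  part₂-⊕ : ∀ v w → part₂ (v ⊕ w) ≡ part₂ v ⊕ part₂ w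
  part₂-⊕ v w = ≡.trans (≡.cong (take k) (drop-zipWith {m = k} _xor_ v w)) (take-zipWith _xor_ (drop k v) (drop k w))

  part₃-⊕ : ∀ v w → part₃ (v ⊕ w) ≡ part₃ v ⊕ part₃ w
  part₃-⊕ v w = ≡.trans (≡.cong (λ u → take k (drop k u)) (drop-zipWith {m = k} _xor_ v w))
    (≡.trans (≡.cong (take k) (drop-zipWith {m = k} _xor_ (drop k v) (drop k w)))
      (take-zipWith _xor_ (drop k (drop k v)) (drop k (drop k w))))

  X-⊕ : ∀ v w → X (v ⊕ w) ≈ X v + X w
  X-⊕ v w = trans (reflexive (≡.cong φ (part₁-⊕ v w))) (additive (part₁ v) (part₁ w))

  Y-⊕ : ∀ v w → Y (v ⊕ w) ≈ Y v + Y w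
  Y-⊕ v w = trans (reflexive (≡.cong φ (part₂-⊕ v w))) (additive (part₂ v) (part₂ w))

  Z-⊕ : ∀ v w → Z (v ⊕ w) ≈ Z v + Z w
  Z-⊕ v w = trans (reflexive (≡.cong φ (part₃-⊕ v w))) (additive (part₃ v) (part₃ w))

  ι-f : ∀ v → ι F (f v) ≈ Tr F (X v * Y v * Z v)
  ι-f v = trans (reflexive (≡.cong (λ w → ι F (f w)) (≡.sym (parts v)))) (f-trace (part₁ v) (part₂ v) (part₃ v))

  ι-f-⊕ : ∀ v w → ι F (f (v ⊕ w)) ≈ Tr F ((X v + X w) * (Y v + Y w) * (Z v + Z w))
  ι-f-⊕ v w = trans (ι-f (v ⊕ w)) (Tr-cong (*-cong (*-cong (X-⊕ v w) (Y-⊕ v w)) (Z-⊕ v w)))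

  -- The full polarisation of the cubic xyz: the permanent, in characteristic two also the
  -- determinant, of the matrix with rows (x, y, z), (x′, y′, z′), (a, b, c).
  polar : (x y z x′ y′ z′ a b c : Carrier) → Carrier
  polar x y z x′ y′ z′ a b c = a * (y * z′ + y′ * z) + b * (x * z′ + x′ * z) + c * (x * y′ + x′ * y)

  module Derivative (h : Vec Bool (3 ℕ.* k)) where

    D : Vec Bool (3 ℕ.* k) → Bool
    D v = f v xor f (v ⊕ h)

    derivative-polynomial : Carrier → Carrier → Carrier → Carrier
    derivative-polynomial x y z = x * y * z + (x + X h) * (y + Y h) * (z + Z h)

    ι-D : ∀ v → ι F (D v) ≈ Tr F (derivative-polynomial (X v) (Y v) (Z v))
    ι-D v = trans (ι-xor (f v) (f (v ⊕ h))) (trans (+-cong (ι-f v) (ι-f-⊕ v h)) (sym (Tr-+ _ _)))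

    ι-D₁ : ∀ v w → ι F (D (v ⊕ w)) ≈ Tr F (derivative-polynomial (X v + X w) (Y v + Y w) (Z v + Z w))
    ι-D₁ v w = trans (ι-D (v ⊕ w)) (Tr-cong (+-cong
      (*-cong (*-cong (X-⊕ v w) (Y-⊕ v w)) (Z-⊕ v w))
      (*-cong (*-cong (+-congʳ (X-⊕ v w)) (+-congʳ (Y-⊕ v w))) (+-congʳ (Z-⊕ v w)))))

    ι-D₂ : ∀ v w u → ι F (D (v ⊕ (w ⊕ u))) ≈
      Tr F (derivative-polynomial (X v + (X w + X u)) (Y v + (Y w + Y u)) (Z v + (Z w + Z u)))
    ι-D₂ v w u = trans (ι-D₁ v (w ⊕ u)) (Tr-cong (+-cong
      (*-cong (*-cong (+-congˡ (X-⊕ w u)) (+-congˡ (Y-⊕ w u))) (+-congˡ (Z-⊕ w u)))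
      (*-cong (*-cong (+-congʳ (+-congˡ (X-⊕ w u))) (+-congʳ (+-congˡ (Y-⊕ w u)))) (+-congʳ (+-congˡ (Z-⊕ w u))))))

    Δ² : Vec Bool (3 ℕ.* k) → Vec Bool (3 ℕ.* k) → Vec Bool (3 ℕ.* k) → Bool
    Δ² v w u = (D (v ⊕ w) xor D (v ⊕ (w ⊕ u))) xor (D v xor D (v ⊕ u))

    -- The base point 𝟎 is an arbitrary choice, as `ι-Δ²` shows.
    T : Vec Bool (3 ℕ.* k) → Vec Bool (3 ℕ.* k) → Bool
    T = Δ² 𝟎

    τ : Vec Bool (3 ℕ.* k) → Vec Bool (3 ℕ.* k) → Carrier
    τ w u = polar (X w) (Y w) (Z w) (X u) (Y u) (Z u) (X h) (Y h) (Z h)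

    -- With the derivative in direction `h` this is a third difference of xyz, in which everything
    -- but the trilinear part cancels; hence `v` disappears.
    ι-Δ² : ∀ v w u → ι F (Δ² v w u) ≈ Tr F (τ w u)
    ι-Δ² v w u = begin
      ι F (Δ² v w u)
        ≈⟨ trans (ι-xor (D (v ⊕ w) xor D (v ⊕ (w ⊕ u))) (D v xor D (v ⊕ u)))
             (+-cong (ι-xor (D (v ⊕ w)) (D (v ⊕ (w ⊕ u)))) (ι-xor (D v) (D (v ⊕ u)))) ⟩
      (ι F (D (v ⊕ w)) + ι F (D (v ⊕ (w ⊕ u)))) + (ι F (D v) + ι F (D (v ⊕ u)))
        ≈⟨ +-cong (+-cong (ι-D₁ v w) (ι-D₂ v w u)) (+-cong (ι-D v) (ι-D₁ v u)) ⟩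
      (Tr F d₁ + Tr F d₂) + (Tr F d₃ + Tr F d₄)
        ≈⟨ trans (Tr-+ (d₁ + d₂) (d₃ + d₄)) (+-cong (Tr-+ d₁ d₂) (Tr-+ d₃ d₄)) ⟨
      Tr F ((d₁ + d₂) + (d₃ + d₄))
        ≈⟨ Tr-cong (identity (X v) (Y v) (Z v) (X w) (Y w) (Z w) (X u) (Y u) (Z u) (X h) (Y h) (Z h)) ⟩
      Tr F (τ w u) ∎
      where
      d₁ = derivative-polynomial (X v + X w) (Y v + Y w) (Z v + Z w)
      d₂ = derivative-polynomial (X v + (X w + X u)) (Y v + (Y w + Y u)) (Z v + (Z w + Z u))
      d₃ = derivative-polynomial (X v) (Y v) (Z v)
      d₄ = derivative-polynomial (X v + X u) (Y v + Y u) (Z v + Z u)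
      open Char2
      identity : ∀ p q r x y z x′ y′ z′ a b c →
        (((p + x) * (q + y) * (r + z) + (p + x + a) * (q + y + b) * (r + z + c)) +
         ((p + (x + x′)) * (q + (y + y′)) * (r + (z + z′)) +
          (p + (x + x′) + a) * (q + (y + y′) + b) * (r + (z + z′) + c))) +
        ((p * q * r + (p + a) * (q + b) * (r + c)) +
         ((p + x′) * (q + y′) * (r + z′) + (p + x′ + a) * (q + y′ + b) * (r + z′ + c)))
        ≈ polar x y z x′ y′ z′ a b c
      identity = solve 12 (λ p q r x y z x′ y′ z′ a b c →
        (((p :+ x) :* (q :+ y) :* (r :+ z) :+ (p :+ x :+ a) :* (q :+ y :+ b) :* (r :+ z :+ c)) :+
         ((p :+ (x :+ x′)) :* (q :+ (y :+ y′)) :* (r :+ (z :+ z′)) :+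
          (p :+ (x :+ x′) :+ a) :* (q :+ (y :+ y′) :+ b) :* (r :+ (z :+ z′) :+ c))) :+
        ((p :* q :* r :+ (p :+ a) :* (q :+ b) :* (r :+ c)) :+
         ((p :+ x′) :* (q :+ y′) :* (r :+ z′) :+ (p :+ x′ :+ a) :* (q :+ y′ :+ b) :* (r :+ z′ :+ c)))
        := a :* (y :* z′ :+ y′ :* z) :+ b :* (x :* z′ :+ x′ :* z) :+ c :* (x :* y′ :+ x′ :* y)) refl

    -- Carries an identity between polar forms back to bits: the trace is additive and `ι F`
    -- injective.
    T-additive : ∀ {w u w₁ u₁ w₂ u₂} → τ w u ≈ τ w₁ u₁ + τ w₂ u₂ → T w u ≡ T w₁ u₁ xor T w₂ u₂
    T-additive {w} {u} {w₁} {u₁} {w₂} {u₂} eq = ι-injective (T w u) (T w₁ u₁ xor T w₂ u₂) (begin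
      ι F (T w u)                       ≈⟨ ι-Δ² 𝟎 w u ⟩
      Tr F (τ w u)                      ≈⟨ Tr-cong eq ⟩
      Tr F (τ w₁ u₁ + τ w₂ u₂)          ≈⟨ Tr-+ (τ w₁ u₁) (τ w₂ u₂) ⟩
      Tr F (τ w₁ u₁) + Tr F (τ w₂ u₂)   ≈⟨ +-cong (ι-Δ² 𝟎 w₁ u₁) (ι-Δ² 𝟎 w₂ u₂) ⟨
      ι F (T w₁ u₁) + ι F (T w₂ u₂)     ≈⟨ ι-xor (T w₁ u₁) (T w₂ u₂) ⟨
      ι F (T w₁ u₁ xor T w₂ u₂)         ∎)

    polar-cong : ∀ {x₁ y₁ z₁ x₁′ y₁′ z₁′ x₂ y₂ z₂ x₂′ y₂′ z₂′} → x₁ ≈ x₂ → y₁ ≈ y₂ → z₁ ≈ z₂ →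
      x₁′ ≈ x₂′ → y₁′ ≈ y₂′ → z₁′ ≈ z₂′ → ∀ {a b c} →
      polar x₁ y₁ z₁ x₁′ y₁′ z₁′ a b c ≈ polar x₂ y₂ z₂ x₂′ y₂′ z₂′ a b c
    polar-cong x y z x′ y′ z′ = +-cong (+-cong
      (*-congˡ (+-cong (*-cong y z′) (*-cong y′ z)))
      (*-congˡ (+-cong (*-cong x z′) (*-cong x′ z))))
      (*-congˡ (+-cong (*-cong x y′) (*-cong x′ y)))

    T-additiveˡ : ∀ u → Additive λ w → T w u
    T-additiveˡ u w₁ w₂ = T-additive (trans
      (polar-cong (X-⊕ w₁ w₂) (Y-⊕ w₁ w₂) (Z-⊕ w₁ w₂) refl refl refl)
      (identity (X w₁) (Y w₁) (Z w₁) (X w₂) (Y w₂) (Z w₂) (X u) (Y u) (Z u) (X h) (Y h) (Z h)))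
      where
      open Char2
      identity : ∀ x₁ y₁ z₁ x₂ y₂ z₂ x y z a b c → polar (x₁ + x₂) (y₁ + y₂) (z₁ + z₂) x y z a b c ≈
        polar x₁ y₁ z₁ x y z a b c + polar x₂ y₂ z₂ x y z a b c
      identity = solve 12 (λ x₁ y₁ z₁ x₂ y₂ z₂ x y z a b c →
        let P : _ → _ → _ → Polynomial 12
            P x′ y′ z′ = a :* (y′ :* z :+ y :* z′) :+ b :* (x′ :* z :+ x :* z′) :+ c :* (x′ :* y :+ x :* y′)
        in P (x₁ :+ x₂) (y₁ :+ y₂) (z₁ :+ z₂) := P x₁ y₁ z₁ :+ P x₂ y₂ z₂) refl

    T-additiveʳ : ∀ w → Additive (T w)
    T-additiveʳ w u₁ u₂ = T-additive (trans
      (polar-cong refl refl refl (X-⊕ u₁ u₂) (Y-⊕ u₁ u₂) (Z-⊕ u₁ u₂))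
      (identity (X u₁) (Y u₁) (Z u₁) (X u₂) (Y u₂) (Z u₂) (X w) (Y w) (Z w) (X h) (Y h) (Z h)))
      where
      open Char2
      identity : ∀ x₁ y₁ z₁ x₂ y₂ z₂ x y z a b c → polar x y z (x₁ + x₂) (y₁ + y₂) (z₁ + z₂) a b c ≈
        polar x y z x₁ y₁ z₁ a b c + polar x y z x₂ y₂ z₂ a b c
      identity = solve 12 (λ x₁ y₁ z₁ x₂ y₂ z₂ x y z a b c →
        let P : _ → _ → _ → Polynomial 12
            P x′ y′ z′ = a :* (y :* z′ :+ y′ :* z) :+ b :* (x :* z′ :+ x′ :* z) :+ c :* (x :* y′ :+ x′ :* y)
        in P (x₁ :+ x₂) (y₁ :+ y₂) (z₁ :+ z₂) := P x₁ y₁ z₁ :+ P x₂ y₂ z₂) refl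

    second-difference : ∀ v w u → D (v ⊕ w) xor D (v ⊕ (w ⊕ u)) ≡ (D v xor D (v ⊕ u)) xor T w u
    second-difference v w u = move (D (v ⊕ w) xor D (v ⊕ (w ⊕ u))) (D v xor D (v ⊕ u)) (T w u)
      (ι-injective (Δ² v w u) (T w u) (trans (ι-Δ² v w u) (sym (ι-Δ² 𝟎 w u))))
      where
      move : ∀ p q r → p xor q ≡ r → p ≡ q xor r
      move false false _ ≡.refl = ≡.refl
      move false true  _ ≡.refl = ≡.refl
      move true  false _ ≡.refl = ≡.refl
      move true  true  _ ≡.refl = ≡.refl

    radical : Vec Bool (3 ℕ.* k) → Bool
    radical w = not (does (∃-cube? λ u → T w u Bool.≟ true))

    radical-elim : ∀ w → radical w ≡ true → ∀ u → T w u ≡ false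
    radical-elim w w∈ u = Bool.¬-not λ Twu → refuted (∃-cube? λ u → T w u Bool.≟ true) w∈ (u , Twu)

    radical-witness : ∀ w → radical w ≡ false → ∃ λ u → T w u ≡ true
    radical-witness w = confirmed (∃-cube? λ u → T w u Bool.≟ true)

    module _ (d : Vec Bool (3 ℕ.* k)) (T≡0 : ∀ u → T d u ≡ false) where
      private
        a = X h
        b = Y h
        c′ = Z h

        τ-vanishes : ∀ x y z → Tr F (polar (X d) (Y d) (Z d) (φ x) (φ y) (φ z) a b c′) ≈ 0#
        τ-vanishes x y z = begin
          Tr F (polar (X d) (Y d) (Z d) (φ x) (φ y) (φ z) a b c′)
            ≈⟨ Tr-cong (polar-cong refl refl refl
                 (reflexive (≡.cong φ (part₁-concat x y z))) (reflexive (≡.cong φ (part₂-concat x y z)))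
                 (reflexive (≡.cong φ (part₃-concat x y z)))) ⟨
          Tr F (τ d (concat (x ∷ y ∷ z ∷ [])))
            ≈⟨ ι-Δ² 𝟎 d _ ⟨
          ι F (T d (concat (x ∷ y ∷ z ∷ [])))
            ≈⟨ reflexive (≡.cong (ι F) (T≡0 _)) ⟩
          0# ∎

      -- Testing against vectors whose only nonzero part is the third isolates the coefficient of
      -- that part in `τ`. Together with its two analogues this says that the coordinate vectors of
      -- `d` and `h` have zero cross product over the field.
      radical-xy : a * Y d + b * X d ≈ 0#
      radical-xy = Tr-nondegenerate λ ζ → let z , φz≈ζ = φ-surjective ζ in trans (Tr-cong (trans
        (solve 7 (λ x y z ζ a b c → (a :* y :+ b :* x) :* ζ := a :* (y :* ζ :+ con false :* z) :+
           b :* (x :* ζ :+ con false :* z) :+ c :* (x :* con false :+ con false :* y)) refl (X d) (Y d) (Z d) ζ a b c′)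
        (polar-cong refl refl refl (sym φ-𝟎) (sym φ-𝟎) (sym φz≈ζ)))) (τ-vanishes 𝟎 𝟎 z)
        where open Char2

      radical-xz : a * Z d + c′ * X d ≈ 0#
      radical-xz = Tr-nondegenerate λ ζ → let y , φy≈ζ = φ-surjective ζ in trans (Tr-cong (trans
        (solve 7 (λ x y z ζ a b c → (a :* z :+ c :* x) :* ζ := a :* (y :* con false :+ ζ :* z) :+
           b :* (x :* con false :+ con false :* z) :+ c :* (x :* ζ :+ con false :* y)) refl (X d) (Y d) (Z d) ζ a b c′)
        (polar-cong refl refl refl (sym φ-𝟎) (sym φy≈ζ) (sym φ-𝟎)))) (τ-vanishes 𝟎 y 𝟎)
        where open Char2

      radical-yz : b * Z d + c′ * Y d ≈ 0#
      radical-yz = Tr-nondegenerate λ ζ → let x , φx≈ζ = φ-surjective ζ in trans (Tr-cong (trans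
        (solve 7 (λ x y z ζ a b c → (b :* z :+ c :* y) :* ζ := a :* (y :* con false :+ con false :* z) :+
           b :* (x :* con false :+ ζ :* z) :+ c :* (x :* con false :+ ζ :* y)) refl (X d) (Y d) (Z d) ζ a b c′)
        (polar-cong refl refl refl (sym φx≈ζ) (sym φ-𝟎) (sym φ-𝟎)))) (τ-vanishes x 𝟎 𝟎)
        where open Char2

  φ-≈0 : ∀ {x} → φ x ≈ 0# → x ≡ 𝟎
  φ-≈0 φx≈0 = φ-injective (trans φx≈0 (sym φ-𝟎))

  parts-injective : ∀ {v w} → part₁ v ≡ part₁ w → part₂ v ≡ part₂ w → part₃ v ≡ part₃ w → v ≡ w
  parts-injective {v} {w} p₁ p₂ p₃ = ≡.trans (≡.sym (parts v)) (≡.trans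
    (≡.cong₂ (λ x r → concat (x ∷ r)) p₁ (≡.cong₂ (λ y z → y ∷ z ∷ []) p₂ p₃)) (parts w))

  coordinates-≈0 : ∀ {v} → X v ≈ 0# → Y v ≈ 0# → Z v ≈ 0# → v ≡ 𝟎
  -- `v` is compared with `v ⊕ v`, whose parts are 𝟎 by additivity.
  coordinates-≈0 {v} x≈0 y≈0 z≈0 = ≡.trans (parts-injective
      (≡.trans (φ-≈0 x≈0) (≡.sym (≡.trans (part₁-⊕ v v) (⊕-self (part₁ v)))))
      (≡.trans (φ-≈0 y≈0) (≡.sym (≡.trans (part₂-⊕ v v) (⊕-self (part₂ v)))))
      (≡.trans (φ-≈0 z≈0) (≡.sym (≡.trans (part₃-⊕ v v) (⊕-self (part₃ v))))))
    (⊕-self v)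

  module _ {h : Vec Bool (3 ℕ.* k)} (h≢𝟎 : h ≢ 𝟎) where
    open Derivative h

    private
      cancel : ∀ {a b x y} → a * y + b * x ≈ 0# → ¬ a ≈ 0# → x ≈ 0# → y ≈ 0#
      cancel {a} {b} {x} {y} eq a≉0 x≈0 = zero-product a≉0 (begin
        a * y           ≈⟨ +-identityʳ (a * y) ⟨
        a * y + 0#      ≈⟨ +-congˡ (trans (*-congˡ x≈0) (zeroʳ b)) ⟨
        a * y + b * x   ≈⟨ eq ⟩
        0#              ∎)

      flip : ∀ {x y} → x + y ≈ 0# → y + x ≈ 0#
      flip {x} {y} eq = trans (+-comm y x) eq

      vanishes : ∀ {x} → x ≡ 𝟎 → φ x ≈ 0#
      vanishes x≡𝟎 = trans (reflexive (≡.cong φ x≡𝟎)) φ-𝟎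

      -- Since `T` is additive on the left, the radical is closed under differences, so injectivity
      -- of `π` on it reduces to a trivial kernel.
      count : (π : Vec Bool (3 ℕ.* k) → Vec Bool k) → (∀ v w → π (v ⊕ w) ≡ π v ⊕ π w) →
        (∀ d → (∀ u → T d u ≡ false) → π d ≡ 𝟎 → d ≡ 𝟎) → # radical ℤ.≤ 2^ⁿ k
      count π π-⊕ trivial-kernel = #-injective radical π λ v w v∈ w∈ πv≡πw → ⊕≡𝟎⇒≡ v w (trivial-kernel (v ⊕ w)
        (λ u → ≡.trans (T-additiveˡ u v w) (≡.cong₂ _xor_ (radical-elim v v∈ u) (radical-elim w w∈ u)))
        (≡.trans (π-⊕ v w) (≡.trans (≡.cong (_⊕ π w) πv≡πw) (⊕-self (π w)))))

    -- Within the radical, a coordinate in which h is nonzero determines the other two.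
    radical-size : # radical ℤ.≤ 2^ⁿ k
    radical-size with part₁ h ≟ᵛ 𝟎 | part₂ h ≟ᵛ 𝟎 | part₃ h ≟ᵛ 𝟎
    ... | no a≢𝟎   | _        | _        = count part₁ part₁-⊕ λ d T≡0 p≡𝟎 →
      let a≉0 = λ a≈0 → a≢𝟎 (φ-≈0 a≈0) in coordinates-≈0 (vanishes p≡𝟎)
        (cancel (radical-xy d T≡0) a≉0 (vanishes p≡𝟎)) (cancel (radical-xz d T≡0) a≉0 (vanishes p≡𝟎))
    ... | yes _    | no b≢𝟎   | _        = count part₂ part₂-⊕ λ d T≡0 p≡𝟎 →
      let b≉0 = λ b≈0 → b≢𝟎 (φ-≈0 b≈0) in coordinates-≈0
        (cancel (flip (radical-xy d T≡0)) b≉0 (vanishes p≡𝟎)) (vanishes p≡𝟎)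
        (cancel (radical-yz d T≡0) b≉0 (vanishes p≡𝟎))
    ... | yes _    | yes _    | no c≢𝟎   = count part₃ part₃-⊕ λ d T≡0 p≡𝟎 →
      let c≉0 = λ c≈0 → c≢𝟎 (φ-≈0 c≈0) in coordinates-≈0
        (cancel (flip (radical-xz d T≡0)) c≉0 (vanishes p≡𝟎))
        (cancel (flip (radical-yz d T≡0)) c≉0 (vanishes p≡𝟎)) (vanishes p≡𝟎)
    ... | yes a≡𝟎  | yes b≡𝟎  | yes c≡𝟎  =
      contradiction (coordinates-≈0 (vanishes a≡𝟎) (vanishes b≡𝟎) (vanishes c≡𝟎)) h≢𝟎

    -- The squared sum is at most 2^(3k) · 2^k, the product of the cube's size and the radical's,
    -- which is the square of 2^(2k).
    derivative-bias : ∀ {W : Vec Bool (3 ℕ.* k) → Bool} → IsSubgroup W → ∀ x →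
      (∑[ w ∈ cube (3 ℕ.* k) ] ([ W w ] ℤ.* sgn (f (x ⊕ w) xor f ((x ⊕ w) ⊕ h)))) ℤ.≤ 2^ⁿ (k ℕ.+ k)
    derivative-bias W-sub x = square-cancel-≤ (ℤ.+≤+ ℕ.z≤n) (ℤ.≤-trans
      (subgroup-sum² D T second-difference T-additiveˡ T-additiveʳ radical radical-witness W-sub x)
      (ℤ.≤-trans (ℤ.*-monoˡ-≤-nonNeg (2^ⁿ (3 ℕ.* k)) radical-size)
      (ℤ.≤-reflexive (≡.trans (2^ⁿ-+ (3 ℕ.* k) k) (≡.trans (≡.cong 2^ⁿ arithmetic) (≡.sym (2^ⁿ-+ (k ℕ.+ k) (k ℕ.+ k))))))))
      where
      open import Data.Nat.Solver using (module +-*-Solver)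
      open +-*-Solver
      arithmetic : 3 ℕ.* k ℕ.+ k ≡ (k ℕ.+ k) ℕ.+ (k ℕ.+ k)
      arithmetic = solve 1 (λ k → con 3 :* k :+ k := (k :+ k) :+ (k :+ k)) ≡.refl k

-- Spans of linear forms.

module Spans where
  open import Data.Sum.Base using (_⊎_; inj₁; inj₂)
  open import Relation.Binary.PropositionalEquality using (refl; sym; trans; cong; cong₂; subst)
  open import Relation.Nullary using (¬_; does; contradiction)
  open import Relation.Nullary.Decidable using (dec-true)
  open Cube

  module _ {n : ℕ} {S : LinearForm n → Set} where

    Span-map : ∀ {S′ : LinearForm n → Set} → (∀ {a} → S a → S′ a) → ∀ {w} → Span S w → Span S′ w
    Span-map S⊆S′ (gen s)   = gen (S⊆S′ s)
    Span-map S⊆S′ zero      = zero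
    Span-map S⊆S′ (add p q) = add (Span-map S⊆S′ p) (Span-map S⊆S′ q)

    Span-empty : (∀ {a} → ¬ S a) → ∀ {w} → Span S w → w ≡ 𝟎
    Span-empty ∅ (gen s)   = contradiction s ∅
    Span-empty ∅ zero      = refl
    Span-empty ∅ (add p q) = trans (cong₂ _⊕_ (Span-empty ∅ p) (Span-empty ∅ q)) (⊕-self 𝟎)

    -- A sum of generators uses `q` an even or an odd number of times. This is why one further query
    -- at most doubles a span.
    Span-extend : ∀ {S′ : LinearForm n → Set} q → (∀ {a} → S′ a → S a ⊎ a ≡ q) →
                  ∀ {w} → Span S′ w → Span S w ⊎ Span S (w ⊕ q)
    Span-extend q S′⊆ (gen s) with S′⊆ s
    ... | inj₁ s′   = inj₁ (gen s′)
    ... | inj₂ refl = inj₂ (subst (Span S) (sym (⊕-self q)) zero)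
    Span-extend q S′⊆ zero = inj₁ zero
    Span-extend q S′⊆ (add {a} {b} p p′) with Span-extend q S′⊆ p | Span-extend q S′⊆ p′
    ... | inj₁ s | inj₁ s′ = inj₁ (add s s′)
    ... | inj₁ s | inj₂ s′ = inj₂ (subst (Span S) (sym (⊕-assoc a b q)) (add s s′))
    ... | inj₂ s | inj₁ s′ = inj₂ (subst (Span S) (⊕-right-comm a q b) (add s s′))
    ... | inj₂ s | inj₂ s′ = inj₁ (subst (Span S) (trans (cong (_⊕ (b ⊕ q)) (⊕-comm a q))
        (trans (⊕-assoc q a (b ⊕ q)) (trans (cong (q ⊕_) (sym (⊕-assoc a b q)))
        (trans (⊕-comm q ((a ⊕ b) ⊕ q)) (⊕-cancelʳ (a ⊕ b) q))))) (add s s′))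

    span-subgroup : (dec : ∀ w → Dec (Span S w)) → IsSubgroup λ w → does (dec w)
    span-subgroup dec = record
      { 𝟎∈ = dec-true (dec 𝟎) zero
      ; ⊕∈ = λ {x} {y} x∈ y∈ → dec-true (dec (x ⊕ y)) (add (accepted (dec x) x∈) (accepted (dec y) y∈))
      }

-- Cutting the paths of a strongly read-once program.

module Frontier {n : ℕ} (P : LBP n) (read-once : StronglyReadOnce P) where
  open import Data.Bool.Base using (true; false)
  import Data.Bool.Properties as Bool
  open import Data.Fin.Base using (Fin)
  import Data.Fin.Properties as Fin
  open import Data.Integer.Base using (_+_; _*_; +_)
  open import Data.List.Base using (List; []; _∷_; length; allFin; cartesianProduct)
  open import Data.List.Membership.Propositional using (_∈_)
  open import Data.List.Membership.Propositional.Properties using (∈-cartesianProduct⁺; ∈-allFin)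
  open import Data.List.Properties using (length-tabulate)
  open import Data.List.Relation.Unary.All using ([]; _∷_)
  open import Data.List.Relation.Unary.AllPairs using ([]; _∷_)
  open import Data.List.Relation.Unary.Any using (here; there)
  open import Data.List.Relation.Unary.Unique.Propositional using (Unique)
  open import Data.List.Relation.Unary.Unique.Propositional.Properties using (cartesianProduct⁺; allFin⁺)
  open import Data.Product.Base using (∃; ∃₂; _×_; _,_; proj₁; proj₂)
  import Data.Product.Properties as Product
  open import Data.Sum.Base using (_⊎_; inj₁; inj₂)
  open import Relation.Binary.Construct.Closure.ReflexiveTransitive using (Star; ε; _◅_; _◅◅_)
  open import Relation.Binary.Construct.Closure.Transitive
    using (TransClosure; _∷ʳ_) renaming ([_] to [_]⁺; _∷_ to _∷⁺_)
  open import Relation.Binary.Definitions using (DecidableEquality)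
  open import Relation.Binary.PropositionalEquality using (refl; sym; trans; cong)
  open import Relation.Nullary using (¬_; yes; no; contradiction)
  open import Relation.Nullary.Decidable using (_⊎-dec_; ¬?)
  open Cube
  open Spans
  open LBP P hiding (size; Computes; StronglyReadOnce)

  -- A tail and an answer. Sinks carry such pairs too, so that their number is exactly twice the
  -- size of the program.
  Edge : Set
  Edge = Fin (size P) × Bool

  _≟ᵉ_ : DecidableEquality Edge
  _≟ᵉ_ = Product.≡-dec Fin._≟_ Bool._≟_

  edges : List Edge
  edges = cartesianProduct (allFin (size P)) (false ∷ true ∷ [])

  ∈-edges : ∀ e → e ∈ edges
  ∈-edges (u , b) = ∈-cartesianProduct⁺ (∈-allFin u) (∈-bools b)
    where
    ∈-bools : ∀ b → b ∈ false ∷ true ∷ []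
    ∈-bools false = here refl
    ∈-bools true  = there (here refl)

  edges-unique : Unique edges
  edges-unique = cartesianProduct⁺ (allFin⁺ (size P)) (((λ ()) ∷ []) ∷ [] ∷ [])

  length-edges : length edges ≡ size P ℕ.* 2
  length-edges = trans (length-product (allFin (size P))) (cong (ℕ._* 2) (length-tabulate {n = size P} λ u → u))
    where
    length-product : ∀ (us : List (Fin (size P))) → length (cartesianProduct us (false ∷ true ∷ [])) ≡ length us ℕ.* 2
    length-product []       = refl
    length-product (u ∷ us) = cong (λ l → 2 ℕ.+ l) (length-product us)

  -- The query at the tail counts as asked before the edge. If the tail is a sink there is none, and
  -- nothing is asked afterwards.
  EdgePreQuery EdgePostQuery : Edge → LinearForm n → Set
  EdgePreQuery  (u , b) a = PreQuery u a ⊎ ∃ λ next → node u ≡ inner a next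
  EdgePostQuery (u , b) a = ∃₂ λ q next → node u ≡ inner q next × PostQuery (next b) a

  EdgePre EdgePost : Edge → LinearForm n → Set
  EdgePre  e = Span (EdgePreQuery e)
  EdgePost e = Span (EdgePostQuery e)

  plus : ∀ {u v w} → u ⟶ v → Star _⟶_ v w → TransClosure _⟶_ u w
  plus u⟶v ε             = [ u⟶v ]⁺
  plus u⟶v (v⟶v′ ◅ path) = u⟶v ∷⁺ plus v⟶v′ path

  inner-injective : ∀ {u q q′ next next′} → node u ≡ inner q next → node u ≡ inner q′ next′ →
                    (q , next) ≡ (q′ , next′)
  inner-injective eq eq′ with trans (sym eq) eq′
  ... | refl = refl

  sink≢inner : ∀ {u c q next} → node u ≡ sink c → ¬ node u ≡ inner q next
  sink≢inner eq eq′ = contradiction (trans (sym eq) eq′) λ ()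

  sink-injective : ∀ {u c c′} → node u ≡ sink c → node u ≡ sink c′ → c ≡ c′
  sink-injective eq eq′ with trans (sym eq) eq′
  ... | refl = refl

  no-query-from-sink : ∀ {v c a} → node v ≡ sink c → ¬ PostQuery v a
  no-query-from-sink eq (u , next , eq′ , ε)             = sink≢inner eq eq′
  no-query-from-sink eq (u , next , eq′ , edge eq″ b ◅ _) = sink≢inner eq eq″

  IsSinkNode : Fin (size P) → Set
  IsSinkNode v = ∃ λ c → node v ≡ sink c

  sinkNode? : ∀ v → Dec (IsSinkNode v)
  sinkNode? v with node v in eq
  ... | sink c       = yes (c , refl)
  ... | inner q next = no λ ()

  -- Equal answers select the same edge at every node, so both inputs follow one path.
  agreeing-paths : ∀ {v x y t t′ c c′} → (∀ a → PostQuery v a → ⟨ a , x ⟩ ≡ ⟨ a , y ⟩) →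
    Star (Step x) v t → Star (Step y) v t′ → node t ≡ sink c → node t′ ≡ sink c′ → c ≡ c′
  agreeing-paths agree ε ε t-sink t′-sink = sink-injective t-sink t′-sink
  agreeing-paths agree ε (step eq ◅ _) t-sink _ = contradiction eq (sink≢inner t-sink)
  agreeing-paths agree (step eq ◅ _) ε _ t′-sink = contradiction eq (sink≢inner t′-sink)
  agreeing-paths {y = y} agree (step {a} {next} eq ◅ p) (step eq′ ◅ p′) with inner-injective eq eq′
  ... | refl rewrite agree a (_ , next , eq , ε) = agreeing-paths
    (λ { a′ (u , next′ , eq″ , path) → agree a′ (u , next′ , eq″ , edge eq ⟨ a , y ⟩ ◅ path) }) p p′

  module _ (Small : Fin (size P) → Set) (small? : ∀ v → Dec (Small v)) where

    Crossing : Fin (size P) → Set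
    Crossing v = IsSinkNode v ⊎ ¬ Small v

    crossing? : ∀ v → Dec (Crossing v)
    crossing? v = sinkNode? v ⊎-dec ¬? (small? v)

    -- `Front x u e`: e is the first edge on the path of x from u whose target is a sink or not
    -- small.  Should u itself be a sink, the pair (u , false) plays the role of that edge.
    data Front (x : Vec Bool n) (u : Fin (size P)) : Edge → Set where
      at-sink : ∀ {c} → node u ≡ sink c → Front x u (u , false)
      stop    : ∀ {q next b} → node u ≡ inner q next → ⟨ q , x ⟩ ≡ b → Crossing (next b) → Front x u (u , b)
      go      : ∀ {q next b e} → node u ≡ inner q next → ⟨ q , x ⟩ ≡ b → ¬ Crossing (next b) →
                Front x (next b) e → Front x u e

    front-exists : ∀ {x u c} → Star (Step x) u (sinkOf c) → ∃ (Front x u)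
    front-exists {u = u} {c} ε = _ , at-sink (isSink c)
    front-exists {x} (step {a} {next} eq ◅ path) with crossing? (next ⟨ a , x ⟩)
    ... | yes crossing = _ , stop eq refl crossing
    ... | no  ¬crossing = let e , front = front-exists path in e , go eq refl ¬crossing front

    front-unique : ∀ {x u e e′} → Front x u e → Front x u e′ → e ≡ e′
    front-unique (at-sink _) (at-sink _) = refl
    front-unique (at-sink eq) (stop eq′ _ _) = contradiction eq′ (sink≢inner eq)
    front-unique (at-sink eq) (go eq′ _ _ _) = contradiction eq′ (sink≢inner eq)
    front-unique (stop eq _ _) (at-sink eq′) = contradiction eq (sink≢inner eq′)
    front-unique (go eq _ _ _) (at-sink eq′) = contradiction eq (sink≢inner eq′)
    front-unique (stop eq refl crossing) (stop eq′ refl crossing′) with inner-injective eq eq′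
    ... | refl = refl
    front-unique (stop eq refl crossing) (go eq′ refl ¬crossing _) with inner-injective eq eq′
    ... | refl = contradiction crossing ¬crossing
    front-unique (go eq refl ¬crossing _) (stop eq′ refl crossing) with inner-injective eq eq′
    ... | refl = contradiction crossing ¬crossing
    front-unique (go eq refl _ front) (go eq′ refl _ front′) with inner-injective eq eq′
    ... | refl = front-unique front front′

    front-reachable : ∀ {x u e} → Front x u e → Star _⟶_ u (proj₁ e)
    front-reachable (at-sink _)       = ε
    front-reachable (stop _ _ _)      = ε
    front-reachable (go eq _ _ front) = edge eq _ ◅ front-reachable front

    front-transfer : ∀ {x y u e} → Star _⟶_ source u → (∀ a → EdgePreQuery e a → ⟨ a , x ⟩ ≡ ⟨ a , y ⟩) →
                     Front x u e → Front y u e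
    front-transfer path agree (at-sink eq)           = at-sink eq
    front-transfer path agree (stop {q} eq qx cross) = stop eq (trans (sym (agree q (inj₂ (_ , eq)))) qx) cross
    front-transfer path agree (go {q} {next} {b} eq qx ¬cross front) = go eq
      -- This node is reachable from the source and precedes the tail of `e` by a nonempty path, so
      -- its query is in the `Pre` of that tail.
      (trans (sym (agree q (inj₁ (_ , next , eq , path , plus (edge eq b) (front-reachable front))))) qx)
      ¬cross (front-transfer (path ◅◅ (edge eq b ◅ ε)) agree front)

    front-small : ∀ {x u e} → Small u → Front x u e → Small (proj₁ e)
    front-small small (at-sink _)  = small
    front-small small (stop _ _ _) = small
    front-small small (go {next = next} {b} _ _ ¬crossing front) with small? (next b)
    ... | yes small′ = front-small small′ front
    ... | no  ¬small = contradiction (inj₂ ¬small) ¬crossing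

    front-crossing : ∀ {x u e} → Front x u e →
      IsSinkNode (proj₁ e) ⊎ ∃₂ λ q next → node (proj₁ e) ≡ inner q next × Crossing (next (proj₂ e))
    front-crossing (at-sink eq)       = inj₁ (_ , eq)
    front-crossing (stop eq _ cross)  = inj₂ (_ , _ , eq , cross)
    front-crossing (go _ _ _ front)   = front-crossing front

    front-continue : ∀ {x u e c} → Front x u e → Star (Step x) u (sinkOf c) →
      node (proj₁ e) ≡ sink c ⊎ ∃₂ λ q next → node (proj₁ e) ≡ inner q next × Star (Step x) (next (proj₂ e)) (sinkOf c)
    front-continue {c = c} (at-sink eq) ε = inj₁ (isSink c)
    front-continue (at-sink eq) (step eq′ ◅ _) = contradiction eq′ (sink≢inner eq)
    front-continue {c = c} (stop eq _ _) ε = contradiction eq (sink≢inner (isSink c))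
    front-continue (stop eq refl _) (step eq′ ◅ path) with inner-injective eq eq′
    ... | refl = inj₂ (_ , _ , eq , path)
    front-continue {c = c} (go eq _ _ _) ε = contradiction eq (sink≢inner (isSink c))
    front-continue (go eq refl _ front) (step eq′ ◅ path) with inner-injective eq eq′
    ... | refl = front-continue front path

    -- Whatever is asked beyond `e` is asked in the subprogram at its head; if `e` stands for a
    -- sink, that sink already fixes the value.
    front-determines : ∀ {x y e c c′} → Front x source e → Front y source e →
      (∀ a → EdgePostQuery e a → ⟨ a , x ⟩ ≡ ⟨ a , y ⟩) →
      Star (Step x) source (sinkOf c) → Star (Step y) source (sinkOf c′) → c ≡ c′
    front-determines fx fy agree px py with front-continue fx px | front-continue fy py
    ... | inj₁ eq | inj₁ eq′ = sink-injective eq eq′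
    ... | inj₁ eq | inj₂ (_ , _ , eq′ , _) = contradiction eq′ (sink≢inner eq)
    ... | inj₂ (_ , _ , eq , _) | inj₁ eq′ = contradiction eq (sink≢inner eq′)
    ... | inj₂ (q , next , eq , px′) | inj₂ (_ , _ , eq′ , py′) with inner-injective eq eq′
    ...   | refl = agreeing-paths (λ a post → agree a (q , next , eq , post)) px′ py′ (isSink _) (isSink _)

    no-query-before-source : ∀ {a} → ¬ PreQuery source a
    no-query-before-source (u , next , eq , _ , u⟶⁺source) = go-back u⟶⁺source
      where
      go-back : ∀ {u} → ¬ TransClosure _⟶_ u source
      go-back [ u⟶source ]⁺  = isSource _ u⟶source
      go-back (_ ∷⁺ path) = go-back path

    -- Queries up to `e` precede its head, and those after `e` belong to the subprogram there, so
    -- the read-once condition at the head applies.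
    front-disjoint : ∀ {x e} → Front x source e → ∀ w → EdgePre e w → EdgePost e w → w ≡ 𝟎
    front-disjoint {e = u , b} front w pre post with front-crossing front
    ... | inj₁ (c , eq) = Span-empty (λ (_ , _ , eq′ , _) → sink≢inner eq eq′) post
    ... | inj₂ (q , next , eq , _) with sinkNode? (next b)
    -- The read-once condition speaks of inner nodes only; beyond a sink the span is zero anyway.
    ...   | yes (c , eq-v) = Span-empty (λ { (_ , _ , eq′ , query) → below-sink eq′ query }) post
      where
      below-sink : ∀ {q′ next′ a} → node u ≡ inner q′ next′ → ¬ PostQuery (next′ b) a
      below-sink eq′ query with inner-injective eq eq′
      ... | refl = no-query-from-sink eq-v query
    ...   | no ¬sink with node (next b) in eq-v
    ...     | sink c         = contradiction (c , refl) ¬sink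
    ...     | inner q′ next′ = read-once (next b) eq-v w (Span-map pre⊆ pre) (Span-map post⊆ post)
      where
      pre⊆ : ∀ {a} → EdgePreQuery (u , b) a → PreQuery (next b) a
      pre⊆ (inj₁ (u′ , next″ , eq′ , path , path⁺)) = u′ , next″ , eq′ , path , path⁺ ∷ʳ edge eq b
      pre⊆ (inj₂ (next″ , eq′)) = u , next″ , eq′ , front-reachable front , [ edge eq b ]⁺
      post⊆ : ∀ {a} → EdgePostQuery (u , b) a → PostQuery (next b) a
      post⊆ (_ , _ , eq′ , query) with inner-injective eq eq′
      ... | refl = query

-- Size estimates on the frontier and summation over its edges.

module Correlation {n : ℕ} (P : LBP n) (read-once : StronglyReadOnce P)
  (Pre? : ∀ v w → Dec (LBP.Pre P v w))
  (EdgePre? : ∀ e w → Dec (Frontier.EdgePre P read-once e w))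
  (EdgePost? : ∀ e w → Dec (Frontier.EdgePost P read-once e w))
  (m p : ℕ) (m+p≡n : m ℕ.+ p ≡ n) where
  open import Data.Bool.Base using (true; false; _xor_)
  import Data.Bool.Properties as Bool
  open import Data.Fin.Base using (Fin)
  import Data.Fin.Properties as Fin
  open import Data.Integer.Base using (0ℤ; 1ℤ; _+_; _*_; _≤_; +_; +≤+; positive)
  open import Data.Integer.Properties
  open import Data.List.Membership.Propositional using (_∈_)
  open import Data.Nat.Base using (suc)
  import Data.Nat.Properties as ℕ
  open import Data.Product.Base using (∃; _,_; proj₁; proj₂)
  import Data.Product.Properties as Product
  open import Data.Sum.Base using (_⊎_; inj₁; inj₂)
  open import Relation.Binary.Construct.Closure.ReflexiveTransitive using (ε)
  open import Relation.Binary.PropositionalEquality using (_≢_; refl; sym; trans; cong; cong₂; subst)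
  open import Relation.Nullary using (¬_; yes; no; does; contradiction)
  open import Relation.Nullary.Decidable using (dec-true)
  open IntegerSums
  open Cube
  open Duality
  open CosetDiscrepancy
  open Spans
  open Frontier P read-once
  open LBP P using (node; source; Pre)

  pre : Fin (size P) → Vec Bool n → Bool
  pre v w = does (Pre? v w)

  edge-pre edge-post : Edge → Vec Bool n → Bool
  edge-pre  e w = does (EdgePre? e w)
  edge-post e w = does (EdgePost? e w)

  Small : Fin (size P) → Set
  Small v = # (pre v) ≤ 2^ⁿ m

  small? : ∀ v → Dec (Small v)
  small? v = # (pre v) ≤? 2^ⁿ m

  -- Nothing precedes the source, so its `Pre` is zero. Every path therefore starts below the
  -- threshold.
  source-small : Small source
  source-small = ≤-trans (#-trivial (pre source) λ w w∈ →
    Span-empty (no-query-before-source Small small?) (accepted (Pre? source w) w∈)) (+≤+ (ℕ.m^n>0 2 m))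

  edge-pre-size : ∀ e → Small (proj₁ e) → # (edge-pre e) ≤ 2^ⁿ (suc m)
  edge-pre-size (u , b) small = ≤-trans (extend (node u) refl)
    (≤-trans (+-mono-≤ small small) (≤-reflexive (cong +_ (cong (2 ℕ.^ m ℕ.+_) (sym (ℕ.+-identityʳ (2 ℕ.^ m)))))))
    where
    bound : ∀ q → (∀ {a} → EdgePreQuery (u , b) a → LBP.PreQuery P u a ⊎ a ≡ q) →
            # (edge-pre (u , b)) ≤ # (pre u) + # (pre u)
    bound q query = ≤-trans (∑-mono (cube n) term) (≤-reflexive (trans
        (∑-+ (cube n) (λ w → [ pre u w ]) (λ w → [ pre u (w ⊕ q) ]))
        (cong (_+_ (# (pre u))) (∑-translate q λ w → [ pre u w ]))))
      where
      term : ∀ w → [ edge-pre (u , b) w ] ≤ [ pre u w ] + [ pre u (w ⊕ q) ]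
      term w with edge-pre (u , b) w in w∈
      ... | false = +-nonneg ([]-nonneg (pre u w)) ([]-nonneg (pre u (w ⊕ q)))
      ... | true with Span-extend q query (accepted (EdgePre? (u , b) w) w∈)
      ...   | inj₁ s rewrite dec-true (Pre? u w) s =
              +-monoʳ-≤ 1ℤ ([]-nonneg (pre u (w ⊕ q)))
      ...   | inj₂ s rewrite dec-true (Pre? u (w ⊕ q)) s =
              +-monoˡ-≤ 1ℤ ([]-nonneg (pre u w))
    extend : ∀ v → node u ≡ v → # (edge-pre (u , b)) ≤ # (pre u) + # (pre u)
    -- A sink adds no query; 𝟎 is a placeholder.
    extend (sink c) eq = bound 𝟎 λ { (inj₁ q) → inj₁ q ; (inj₂ (_ , eq′)) → contradiction eq′ (sink≢inner eq) }
    extend (inner q next) eq = bound q λ where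
      (inj₁ query)     → inj₁ query
      (inj₂ (_ , eq′)) → inj₂ (sym (cong proj₁ (inner-injective eq eq′)))

  -- At an inner head, 2^m · |B| ≤ |Pre| · |B| ≤ 2^n, because the head has crossed the threshold and
  -- its `Pre` meets B only in 𝟎. In the sink cases B has one element.
  edge-post-size : ∀ {x e} → Front Small small? x source e → # (edge-post e) ≤ 2^ⁿ p
  edge-post-size {e = e@(u , b)} front with front-crossing Small small? front
  ... | inj₁ (c , eq) = ≤-trans (#-trivial (edge-post e) λ w w∈ →
      Span-empty (λ (_ , _ , eq′ , _) → sink≢inner eq eq′) (accepted (EdgePost? e w) w∈)) (+≤+ (ℕ.m^n>0 2 p))
  ... | inj₂ (q , next , eq , crossing) with sinkNode? (next b) | crossing
  ...   | yes (c , eq-v) | _ = ≤-trans (#-trivial (edge-post e) λ w w∈ →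
      Span-empty below-sink (accepted (EdgePost? e w) w∈)) (+≤+ (ℕ.m^n>0 2 p))
    where
    below-sink : ∀ {a} → ¬ EdgePostQuery e a
    below-sink (_ , _ , eq′ , query) with inner-injective eq eq′
    ... | refl = no-query-from-sink eq-v query
  ...   | no ¬sink | inj₁ sink-v = contradiction sink-v ¬sink
  ...   | no ¬sink | inj₂ ¬small with node (next b) in eq-v
  ...     | sink c         = contradiction (c , refl) ¬sink
  ...     | inner q′ next′ = *-cancelˡ-≤-pos (# (edge-post e)) (2^ⁿ p) (2^ⁿ m) {{positive (2^ⁿ>0 m)}} (≤-trans
      (*-monoʳ (# (edge-post e)) (#-nonneg (edge-post e)) (<⇒≤ (≰⇒> ¬small)))
      (≤-trans (subgroup-product (span-subgroup (Pre? (next b))) (span-subgroup (EdgePost? e)) λ w w∈ w∈′ →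
        read-once (next b) eq-v w (accepted (Pre? (next b) w) w∈) (Span-map below (accepted (EdgePost? e w) w∈′)))
      (≤-reflexive (trans (cong 2^ⁿ (sym m+p≡n)) (sym (2^ⁿ-+ m p))))))
    where
    below : ∀ {a} → EdgePostQuery e a → LBP.PostQuery P (next b) a
    below (_ , _ , eq′ , query) with inner-injective eq eq′
    ... | refl = query

  module _ (f g : Vec Bool n → Bool) (computes : Computes P g) (C : ℤ) (0≤C : 0ℤ ≤ C)
           (f-bias : ∀ {h} → h ≢ 𝟎 → ∀ {W : Vec Bool n → Bool} → IsSubgroup W → ∀ x →
             (∑[ w ∈ cube n ] [ W w ] * sgn (f (x ⊕ w) xor f ((x ⊕ w) ⊕ h))) ≤ C)
           (τ : ℤ) (0≤τ : 0ℤ ≤ τ) (τ-small : C * 2^ⁿ (suc m) * (τ * τ) ≤ 2^ⁿ n) where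

    frontier-edge : ∀ x → ∃ (Front Small small? x source)
    frontier-edge x = front-exists Small small? (computes x)

    region : Edge → Vec Bool n → Bool
    region e x = does (e ≟ᵉ proj₁ (frontier-edge x))

    region⇒front : ∀ e x → region e x ≡ true → Front Small small? x source e
    region⇒front e x x∈ = subst (Front Small small? x source)
      (sym (accepted (e ≟ᵉ proj₁ (frontier-edge x)) x∈)) (proj₂ (frontier-edge x))

    front⇒region : ∀ e x → Front Small small? x source e → region e x ≡ true
    front⇒region e x front = dec-true (e ≟ᵉ proj₁ (frontier-edge x))
      (front-unique Small small? front (proj₂ (frontier-edge x)))

    -- A translation orthogonal to all queries up to `e` changes none of the answers that lead
    -- there.
    region-translate : ∀ e x {w} → perp (edge-pre e) w ≡ true → region e x ≡ true → region e (x ⊕ w) ≡ true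
    region-translate e x {w} w∈ x∈ = front⇒region e (x ⊕ w) (front-transfer Small small? ε agree (region⇒front e x x∈))
      where
      agree : ∀ a → EdgePreQuery e a → ⟨ a , x ⟩ ≡ ⟨ a , x ⊕ w ⟩
      agree a query = sym (trans (⟨⟩-⊕ʳ a x w) (trans
        (cong (⟨ a , x ⟩ xor_) (perp-elim (edge-pre e) w∈ a (dec-true (EdgePre? e a) (gen query))))
        (Bool.xor-identityʳ ⟨ a , x ⟩)))

    region-inv : ∀ e x {w} → perp (edge-pre e) w ≡ true → region e (x ⊕ w) ≡ region e x
    region-inv e x {w} w∈ with region e x in x∈ | region e (x ⊕ w) in xw∈
    ... | true  | true  = refl
    ... | false | false = refl
    ... | true  | false = trans (sym xw∈) (region-translate e x w∈ x∈)
    ... | false | true  = trans (sym (region-translate e (x ⊕ w) w∈ xw∈))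
                            (trans (cong (region e) (⊕-cancelʳ x w)) x∈)

    region-value : ∀ e x y → region e x ≡ true → region e y ≡ true → perp (edge-post e) (x ⊕ y) ≡ true → g x ≡ g y
    region-value e x y x∈ y∈ xy∈ = front-determines Small small? (region⇒front e x x∈) (region⇒front e y y∈)
      agree (computes x) (computes y)
      where
      same : ∀ p q → p xor q ≡ false → p ≡ q
      same false false _ = refl
      same true  true  _ = refl
      agree : ∀ a → EdgePostQuery e a → ⟨ a , x ⟩ ≡ ⟨ a , y ⟩
      agree a query = same ⟨ a , x ⟩ ⟨ a , y ⟩ (trans (sym (⟨⟩-⊕ʳ a x y))
        (perp-elim (edge-post e) xy∈ a (dec-true (EdgePost? e a) (gen query))))

    edge-bound : ∀ e → τ * (∑[ x ∈ cube n ] [ region e x ] * sgn (f x xor g x)) ≤ # (region e) + τ * τ * 2^ⁿ p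
    -- An input in the region certifies that `e` is a frontier edge, on which the size and
    -- disjointness estimates depend. For an empty region the sum is 0.
    edge-bound e with ∃-cube? (λ x → region e x Bool.≟ true)
    ... | yes (x , x∈) = ≤-trans
      (correlation-bound pre-subgroup (span-subgroup (EdgePost? e)) disjoint (region e) (region-inv e)
        f g (region-value e) C 0≤C (λ h h≢𝟎 → f-bias h≢𝟎 (perp-subgroup (edge-pre e))) τ 0≤τ
        (≤-trans (*-monoʳ (τ * τ) (square-nonneg τ) (*-monoˡ C 0≤C
          (edge-pre-size e (front-small Small small? source-small front)))) τ-small))
      (+-monoʳ-≤ (# (region e)) (*-monoˡ (τ * τ) (square-nonneg τ) (edge-post-size front)))
      where
      front : Front Small small? x source e
      front = region⇒front e x x∈
      pre-subgroup : IsSubgroup (edge-pre e)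
      pre-subgroup = span-subgroup (EdgePre? e)
      disjoint : ∀ w → edge-pre e w ≡ true → edge-post e w ≡ true → w ≡ 𝟎
      disjoint w w∈ w∈′ = front-disjoint Small small? front w
        (accepted (EdgePre? e w) w∈) (accepted (EdgePost? e w) w∈′)
    ... | no none = subst (_≤ # (region e) + τ * τ * 2^ⁿ p) (sym (trans (cong (τ *_) no-terms) (*-zeroʳ τ)))
      (+-nonneg (#-nonneg (region e)) (*-nonneg (square-nonneg τ) (<⇒≤ (2^ⁿ>0 p))))
      where
      no-terms : (∑[ x ∈ cube n ] [ region e x ] * sgn (f x xor g x)) ≡ 0ℤ
      no-terms = trans (∑-cong (cube n) λ x → cong (λ r → [ r ] * sgn (f x xor g x)) (Bool.¬-not λ x∈ → none (x , x∈)))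
        (∑-zero (cube n))

    partition : ∀ (F : Vec Bool n → ℤ) → (∑[ e ∈ edges ] ∑[ x ∈ cube n ] [ region e x ] * F x) ≡ ∑ (cube n) F
    partition F = trans (∑-swap edges (cube n) λ e x → [ region e x ] * F x)
      (∑-cong (cube n) λ x → ∑-point _≟ᵉ_ edges-unique (∈-edges (proj₁ (frontier-edge x))) λ _ → F x)

    total-correlation : τ * (∑[ x ∈ cube n ] sgn (f x xor g x)) ≤ 2^ⁿ n + + (size P ℕ.* 2) * (τ * τ * 2^ⁿ p)
    total-correlation = begin
      τ * (∑[ x ∈ cube n ] sgn (f x xor g x))
        ≡⟨ cong (τ *_) (partition λ x → sgn (f x xor g x)) ⟨
      τ * (∑[ e ∈ edges ] ∑[ x ∈ cube n ] [ region e x ] * sgn (f x xor g x))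
        ≡⟨ ∑-*ˡ edges τ (λ e → ∑[ x ∈ cube n ] [ region e x ] * sgn (f x xor g x)) ⟨
      (∑[ e ∈ edges ] τ * (∑[ x ∈ cube n ] [ region e x ] * sgn (f x xor g x)))
        ≤⟨ ∑-mono edges edge-bound ⟩
      (∑[ e ∈ edges ] # (region e) + τ * τ * 2^ⁿ p)
        ≡⟨ ∑-+ edges (λ e → # (region e)) (λ _ → τ * τ * 2^ⁿ p) ⟩
      (∑[ e ∈ edges ] # (region e)) + (∑[ e ∈ edges ] τ * τ * 2^ⁿ p)
        ≡⟨ cong₂ _+_
             (trans (∑-cong edges λ e → ∑-cong (cube n) λ x → sym (*-identityʳ [ region e x ]))
               (trans (partition λ _ → 1ℤ) (∑-cube-1 n)))
             (trans (∑-const edges (τ * τ * 2^ⁿ p)) (cong (λ l → + l * (τ * τ * 2^ⁿ p)) length-edges)) ⟩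
      2^ⁿ n + + (size P ℕ.* 2) * (τ * τ * 2^ⁿ p) ∎
      where open ≤-Reasoning

-- Decidability under double negation, parameters, and counting disagreements.

module Counting where
  open import Data.Bool.Base using (false; true; _xor_)
  import Data.Bool.Properties as Bool
  open import Data.Fin.Base using (Fin; zero; suc)
  open import Data.Integer.Base using (1ℤ; -1ℤ; _+_; _*_; _≤_; +_; +≤+)
  open import Data.Integer.Properties
  open import Data.Integer.Tactic.RingSolver using (solve-∀)
  open import Data.List.Base using (List; []; _∷_; length; filter; allFin; cartesianProduct)
  open import Data.List.Membership.Propositional using (_∈_)
  open import Data.List.Membership.Propositional.Properties using (∈-cartesianProduct⁺; ∈-allFin)
  open import Data.List.Relation.Unary.All as All using (All; []; _∷_)
  open import Data.Nat.Base using (suc; z≤n; s≤s)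
  import Data.Nat.Properties as ℕ
  open import Data.Nat.Solver using (module +-*-Solver)
  open import Data.Product.Base using (_,_)
  open import Relation.Binary.PropositionalEquality using (refl; sym; trans; cong; cong₂; subst₂)
  open import Relation.Nullary using (¬_; ¬?)
  open import Relation.Nullary.Decidable using (decidable-stable; ¬¬-excluded-middle)
  open IntegerSums
  open Cube

  -- Each instance of excluded middle holds under double negation, and finitely many of them can be
  -- collected before leaving it.
  ¬¬-decidable : ∀ {A : Set} {P : A → Set} (xs : List A) → (∀ x → x ∈ xs) → ¬ ¬ (∀ x → Dec (P x))
  ¬¬-decidable {P = P} xs complete none = decide xs λ decs → none λ x → All.lookup decs (complete x)
    where
    decide : ∀ xs → ¬ ¬ All (λ x → Dec (P x)) xs
    decide []       k = k []
    decide (x ∷ xs) k = ¬¬-excluded-middle λ d → decide xs λ ds → k (d ∷ ds)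

  ¬¬-decidable₂ : ∀ {A : Set} {n} {P : A → Vec Bool n → Set} (xs : List A) → (∀ x → x ∈ xs) →
                  ¬ ¬ (∀ x w → Dec (P x w))
  ¬¬-decidable₂ {n = n} {P} xs complete none = ¬¬-decidable {P = λ (x , w) → P x w}
    (cartesianProduct xs (cube n)) (λ (x , w) → ∈-cartesianProduct⁺ (complete x) (∈-cube w))
    λ dec → none λ x w → dec (x , w)

  disagreements : ∀ {n} → (f g : Vec Bool n → Bool) → ℕ
  disagreements {n} f g = length (filter (λ x → ¬? (f x Bool.≟ g x)) (cube n))

  -- An agreement contributes 1 and a disagreement -1 + 2.
  ∑-disagreements : ∀ {n} (f g : Vec Bool n → Bool) →
    (∑[ x ∈ cube n ] sgn (f x xor g x)) + (+ disagreements f g + + disagreements f g) ≡ 2^ⁿ n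
  ∑-disagreements {n} f g = trans (count (cube n)) (∑-cube-1 n)
    where
    differ : List (Vec Bool n) → ℤ
    differ xs = + length (filter (λ x → ¬? (f x Bool.≟ g x)) xs)
    agree-step : ∀ s d → 1ℤ + s + (d + d) ≡ 1ℤ + (s + (d + d))
    agree-step = solve-∀
    differ-step : ∀ s d → -1ℤ + s + ((1ℤ + d) + (1ℤ + d)) ≡ 1ℤ + (s + (d + d))
    differ-step = solve-∀
    count : ∀ xs → (∑[ x ∈ xs ] sgn (f x xor g x)) + (differ xs + differ xs) ≡ (∑[ x ∈ xs ] 1ℤ)
    count []       = refl
    count (x ∷ xs) with f x | g x
    ... | false | false = trans (agree-step (∑ xs λ x → sgn (f x xor g x)) (differ xs)) (cong (_+_ 1ℤ) (count xs))
    ... | true  | true  = trans (agree-step (∑ xs λ x → sgn (f x xor g x)) (differ xs)) (cong (_+_ 1ℤ) (count xs))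
    ... | false | true  = trans (differ-step (∑ xs λ x → sgn (f x xor g x)) (differ xs)) (cong (_+_ 1ℤ) (count xs))
    ... | true  | false = trans (differ-step (∑ xs λ x → sgn (f x xor g x)) (differ xs)) (cong (_+_ 1ℤ) (count xs))

  module _ {c ℓ₁ ℓ₂ : Level} {k : ℕ} .{{_ : ℕ.NonZero k}} (F : BinaryField c ℓ₁ ℓ₂ k)
    (φ : Vec Bool k → BinaryField.Carrier F) (iso : IsLinearIsomorphism F φ)
    (f : Vec Bool (3 ℕ.* k) → Bool)
    (f-trace : ∀ x y z → BinaryField._≈_ F (ι F (f (concat (x ∷ y ∷ z ∷ []))))
       (Tr F (BinaryField._*ᶠ_ F (BinaryField._*ᶠ_ F (φ x) (φ y)) (φ z))))
    (g : Vec Bool (3 ℕ.* k) → Bool) (P : LBP (3 ℕ.* k))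
    (read-once : StronglyReadOnce P) (computes : Computes P g) where

    private
      n = 3 ℕ.* k

    size>0 : 1 ℕ.≤ size P
    size>0 = positive (LBP.source P)
      where
      positive : ∀ {s} → Fin s → 1 ℕ.≤ s
      positive zero    = s≤s z≤n
      positive (suc _) = s≤s z≤n

    -- Membership in a span is decidable only up to double negation, which the stable goal absorbs.
    few-agreements : ∀ t r → k ≡ 4 ℕ.* t ℕ.+ 2 ℕ.+ r → size P ℕ.≤ 2 ℕ.^ r →
      2^ⁿ t * (∑[ x ∈ cube n ] sgn (f x xor g x)) ≤ 2^ⁿ n + 2^ⁿ n
    few-agreements t r k≡ size≤ = decidable-stable (2^ⁿ t * (∑[ x ∈ cube n ] sgn (f x xor g x)) ≤? 2^ⁿ n + 2^ⁿ n)
      λ ¬goal → ¬¬-decidable₂ (allFin (size P)) ∈-allFin λ Pre? →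
      ¬¬-decidable₂ (edges P read-once) (∈-edges P read-once) λ EdgePre? →
      ¬¬-decidable₂ (edges P read-once) (∈-edges P read-once) λ EdgePost? →
      ¬goal (≤-trans
        (Correlation.total-correlation P read-once Pre? EdgePre? EdgePost? m p m+p≡n f g computes
          (2^ⁿ (k ℕ.+ k)) (+≤+ z≤n) derivative-bias (2^ⁿ t) (+≤+ z≤n) τ-small)
        (+-monoʳ-≤ (2^ⁿ n) edges-small))
      where
      open TraceOfTripleProduct F φ iso f f-trace using (derivative-bias)
      open +-*-Solver
      open Frontier using (edges; ∈-edges)
      -- m = k - 2 t - 1 and p = n - m.
      m p : ℕ
      m = 2 ℕ.* t ℕ.+ 1 ℕ.+ r
      p = 10 ℕ.* t ℕ.+ 5 ℕ.+ 2 ℕ.* r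
      m+p≡n : m ℕ.+ p ≡ n
      m+p≡n = trans (solve 2 (λ t r → con 2 :* t :+ con 1 :+ r :+ (con 10 :* t :+ con 5 :+ con 2 :* r) :=
        con 3 :* (con 4 :* t :+ con 2 :+ r)) refl t r) (cong (3 ℕ.*_) (sym k≡))
      -- The exponents agree: 2k + (m + 1) + 2t = 3k. This choice of `m` is the largest possible.
      τ-small : 2^ⁿ (k ℕ.+ k) * 2^ⁿ (suc m) * (2^ⁿ t * 2^ⁿ t) ≤ 2^ⁿ n
      τ-small = ≤-reflexive (trans (cong₂ _*_ (2^ⁿ-+ (k ℕ.+ k) (suc m)) (2^ⁿ-+ t t))
        (trans (2^ⁿ-+ (k ℕ.+ k ℕ.+ suc m) (t ℕ.+ t)) (cong 2^ⁿ exponent)))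
        where
        exponent : k ℕ.+ k ℕ.+ suc m ℕ.+ (t ℕ.+ t) ≡ n
        exponent rewrite k≡ = solve 2 (λ t r → (con 4 :* t :+ con 2 :+ r) :+ (con 4 :* t :+ con 2 :+ r) :+
          (con 1 :+ (con 2 :* t :+ con 1 :+ r)) :+ (t :+ t) := con 3 :* (con 4 :* t :+ con 2 :+ r)) refl t r
      -- At size 2^r the exponents agree again: 1 + r + 2t + p = 3k. This determines r = k - (4t +
      -- 2).
      edges-small : + (size P ℕ.* 2) * (2^ⁿ t * 2^ⁿ t * 2^ⁿ p) ≤ 2^ⁿ n
      edges-small = subst₂ _≤_ (sym (trans (cong (+ (size P ℕ.* 2) *_) (trans (cong (_* 2^ⁿ p) (2^ⁿ-+ t t)) (2^ⁿ-+ (t ℕ.+ t) p)))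
          (sym (pos-* (size P ℕ.* 2) _)))) (cong 2^ⁿ exponent)
        (+≤+ (ℕ.≤-trans (ℕ.*-monoˡ-≤ (2 ℕ.^ (t ℕ.+ t ℕ.+ p)) (ℕ.*-monoˡ-≤ 2 size≤))
          (ℕ.≤-reflexive (trans (cong (ℕ._* 2 ℕ.^ (t ℕ.+ t ℕ.+ p)) (ℕ.*-comm (2 ℕ.^ r) 2))
            (sym (ℕ.^-distribˡ-+-* 2 (suc r) (t ℕ.+ t ℕ.+ p)))))))
        where
        exponent : suc r ℕ.+ (t ℕ.+ t ℕ.+ p) ≡ n
        exponent rewrite k≡ = solve 2 (λ t r → con 1 :+ r :+ (t :+ t :+ (con 10 :* t :+ con 5 :+ con 2 :* r)) :=
          con 3 :* (con 4 :* t :+ con 2 :+ r)) refl t r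

    -- `few-agreements` with the sum of signs replaced by 2^n minus twice the disagreements,
    -- rearranged to avoid subtraction of naturals.
    many-disagreements : ∀ t → size P ℕ.* 2 ℕ.^ (4 ℕ.* t ℕ.+ 2) ℕ.≤ 2 ℕ.^ k →
      2 ℕ.^ t ℕ.* 2 ℕ.^ n ℕ.≤ 2 ℕ.* 2 ℕ.^ n ℕ.+ 2 ℕ.* (2 ℕ.^ t ℕ.* disagreements f g)
    many-disagreements t size≤ = drop‿+≤+ (subst₂ _≤_ left right
      (+-monoˡ-≤ (2^ⁿ t * (D + D)) (few-agreements t (k ℕ.∸ e) (sym (ℕ.m+[n∸m]≡n e≤k)) size≤2^r)))
      where
      e : ℕ
      e = 4 ℕ.* t ℕ.+ 2
      D : ℤ
      D = + disagreements f g
      -- A program has at least one node, so the size hypothesis itself excludes larger `e`.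
      e≤k : e ℕ.≤ k
      e≤k = ℕ.≮⇒≥ λ k<e → ℕ.<-irrefl refl (ℕ.<-≤-trans (ℕ.^-monoʳ-< 2 (s≤s (s≤s z≤n)) k<e)
        (ℕ.≤-trans (ℕ.≤-trans (ℕ.≤-reflexive (sym (ℕ.*-identityˡ (2 ℕ.^ e)))) (ℕ.*-monoˡ-≤ (2 ℕ.^ e) size>0)) size≤))
      size≤2^r : size P ℕ.≤ 2 ℕ.^ (k ℕ.∸ e)
      size≤2^r = ℕ.*-cancelʳ-≤ (size P) (2 ℕ.^ (k ℕ.∸ e)) (2 ℕ.^ e) {{ℕ.m^n≢0 2 e}} (ℕ.≤-trans size≤
        (ℕ.≤-reflexive (trans (cong (2 ℕ.^_) (sym (ℕ.m∸n+n≡m e≤k))) (ℕ.^-distribˡ-+-* 2 (k ℕ.∸ e) e))))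
      left : 2^ⁿ t * (∑[ x ∈ cube n ] sgn (f x xor g x)) + 2^ⁿ t * (D + D) ≡ + (2 ℕ.^ t ℕ.* 2 ℕ.^ n)
      left = trans (sym (*-distribˡ-+ (2^ⁿ t) _ (D + D)))
        (trans (cong (2^ⁿ t *_) (∑-disagreements f g)) (sym (pos-* (2 ℕ.^ t) (2 ℕ.^ n))))
      right : 2^ⁿ n + 2^ⁿ n + 2^ⁿ t * (D + D) ≡ + (2 ℕ.* 2 ℕ.^ n ℕ.+ 2 ℕ.* (2 ℕ.^ t ℕ.* disagreements f g))
      right = trans (cong (λ z → 2^ⁿ n + 2^ⁿ n + z) (sym (pos-* (2 ℕ.^ t) (disagreements f g ℕ.+ disagreements f g))))
        (cong +_ (solve 3 (λ a b d → a :+ a :+ b :* (d :+ d) := con 2 :* a :+ con 2 :* (b :* d))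
          refl (2 ℕ.^ n) (2 ℕ.^ t) (disagreements f g)))
        where open +-*-Solver

-- Dedekind cuts, rounding and asymptotics.

module Reals where
  open import Data.Empty using (⊥; ⊥-elim)
  open import Data.Integer.Base as ℤ using (+_)
  import Data.Integer.Properties as ℤ
  open import Data.Nat.Base as ℕ using (zero; suc)
  import Data.Nat.Properties as ℕ
  open import Data.Product.Base using (∃-syntax; _×_; _,_; proj₁; proj₂)
  open import Data.Rational.Base
  open import Data.Rational.Properties
  open import Data.Rational.Solver using (module +-*-Solver)
  import Data.Rational.Unnormalised.Base as ℚᵘ
  import Data.Rational.Unnormalised.Properties as ℚᵘ
  open import Data.Sum.Base using (_⊎_; inj₁; inj₂)
  open import Relation.Binary.PropositionalEquality using (refl; sym; trans; cong; cong₂; subst₂)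
  open import Relation.Nullary using (yes; no)
  open Exp2

  lower<upper : ∀ (x : ℝ) {p q} → lower x p → upper x q → p < q
  lower<upper x {p} {q} p<x x<q with p <? q
  ... | yes p<q = p<q
  ... | no  p≮q with ℝ.upper-open x x<q
  ...   | r , r<q , x<r = ⊥-elim (ℝ.disjoint x (ℝ.lower-closed x (<-≤-trans r<q (≮⇒≥ p≮q)) p<x) x<r)

  /1-+ : ∀ i j → i / 1 + j / 1 ≡ (i ℤ.+ j) / 1
  /1-+ i j = toℚᵘ-injective (ℚᵘ.≃-trans (toℚᵘ-homo-+ (i / 1) (j / 1)) (ℚᵘ.≃-trans
    (ℚᵘ.+-cong (toℚᵘ-fromℚᵘ (ℚᵘ.mkℚᵘ i 0)) (toℚᵘ-fromℚᵘ (ℚᵘ.mkℚᵘ j 0)))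
    (ℚᵘ.≃-trans (ℚᵘ.*≡* (cong (ℤ._* + 1) (cong₂ ℤ._+_ (ℤ.*-identityʳ i) (ℤ.*-identityʳ j))))
      (ℚᵘ.≃-sym (toℚᵘ-fromℚᵘ (ℚᵘ.mkℚᵘ (i ℤ.+ j) 0))))))

  fromℕ-+ : ∀ m n → fromℕ (m ℕ.+ n) ≡ fromℕ m + fromℕ n
  fromℕ-+ m n = sym (/1-+ (+ m) (+ n))

  fromℕ-* : ∀ m n → fromℕ (m ℕ.* n) ≡ fromℕ m * fromℕ n
  fromℕ-* zero    n = sym (*-zeroˡ (fromℕ n))
  fromℕ-* (suc m) n = trans (fromℕ-+ n (m ℕ.* n)) (trans (cong (λ z → fromℕ n + z) (fromℕ-* m n))
    (trans (solve 2 (λ m n → n :+ m :* n := (con 1ℚ :+ m) :* n) refl (fromℕ m) (fromℕ n))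
      (cong (_* fromℕ n) (sym (fromℕ-suc m)))))
    where open +-*-Solver

  fromℕ-^ : ∀ n → fromℕ (2 ℕ.^ n) ≡ 2ℚ ^ℚ n
  fromℕ-^ zero    = refl
  fromℕ-^ (suc n) = trans (fromℕ-* 2 (2 ℕ.^ n)) (cong (2ℚ *_) (fromℕ-^ n))

  fromℕ-mono : ∀ {m n} → m ℕ.≤ n → fromℕ m ≤ fromℕ n
  fromℕ-mono {m} {n} m≤n = subst₂ _≤_ (+-identityʳ (fromℕ m))
    (trans (sym (fromℕ-+ m (n ℕ.∸ m))) (cong fromℕ (ℕ.m+[n∸m]≡n m≤n))) (+-monoʳ-≤ (fromℕ m) (fromℕ-nn (n ℕ.∸ m)))

  fromℕ-<-suc : ∀ n → fromℕ n < fromℕ (suc n)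
  fromℕ-<-suc n = subst₂ _<_ (+-identityˡ (fromℕ n)) (sym (fromℕ-suc n)) (+-monoˡ-< (fromℕ n) 0<1)

  fromℕ-strict : ∀ {m n} → m ℕ.< n → fromℕ m < fromℕ n
  fromℕ-strict {m} m<n = <-≤-trans (fromℕ-<-suc m) (fromℕ-mono m<n)

  /-cancel : ∀ d n .{{_ : ℕ.NonZero n}} → (+ d / n) * fromℕ n ≡ fromℕ d
  /-cancel d (suc n) = toℚᵘ-injective (ℚᵘ.≃-trans (toℚᵘ-homo-* (+ d / suc n) (fromℕ (suc n))) (ℚᵘ.≃-trans
    (ℚᵘ.*-cong (toℚᵘ-fromℚᵘ (ℚᵘ.mkℚᵘ (+ d) n)) (toℚᵘ-fromℚᵘ (ℚᵘ.mkℚᵘ (+ suc n) 0)))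
    (ℚᵘ.≃-trans (ℚᵘ.*≡* (trans (ℤ.*-identityʳ _) (cong (λ z → + d ℤ.* z)
        (cong +_ (sym (ℕ.*-identityʳ (suc n)))))))
      (ℚᵘ.≃-sym (toℚᵘ-fromℚᵘ (ℚᵘ.mkℚᵘ (+ d) 0))))))

  3k/3 : ∀ k → + (3 ℕ.* k) / 3 ≡ fromℕ k
  3k/3 k = *-cancelʳ-≡ (fromℕ 3) (trans (/-cancel (3 ℕ.* k) 3) (trans (fromℕ-* 3 k) (*-comm (fromℕ 3) (fromℕ k))))
    where
    *-cancelʳ-≡ : ∀ {p q} r .{{_ : NonZero r}} → p * r ≡ q * r → p ≡ q
    *-cancelʳ-≡ {p} {q} r eq = trans (sym (undo p)) (trans (cong (_* 1/ r) eq) (undo q))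
      where
      undo : ∀ p → p * r * 1/ r ≡ p
      undo p = trans (*-assoc p r (1/ r)) (trans (cong (p *_) (*-inverseʳ r)) (*-identityʳ p))

  -- An upper witness for 2^(-γ) comes with a rational exponent above -γ, hence above -c, and powers
  -- of 2 are monotone in the exponent.
  2^-neg> : ∀ γ c → upper γ (fromℕ c) → ∀ {q} → upper (2^ negʳ γ) q → ½ ^ℚ c < q
  2^-neg> γ c γ<c {q} (e , r , -γ<e , r<q , 0≤r , r≥) with ½ ^ℚ c ≤? r
  ... | yes ½^c≤r = ≤-<-trans ½^c≤r r<q
  ... | no  ½^c≰r = ⊥-elim (2^-disjoint (ℚᵘ.mkℚᵘ (ℤ.- (+ c)) 0) e -c<e 0≤r (≰⇒> ½^c≰r) (^-nn (<⇒≤ 0<½) c)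
      (≤-reflexive (trans (*-identityʳ (½ ^ℚ c)) (sym (exp2-neg c)))) r≥)
    where
    -e<c : 0ℚ - fromℚᵘ e < fromℕ c
    -e<c = lower<upper γ -γ<e γ<c
    -c<e : (ℤ.- (+ c)) / 1 < fromℚᵘ e
    -c<e = subst₂ _<_
      (solve 2 (λ c e → (c :+ e) :+ (con 0ℚ :- e) := c) refl ((ℤ.- (+ c)) / 1) (fromℚᵘ e))
      (trans (solve 3 (λ -c e c → (-c :+ e) :+ c := e :+ (-c :+ c)) refl ((ℤ.- (+ c)) / 1) (fromℚᵘ e) (fromℕ c))
        (trans (cong (λ z → fromℚᵘ e + z) (trans (/1-+ (ℤ.- (+ c)) (+ c)) (cong (_/ 1) (ℤ.+-inverseˡ (+ c)))))
          (+-identityʳ (fromℚᵘ e))))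
      (+-monoʳ-< ((ℤ.- (+ c)) / 1 + fromℚᵘ e) -e<c)
      where open +-*-Solver

  -- The inequality of cuts is tested at the rational 2^(k-e): were `s` larger, that number would
  -- lie strictly below itself.
  size-bound : ∀ s k e → fromℚ (fromℕ s) ≤ʳ 2^ (fromℕ k -ʳ fromℚ (fromℕ e)) → s ℕ.* 2 ℕ.^ e ℕ.≤ 2 ℕ.^ k
  size-bound s k e s≤ = ℕ.≮⇒≥ λ 2^k<s2^e → refute (s≤ (q<s 2^k<s2^e))
    where
    open +-*-Solver
    q : ℚ
    q = exp2 (k ℤ.⊖ e)
    q<s : 2 ℕ.^ k ℕ.< s ℕ.* 2 ℕ.^ e → q < fromℕ s
    q<s lt = *-cancelʳ-<-nonNeg (2ℚ ^ℚ e) {{nonNegative (^-nn (<⇒≤ 0<2) e)}} (subst₂ _<_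
      (trans (fromℕ-^ k) (sym (exp2-⊖ k e)))
      (trans (fromℕ-* s (2 ℕ.^ e)) (cong (fromℕ s *_) (fromℕ-^ e)))
      (fromℕ-strict lt))
    refute : lower (2^ (fromℕ k -ʳ fromℚ (fromℕ e))) q → ⊥
    refute (u , r , e<k-u , q<r , 0≤r , r≤) = 2^-disjoint u (ℚᵘ.mkℚᵘ (k ℤ.⊖ e) 0) u<k-e (<⇒≤ (exp2-pos (k ℤ.⊖ e))) q<r 0≤r r≤
        (≤-reflexive (sym (*-identityʳ q)))
      where
      k-e : (k ℤ.⊖ e) / 1 ≡ fromℕ k - fromℕ e
      k-e = trans (cong (_/ 1) (sym (ℤ.m-n≡m⊖n k e))) (trans (sym (/1-+ (+ k) (ℤ.- (+ e))))
        (cong (λ z → fromℕ k + z) (-fromℕ e)))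
        where
        -fromℕ : ∀ e → (ℤ.- (+ e)) / 1 ≡ - fromℕ e
        -fromℕ e = trans (solve 2 (λ a b → a := (a :+ b) :- b) refl ((ℤ.- (+ e)) / 1) (fromℕ e))
          (trans (cong (λ z → z - fromℕ e) (trans (/1-+ (ℤ.- (+ e)) (+ e)) (cong (_/ 1) (ℤ.+-inverseˡ (+ e)))))
            (+-identityˡ (- fromℕ e)))
      u<k-e : fromℚᵘ u < (k ℤ.⊖ e) / 1
      u<k-e = subst₂ _<_ (solve 2 (λ e u → e :+ (u :- e) := u) refl (fromℕ e) (fromℚᵘ u))
        (trans (solve 3 (λ k u e → (k :- u) :+ (u :- e) := k :- e) refl (fromℕ k) (fromℚᵘ u) (fromℕ e)) (sym k-e))
        (+-monoˡ-< (fromℚᵘ u - fromℕ e) e<k-u)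

  -- Comparing a real with one integer is undecidable, but locatedness chooses between two
  -- consecutive ones. The search descends from an upper bound, and the overlap of the alternatives
  -- costs the gap of 2.
  roundUp : ∀ (x : ℝ) → ∃[ c ] upper x (fromℕ (2 ℕ.+ c)) × (c ≡ 0 ⊎ lower x (fromℕ c))
  roundUp x = let (u , x<u) = ℝ.upper-inhabited x
                  (M , u≤M) = ≤fromℕ u
              in descend M (ℝ.upper-closed x (≤-<-trans u≤M (fromℕ-<-suc (suc M))) x<u)
    where
    descend : ∀ j → upper x (fromℕ (2 ℕ.+ j)) → ∃[ c ] upper x (fromℕ (2 ℕ.+ c)) × (c ≡ 0 ⊎ lower x (fromℕ c))
    descend zero    x<2 = 0 , x<2 , inj₁ refl
    descend (suc j) x<  with ℝ.located x (fromℕ-<-suc (suc j))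
    ... | inj₁ j+1<x = suc j , x< , inj₂ j+1<x
    ... | inj₂ x<j+2 = descend j x<j+2

  slack : (ℕ → ℝ) → ℕ → ℕ
  slack γ n = 2 ℕ.+ proj₁ (roundUp (γ n))

  4[2+c]+2 : ∀ c → fromℕ 4 * fromℕ c + fromℕ 10 ≡ fromℕ (4 ℕ.* (2 ℕ.+ c) ℕ.+ 2)
  4[2+c]+2 c = trans (cong (_+ fromℕ 10) (sym (fromℕ-* 4 c)))
    (trans (sym (fromℕ-+ (4 ℕ.* c) 10)) (cong fromℕ (sym (trans (cong (ℕ._+ 2) (ℕ.*-distribˡ-+ 4 2 c))
      (trans (cong (ℕ._+ 2) (ℕ.+-comm 8 (4 ℕ.* c))) (ℕ.+-assoc (4 ℕ.* c) 8 2))))))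

  slack-littleO : ∀ γ → IsLittleO-n γ → IsLittleO-n λ n → fromℚ (fromℕ (4 ℕ.* slack γ n ℕ.+ 2))
  -- 4(2 + c) + 2 = 4c + 10, where c = 0 or c is below γ(n). Half of ε pays for 4c, whence ε/8, and
  -- the other half for the constant 10 once n is large.
  slack-littleO γ γ=o ε 0<ε = split (ε * (+ 1 / 8)) (ε * ½)
    (*-pos {ε} {+ 1 / 8} 0<ε (positive⁻¹ (+ 1 / 8))) (*-pos {ε} {½} 0<ε 0<½)
    (solve 2 (λ e n → con (fromℕ 4) :* (e :* con (+ 1 / 8) :* n) :+ e :* con ½ :* n := e :* n) refl ε)
    where
    open +-*-Solver
    split : ∀ δ δ′ → 0ℚ < δ → 0ℚ < δ′ → (∀ x → fromℕ 4 * (δ * x) + δ′ * x ≡ ε * x) →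
            ∃[ N ] ∀ n → N ℕ.≤ n → fromℚ (fromℕ (4 ℕ.* slack γ n ℕ.+ 2)) ≤ʳ fromℚ (ε * fromℕ n)
    split δ δ′ 0<δ 0<δ′ δ+δ′ = combine (γ=o δ 0<δ) (archimedean (fromℕ 10) 0<δ′)
      where
      combine : (∃[ N ] ∀ n → N ℕ.≤ n → γ n ≤ʳ fromℚ (δ * fromℕ n)) → (∃[ N ] fromℕ 10 ≤ fromℕ (suc N) * δ′) →
                ∃[ N ] ∀ n → N ℕ.≤ n → fromℚ (fromℕ (4 ℕ.* slack γ n ℕ.+ 2)) ≤ʳ fromℚ (ε * fromℕ n)
      combine (N₁ , γ≤) (N₂ , 10≤) = N₁ ℕ.⊔ suc N₂ , λ n N≤n {q} q<η → <-≤-trans {q} q<η (bound n N≤n)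
        where
        small : ∀ n c → N₁ ℕ.≤ n → c ≡ 0 ⊎ lower (γ n) (fromℕ c) → fromℕ c ≤ δ * fromℕ n
        small n c N₁≤n (inj₁ refl) = *-nn {δ} {fromℕ n} (<⇒≤ 0<δ) (fromℕ-nn n)
        small n c N₁≤n (inj₂ c<γ)  = <⇒≤ (γ≤ n N₁≤n c<γ)
        large : ∀ n → suc N₂ ℕ.≤ n → fromℕ 10 ≤ δ′ * fromℕ n
        large n N₂<n = ≤-trans 10≤ (≤-trans (*-monoʳ-≤-nonNeg δ′ {{nonNegative (<⇒≤ 0<δ′)}} (fromℕ-mono N₂<n))
          (≤-reflexive (*-comm (fromℕ n) δ′)))
        bound : ∀ n → N₁ ℕ.⊔ suc N₂ ℕ.≤ n → fromℕ (4 ℕ.* slack γ n ℕ.+ 2) ≤ ε * fromℕ n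
        bound n N≤n = subst₂ _≤_ (4[2+c]+2 (proj₁ (roundUp (γ n)))) (δ+δ′ (fromℕ n))
          (+-mono-≤ (*-monoˡ-≤-nonNeg (fromℕ 4) (small n _ (ℕ.≤-trans (ℕ.m≤m⊔n N₁ (suc N₂)) N≤n) (proj₂ (proj₂ (roundUp (γ n))))))
            (large n (ℕ.≤-trans (ℕ.m≤n⊔m N₁ (suc N₂)) N≤n)))

  -- Division of the hypothesis by 2 · 2^t · N.
  dist-bound : ∀ t d N .{{_ : ℕ.NonZero N}} → 2 ℕ.^ t ℕ.* N ℕ.≤ 2 ℕ.* N ℕ.+ 2 ℕ.* (2 ℕ.^ t ℕ.* d) →
               ½ ≤ ½ ^ℚ t + + d / N
  dist-bound t d N le = *-cancelʳ-≤-pos (fromℕ N) {{positive 0<N}} (*-cancelˡ-≤-pos (fromℕ 2 * 2ℚ ^ℚ t)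
      {{positive (*-pos (positive⁻¹ (fromℕ 2)) (^-pos 0<2 t))}} (subst₂ _≤_ left right (fromℕ-mono le)))
    where
    open +-*-Solver
    0<N : 0ℚ < fromℕ N
    0<N = <-≤-trans 0<1 (fromℕ-mono (ℕ.>-nonZero⁻¹ N))
    left : fromℕ (2 ℕ.^ t ℕ.* N) ≡ fromℕ 2 * 2ℚ ^ℚ t * (½ * fromℕ N)
    left = trans (fromℕ-* (2 ℕ.^ t) N) (trans (cong (_* fromℕ N) (fromℕ-^ t))
      (solve 2 (λ T N → T :* N := con (fromℕ 2) :* T :* (con ½ :* N)) refl (2ℚ ^ℚ t) (fromℕ N)))
    right : fromℕ (2 ℕ.* N ℕ.+ 2 ℕ.* (2 ℕ.^ t ℕ.* d)) ≡ fromℕ 2 * 2ℚ ^ℚ t * ((½ ^ℚ t + + d / N) * fromℕ N)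
    right = trans (fromℕ-+ (2 ℕ.* N) (2 ℕ.* (2 ℕ.^ t ℕ.* d))) (trans
      (cong₂ _+_ (fromℕ-* 2 N) (trans (fromℕ-* 2 (2 ℕ.^ t ℕ.* d)) (cong (fromℕ 2 *_)
        (trans (fromℕ-* (2 ℕ.^ t) d) (cong₂ _*_ (fromℕ-^ t) (sym (/-cancel d N)))))))
      (trans (cong (λ u → fromℕ 2 * u + fromℕ 2 * (2ℚ ^ℚ t * (+ d / N * fromℕ N)))
          (trans (sym (*-identityˡ (fromℕ N))) (cong (_* fromℕ N) (sym (½^*2^ t)))))
        (solve 4 (λ h T x N → con (fromℕ 2) :* (h :* T :* N) :+ con (fromℕ 2) :* (T :* (x :* N)) :=
          con (fromℕ 2) :* T :* ((h :+ x) :* N)) refl (½ ^ℚ t) (2ℚ ^ℚ t) (+ d / N) (fromℕ N))))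

  below-distance : ∀ h q d → h < ½ - q → ½ ≤ h + d → q < d
  below-distance h q d h<½-q ½≤h+d = subst₂ _<_
    (solve 2 (λ h q → h :+ (q :- h) := q) refl h q)
    (solve 3 (λ h q d → (h :+ d :- q) :+ (q :- h) := d) refl h q d)
    (+-monoˡ-< (q - h) (<-≤-trans h<½-q (+-monoˡ-≤ (- q) ½≤h+d)))
    where open +-*-Solver

-- Choice of η and passage to real inequalities.

open import Data.Bool.Base using (Bool)
open import Data.Integer.Base using (+_)
open import Data.Nat.Base using (ℕ; NonZero; _*_)
open import Data.Product.Base using (Σ; _×_)
open import Data.Rational.Base using (½; _/_)
open import Data.Vec.Base using (Vec; []; _∷_; concat)

open import Data.Nat.Base using (_+_)
open import Data.Nat.Properties using (m^n≢0)
open import Data.Product.Base using (_,_; proj₁; proj₂)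
open import Data.Rational.Properties using (<-≤-trans)
open import Relation.Binary.PropositionalEquality using (subst)

corollary18 : ∀ {c ℓ₁ ℓ₂} (γ : ℕ → ℝ) → (∀ n → 0ʳ ≤ʳ γ n) → IsLittleO-n γ →
    Σ (ℕ → ℝ) λ η → (∀ n → 0ʳ ≤ʳ η n) × IsLittleO-n η ×
    (∀ (k : ℕ) .{{_ : NonZero k}} → let n = 3 * k in
    (F : BinaryField c ℓ₁ ℓ₂ k) → let open BinaryField F in
    (φ : Vec Bool k → Carrier) → IsLinearIsomorphism F φ →
    (f : Vec Bool n → Bool) →
    (∀ x y z → ι F (f (concat (x ∷ y ∷ z ∷ []))) ≈ Tr F (φ x *ᶠ φ y *ᶠ φ z)) →
    (g : Vec Bool n → Bool) (P : LBP n) →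
    StronglyReadOnce P → Computes P g →
    fromℚ (+ size P / 1) ≤ʳ 2^ ((+ n / 3) -ʳ η n) →
    (½ -ʳ (2^ (negʳ (γ n)))) ≤ʳ fromℚ (dist f g))
corollary18 γ _ γ=o =
  -- `slack γ n` is the t of the overview: above γ(n), so that 2^(-t) < 2^(-γ(n)), and at most 2
  -- more than a natural that is 0 or below γ(n).
  (λ n → fromℚ (fromℕ (4 * slack γ n + 2))) ,
  (λ n q<0 → <-≤-trans q<0 (fromℕ-nn (4 * slack γ n + 2))) ,
  slack-littleO γ γ=o ,
  -- The conclusion compares lower cuts: the last hypothesis unfolds to ½ - q being an upper bound
  -- of 2^(-γ(n)).
  λ k F φ iso f f-trace g P read-once computes size≤ {q} q<½-2^-γ →
    let n = 3 * k
        t = slack γ n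
        size-small = size-bound (size P) k (4 * t + 2)
          (subst (λ x → fromℚ (+ size P / 1) ≤ʳ 2^ (x -ʳ fromℚ (fromℕ (4 * t + 2)))) (3k/3 k) size≤)
    in below-distance (½ ^ℚ t) q (dist f g)
      (2^-neg> (γ n) t (proj₁ (proj₂ (roundUp (γ n)))) q<½-2^-γ)
      (dist-bound t (disagreements f g) (2 ^ n) {{m^n≢0 2 n}}
        (many-disagreements F φ iso f f-trace g P read-once computes t size-small))
  where
  open Exp2 using (fromℕ; fromℕ-nn)
  open Counting
  open Reals
  open import Data.Nat.Base using (_^_)
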